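{- Let $k\ge 2$ be an integer and let $\Gamma$ be a connected bipartite $k$-regular graph with $v$ vertices and biadjacency matrix $\boldsymbol{N}$. Let $\{\pm\tau_0,\ldots,\pm\tau_d\}$ be the set of distinct eigenvalues of the adjacency matrix of $\Gamma$, where $\tau_0=k$ and the $\tau_i\ge 0$ are distinct. Suppose there exists a real polynomial $f(x)=\sum_{i=0}^{t} f_i\,\mathscr{F}_{0,i}(x)$ such that $f(k^2)>0$, $f(\tau_i^2)\le 0$ for each $i\in\{1,\ldots,d\}$, $f_0>0$, and $f_j\ge 0$ for each $j\in\{1,\ldots,t\}$. Then $$v\le \frac{2f(k^2)}{f_0}.$$ Equality holds if and only if $f(\tau_i^2)=0$ for each $i\in\{1,\ldots,d\}$ and, for each $j\in\{1,\ldots,t\}$, $\mathrm{tr}(f_j\mathscr{F}_{0,j}(\boldsymbol{N}\boldsymbol{N}^{\top}))=0$ and $\mathrm{tr}(f_j\mathscr{F}_{0,j}(\boldsymbol{N}^{\top}\boldsymbol{N}))=0$. If equality holds and $f_j>0$ for each $j\in\{1,\ldots,t\}$, then the girth of $\Gamma$ is at least $2t+2$.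
   Context: Graphs are finite and simple. For a connected regular bipartite graph, the adjacency matrix can be written (ordering vertices by the two colour classes) as $\boldsymbol{A}=\begin{pmatrix}\boldsymbol{O}&\boldsymbol{N}\\ \boldsymbol{N}^{\top}&\boldsymbol{O}\end{pmatrix}$; the matrix $\boldsymbol{N}$ is called the biadjacency matrix. For the integer $k\ge 2$ define polynomials $F_i(x)=F_i^{(k)}(x)$ by $F_0(x)=1$, $F_1(x)=x$, $F_2(x)=x^2-k$, and $F_i(x)=xF_{i-1}(x)-(k-1)F_{i-2}(x)$ for $i\ge 3$. The polynomial $F_{2i}$ is even, and $\mathscr{F}_{0,i}$ denotes the polynomial of degree $i$ with $\mathscr{F}_{0,i}(x^2)=F_{2i}(x)$. Thus $\mathscr{F}_{0,0}(x)=1$, $\mathscr{F}_{0,1}(x)=x-k$, $\mathscr{F}_{0,2}(x)=x^2-(3k-2)x+k(k-1)$, and $\mathscr{F}_{0,i}(x)=(x-2k+2)\mathscr{F}_{0,i-1}(x)-(k-1)^2\mathscr{F}_{0,i-2}(x)$ for $i\ge 3$. -}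

module Defs where

open import Algebra.Bundles using (CommutativeRing; CommutativeSemiring)
open import Algebra.Structures using (IsCommutativeRing)
import Algebra.Definitions.RawMonoid as RawMonoidDefs
open import Data.Bool.Base using (if_then_else_)
open import Data.Fin.Base using (Fin; zero; suc; toℕ)
import Data.Fin.Properties as Fin
open import Data.List.Base using (List; []; _∷_; _∷ʳ_; length)
open import Data.List.Relation.Unary.Linked using (Linked)
open import Data.List.Relation.Unary.Unique.Propositional using (Unique)
open import Data.Nat.Base as ℕ using (ℕ; zero; suc)
open import Data.Product.Base using (∃; ∃-syntax; _×_; _,_)
open import Data.Sum.Base using (_⊎_; inj₁; inj₂)
open import Data.Vec.Base using (count; allFin)
open import Data.Vec.Functional as Vector using (Vector)
open import Function.Bundles using (_↔_; _⇔_; module Inverse)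
open import Level using (Level; 0ℓ; _⊔_) renaming (suc to lsuc)
open import Relation.Binary.Construct.Closure.ReflexiveTransitive using (Star)
import Relation.Binary.Construct.NonStrictToStrict as ToStrict
open import Relation.Binary.Core using (Rel)
open import Relation.Binary.Definitions using (Decidable; Symmetric; Irreflexive)
open import Relation.Binary.PropositionalEquality.Core using (_≡_)
open import Relation.Binary.Structures using (IsDecTotalOrder)
open import Relation.Nullary.Decidable.Core using (does)
open import Relation.Nullary.Negation.Core using (¬_)
open import Relation.Unary using (Pred)

-- The classical real numbers, characterised (uniquely up to isomorphism)
-- as a Dedekind-complete ordered field.  Order and equality are decidable,
-- as they are classically.  As usual for a total inverse, 0# ⁻¹ is left
-- unspecified.

record Reals (c ℓ₁ ℓ₂ : Level) : Set (lsuc (c ⊔ ℓ₁ ⊔ ℓ₂)) where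
  infix  8 _⁻¹
  infix  8 -_
  infixl 7 _*_
  infixl 6 _+_
  infix  4 _≈_ _≤_
  field
    Carrier           : Set c
    _≈_               : Rel Carrier ℓ₁
    _≤_               : Rel Carrier ℓ₂
    _+_ _*_           : Carrier → Carrier → Carrier
    -_ _⁻¹            : Carrier → Carrier
    0# 1#             : Carrier
    isCommutativeRing : IsCommutativeRing _≈_ _+_ _*_ -_ 0# 1#
    isDecTotalOrder   : IsDecTotalOrder _≈_ _≤_
    0≉1               : ¬ 0# ≈ 1#
    ⁻¹-cong           : ∀ {x y} → x ≈ y → x ⁻¹ ≈ y ⁻¹
    *-inverseʳ        : ∀ x → ¬ x ≈ 0# → x * x ⁻¹ ≈ 1#
    +-monoˡ-≤         : ∀ {x y} z → x ≤ y → x + z ≤ y + z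
    *-nonNegative     : ∀ {x y} → 0# ≤ x → 0# ≤ y → 0# ≤ x * y

  IsUpperBound : ∀ {ℓ} → Pred Carrier ℓ → Carrier → Set (c ⊔ ℓ₂ ⊔ ℓ)
  IsUpperBound P u = ∀ x → P x → x ≤ u

  field
    supremum : (P : Pred Carrier (c ⊔ ℓ₁ ⊔ ℓ₂)) → ∃ P → ∃ (IsUpperBound P) →
               ∃[ s ] IsUpperBound P s × (∀ u → IsUpperBound P u → s ≤ u)

  commutativeRing : CommutativeRing c ℓ₁
  commutativeRing = record { isCommutativeRing = isCommutativeRing }

  open CommutativeRing commutativeRing public
    using (_-_; +-rawMonoid)

  open ToStrict _≈_ _≤_ public using (_<_)

  open RawMonoidDefs +-rawMonoid public using (sum)

  infixl 7 _/_
  _/_ : Carrier → Carrier → Carrier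
  x / y = x * y ⁻¹

  fromℕ : ℕ → Carrier
  fromℕ n = n · 1#
    where open RawMonoidDefs +-rawMonoid renaming (_×_ to _·_)

record Graph (v : ℕ) : Set₁ where
  infix 4 _~_ _~?_
  field
    _~_      : Rel (Fin v) 0ℓ
    _~?_     : Decidable _~_
    ~-sym    : Symmetric _~_
    ~-irrefl : Irreflexive _≡_ _~_

module _ {v : ℕ} (Γ : Graph v) where
  open Graph Γ

  degree : Fin v → ℕ
  degree x = count (x ~?_) (allFin v)

  Regular : ℕ → Set
  Regular k = ∀ x → degree x ≡ k

  Connected : Set
  Connected = ∀ x y → Star _~_ x y

  -- A 2-colouring presented as an ordering of the vertices by colour
  -- class: the classes are the images of Fin p and of Fin q.
  record Bipartition : Set where
    field
      p q      : ℕ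
      ordering : (Fin p ⊎ Fin q) ↔ Fin v

    left : Fin p → Fin v
    left i = Inverse.to ordering (inj₁ i)

    right : Fin q → Fin v
    right j = Inverse.to ordering (inj₂ j)

    field
      left-independent  : ∀ i i′ → ¬ left i ~ left i′
      right-independent : ∀ j j′ → ¬ right j ~ right j′

  -- The closing edge is recorded by repeating start at the end of the walk.
  record Cycle : Set where
    field
      start    : Fin v
      rest     : List (Fin v)
      distinct : Unique (start ∷ rest)
      closed   : Linked _~_ (start ∷ (rest ∷ʳ start))
      proper   : 3 ℕ.≤ length (start ∷ rest)

    cycleLength : ℕ
    cycleLength = length (start ∷ rest)

  IsGirth : ℕ → Set
  IsGirth g = (∃[ C ] Cycle.cycleLength C ≡ g) ×
              (∀ C → g ℕ.≤ Cycle.cycleLength C)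

-- Needed only for 𝓕-spec.
private
  module Identities {c ℓ} (S : CommutativeSemiring c ℓ) where
    open CommutativeSemiring S using (_≈_; _+_; _*_; refl)

    open import Algebra.Solver.Ring.NaturalCoefficients.Default S

    +-step : ∀ a b x p q → a + b + x * (p + q) ≈ a + x * p + (b + x * q)
    +-step = solve 5 (λ a b x p q →
      a :+ b :+ x :* (p :+ q) := a :+ x :* p :+ (b :+ x :* q)) refl

    •-step : ∀ a b x p → a * b + x * (a * p) ≈ a * (b + x * p)
    •-step = solve 4 (λ a b x p →
      a :* b :+ x :* (a :* p) := a :* (b :+ x :* p)) refl

    *-step : ∀ a x p q → a * q + x * (p * q) ≈ (a + x * p) * q
    *-step = solve 4 (λ a x p q →
      a :* q :+ x :* (p :* q) := (a :+ x :* p) :* q) refl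

    three-two : ∀ a e → a + (a + a) + (e + e) ≈ a + (a + e) + (a + e)
    three-two = solve 2 (λ a e →
      a :+ (a :+ a) :+ (e :+ e) := a :+ (a :+ e) :+ (a :+ e)) refl

    two-two : ∀ y α e → y + (α + α) + (e + e) ≈ y + ((α + e) + (α + e))
    two-two = solve 3 (λ y α e →
      y :+ (α :+ α) :+ (e :+ e) := y :+ ((α :+ e) :+ (α :+ e))) refl

    base : ∀ x α n →
      x * x * (x * x) + (α + n + n) * (x * x) + α * n
      ≈ x * (x * (x * x + α) + n * x) + n * (x * x + α)
    base = solve 3 (λ x α n →
      x :* x :* (x :* x) :+ (α :+ n :+ n) :* (x :* x) :+ α :* n
      := x :* (x :* (x :* x :+ α) :+ n :* x) :+ n :* (x :* x :+ α)) refl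

    step : ∀ x m n p q →
      (x * x + (n + n)) * p + (n * m) * q
      ≈ x * (x * p) + n * (p + m * q) + n * p
    step = solve 5 (λ x m n p q →
      (x :* x :+ (n :+ n)) :* p :+ (n :* m) :* q
      := x :* (x :* p) :+ n :* (p :+ m :* q) :+ n :* p) refl

    regroup : ∀ x n p q → x * (x * p) + n * (x * q) ≈ x * (x * p + n * q)
    regroup = solve 4 (λ x n p q →
      x :* (x :* p) :+ n :* (x :* q) := x :* (x :* p :+ n :* q)) refl

module Over {c ℓ₁ ℓ₂} {{ℝ : Reals c ℓ₁ ℓ₂}} where
  open Reals ℝ

  -- Coefficient lists, constant coefficient first; trailing zeros are
  -- allowed.
  Poly : Set c
  Poly = List Carrier

  infixl 6 _+ₚ_ _-ₚ_
  infixl 7 _*ₚ_ _•ₚ_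

  _+ₚ_ : Poly → Poly → Poly
  []       +ₚ qs       = qs
  (a ∷ ps) +ₚ []       = a ∷ ps
  (a ∷ ps) +ₚ (b ∷ qs) = (a + b) ∷ (ps +ₚ qs)

  _•ₚ_ : Carrier → Poly → Poly
  a •ₚ []       = []
  a •ₚ (b ∷ qs) = (a * b) ∷ (a •ₚ qs)

  _-ₚ_ : Poly → Poly → Poly
  ps -ₚ qs = ps +ₚ (- 1#) •ₚ qs

  _*ₚ_ : Poly → Poly → Poly
  []       *ₚ qs = []
  (a ∷ ps) *ₚ qs = a •ₚ qs +ₚ (0# ∷ (ps *ₚ qs))

  constant : Carrier → Poly
  constant a = a ∷ []

  X : Poly
  X = 0# ∷ 1# ∷ []

  sumₚ : ∀ {n} → Vector Poly n → Poly
  sumₚ = Vector.foldr _+ₚ_ []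

  eval : Poly → Carrier → Carrier
  eval []       x = 0#
  eval (a ∷ ps) x = a + x * eval ps x

  Matrix : ℕ → ℕ → Set c
  Matrix m n = Fin m → Fin n → Carrier

  infixl 6 _+ᴹ_
  infixl 7 _*ᴹ_ _*ᵛ_ _•ᴹ_
  infix  9 _ᵀ

  0ᴹ : ∀ {m n} → Matrix m n
  0ᴹ i j = 0#

  1ᴹ : ∀ {n} → Matrix n n
  1ᴹ i j = if does (i Fin.≟ j) then 1# else 0#

  _+ᴹ_ : ∀ {m n} → Matrix m n → Matrix m n → Matrix m n
  (M +ᴹ N) i j = M i j + N i j

  _•ᴹ_ : ∀ {m n} → Carrier → Matrix m n → Matrix m n
  (a •ᴹ M) i j = a * M i j

  _*ᴹ_ : ∀ {l m n} → Matrix l m → Matrix m n → Matrix l n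
  (M *ᴹ N) i j = sum (λ h → M i h * N h j)

  _*ᵛ_ : ∀ {m n} → Matrix m n → Vector Carrier n → Vector Carrier m
  (M *ᵛ x) i = sum (λ j → M i j * x j)

  _ᵀ : ∀ {m n} → Matrix m n → Matrix n m
  (M ᵀ) i j = M j i

  tr : ∀ {n} → Matrix n n → Carrier
  tr M = sum (λ i → M i i)

  evalᴹ : ∀ {n} → Poly → Matrix n n → Matrix n n
  evalᴹ []       M = 0ᴹ
  evalᴹ (a ∷ ps) M = a •ᴹ 1ᴹ +ᴹ M *ᴹ evalᴹ ps M

  IsEigenvalue : ∀ {n} → Matrix n n → Carrier → Set (c ⊔ ℓ₁)
  IsEigenvalue {n} M θ =
    ∃[ x ] ¬ (∀ i → x i ≈ 0#) × (∀ i → (M *ᵛ x) i ≈ θ * x i)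

  module _ {v : ℕ} (Γ : Graph v) where
    open Graph Γ

    adjacency : Matrix v v
    adjacency x y = if does (x ~? y) then 1# else 0#

    biadjacency : (B : Bipartition Γ) →
                  Matrix (Bipartition.p B) (Bipartition.q B)
    biadjacency B i j = adjacency (left i) (right j)
      where open Bipartition B

    -- The set of eigenvalues is { ± τ i }; multiplicities play no role.
    IsSymmetricSpectrum : ∀ {n} → Vector Carrier n → Set (c ⊔ ℓ₁ ⊔ ℓ₂)
    IsSymmetricSpectrum τ =
      (∀ i → 0# ≤ τ i) ×
      (∀ i j → τ i ≈ τ j → i ≡ j) ×
      (∀ θ → IsEigenvalue adjacency θ ⇔ (∃[ i ] (θ ≈ τ i ⊎ θ ≈ - τ i)))

  F : ℕ → ℕ → Poly
  F k 0 = constant 1#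
  F k 1 = X
  F k 2 = X *ₚ X -ₚ constant (fromℕ k)
  F k (suc (suc (suc i))) =
    X *ₚ F k (suc (suc i)) -ₚ (fromℕ k - 1#) •ₚ F k (suc i)

  -- The polynomial with 𝓕 k i (x²) = F k (2i) (x); see 𝓕-spec.
  𝓕 : ℕ → ℕ → Poly
  𝓕 k 0 = constant 1#
  𝓕 k 1 = X -ₚ constant (fromℕ k)
  𝓕 k 2 =
    X *ₚ X -ₚ (fromℕ 3 * fromℕ k - fromℕ 2) •ₚ X
           +ₚ constant (fromℕ k * (fromℕ k - 1#))
  𝓕 k (suc (suc (suc i))) =
    (X -ₚ constant (fromℕ 2 * fromℕ k) +ₚ constant (fromℕ 2))
      *ₚ 𝓕 k (suc (suc i))
    -ₚ ((fromℕ k - 1#) * (fromℕ k - 1#)) •ₚ 𝓕 k (suc i)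

  𝓕-combination : ℕ → ∀ {n} → Vector Carrier n → Poly
  𝓕-combination k a = sumₚ (λ i → a i •ₚ 𝓕 k (toℕ i))

  private
    module R = CommutativeRing commutativeRing
    module I = Identities R.commutativeSemiring

    open import Algebra.Properties.Ring R.ring
      using (-1*x≈-x; -‿distribˡ-*; -‿distribʳ-*; -‿involutive)
    open import Algebra.Properties.AbelianGroup R.+-abelianGroup
      using () renaming (⁻¹-∙-comm to -‿+-comm)
    open import Relation.Binary.Reasoning.Setoid R.setoid

    eval-+ : ∀ ps qs x → eval (ps +ₚ qs) x ≈ eval ps x + eval qs x
    eval-+ []       qs       x = R.sym (R.+-identityˡ _)
    eval-+ (a ∷ ps) []       x = R.sym (R.+-identityʳ _)
    eval-+ (a ∷ ps) (b ∷ qs) x =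
      R.trans (R.+-congˡ (R.*-congˡ (eval-+ ps qs x)))
              (I.+-step a b x (eval ps x) (eval qs x))

    eval-• : ∀ a ps x → eval (a •ₚ ps) x ≈ a * eval ps x
    eval-• a []       x = R.sym (R.zeroʳ a)
    eval-• a (b ∷ ps) x =
      R.trans (R.+-congˡ (R.*-congˡ (eval-• a ps x)))
              (I.•-step a b x (eval ps x))

    eval-- : ∀ ps qs x → eval (ps -ₚ qs) x ≈ eval ps x - eval qs x
    eval-- ps qs x =
      R.trans (eval-+ ps _ x)
              (R.+-congˡ (R.trans (eval-• (- 1#) qs x) (-1*x≈-x _)))

    eval-* : ∀ ps qs x → eval (ps *ₚ qs) x ≈ eval ps x * eval qs x
    eval-* []       qs x = R.sym (R.zeroˡ _)
    eval-* (a ∷ ps) qs x = begin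
      eval (a •ₚ qs +ₚ (0# ∷ (ps *ₚ qs))) x
        ≈⟨ eval-+ (a •ₚ qs) _ x ⟩
      eval (a •ₚ qs) x + (0# + x * eval (ps *ₚ qs) x)
        ≈⟨ R.+-cong (eval-• a qs x)
             (R.trans (R.+-identityˡ _) (R.*-congˡ (eval-* ps qs x))) ⟩
      a * eval qs x + x * (eval ps x * eval qs x)
        ≈⟨ I.*-step a x (eval ps x) (eval qs x) ⟩
      (a + x * eval ps x) * eval qs x ∎

    eval-constant : ∀ a x → eval (constant a) x ≈ a
    eval-constant a x = R.trans (R.+-congˡ (R.zeroʳ x)) (R.+-identityʳ a)

    eval-X : ∀ x → eval X x ≈ x
    eval-X x = begin
      0# + x * (1# + x * 0#)  ≈⟨ R.+-identityˡ _ ⟩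
      x * (1# + x * 0#)       ≈⟨ R.*-congˡ (eval-constant 1# x) ⟩
      x * 1#                  ≈⟨ R.*-identityʳ x ⟩
      x                       ∎

    infixl 6 _⟨+⟩_ _⟨-⟩_
    infixl 7 _⟨*⟩_

    _⟨+⟩_ : ∀ {ps qs x a b} → eval ps x ≈ a → eval qs x ≈ b →
            eval (ps +ₚ qs) x ≈ a + b
    _⟨+⟩_ {ps} {qs} {x} e f = R.trans (eval-+ ps qs x) (R.+-cong e f)

    _⟨-⟩_ : ∀ {ps qs x a b} → eval ps x ≈ a → eval qs x ≈ b →
            eval (ps -ₚ qs) x ≈ a - b
    _⟨-⟩_ {ps} {qs} {x} e f =
      R.trans (eval-- ps qs x) (R.+-cong e (R.-‿cong f))

    _⟨*⟩_ : ∀ {ps qs x a b} → eval ps x ≈ a → eval qs x ≈ b →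
            eval (ps *ₚ qs) x ≈ a * b
    _⟨*⟩_ {ps} {qs} {x} e f = R.trans (eval-* ps qs x) (R.*-cong e f)

    ⟨•⟩ : ∀ a {ps x b} → eval ps x ≈ b → eval (a •ₚ ps) x ≈ a * b
    ⟨•⟩ a {ps} {x} e = R.trans (eval-• a ps x) (R.*-congˡ e)

    module _ (k : ℕ) (x : Carrier) where
      κ : Carrier
      κ = fromℕ k

      f : ℕ → Carrier
      f i = eval (F k i) x

      f₂ : f 2 ≈ x * x - κ
      f₂ = _⟨-⟩_ {X *ₚ X} {constant κ}
             (_⟨*⟩_ {X} {X} (eval-X x) (eval-X x)) (eval-constant κ x)

      f₃₊ : ∀ i → f (3 ℕ.+ i) ≈ x * f (2 ℕ.+ i) - (κ - 1#) * f (1 ℕ.+ i)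
      f₃₊ i = _⟨-⟩_ {X *ₚ F k (2 ℕ.+ i)} {(κ - 1#) •ₚ F k (1 ℕ.+ i)}
                (_⟨*⟩_ {X} {F k (2 ℕ.+ i)} (eval-X x) R.refl)
                (⟨•⟩ (κ - 1#) {F k (1 ℕ.+ i)} R.refl)

      f₃₊′ : ∀ i → f (3 ℕ.+ i) ≈ x * f (2 ℕ.+ i) + - (κ - 1#) * f (1 ℕ.+ i)
      f₃₊′ i = R.trans (f₃₊ i) (R.+-congˡ (-‿distribˡ-* _ _))

      move : ∀ {a b d} → a ≈ b - d → b ≈ a + d
      move {a} {b} {d} e = R.sym (begin
        a + d           ≈⟨ R.+-congʳ e ⟩
        b - d + d       ≈⟨ R.+-assoc b (- d) d ⟩
        b + (- d + d)   ≈⟨ R.+-congˡ (R.-‿inverseˡ d) ⟩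
        b + 0#          ≈⟨ R.+-identityʳ b ⟩
        b               ∎)

    fromℕ2≈ : fromℕ 2 ≈ 1# + 1#
    fromℕ2≈ = R.+-congˡ (R.+-identityʳ 1#)

    -fromℕ2≈ : - fromℕ 2 ≈ - 1# - 1#
    -fromℕ2≈ = R.trans (R.-‿cong fromℕ2≈) (R.sym (-‿+-comm 1# 1#))

    fromℕ2* : ∀ a → fromℕ 2 * a ≈ a + a
    fromℕ2* a = R.trans (R.*-congʳ fromℕ2≈)
      (R.trans (R.distribʳ a 1# 1#)
               (R.+-cong (R.*-identityˡ a) (R.*-identityˡ a)))

    fromℕ3* : ∀ a → fromℕ 3 * a ≈ a + (a + a)
    fromℕ3* a = R.trans (R.distribʳ a 1# (fromℕ 2))
      (R.+-cong (R.*-identityˡ a) (fromℕ2* a))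

  𝓕-spec : ∀ k i x → eval (𝓕 k i) (x * x) ≈ eval (F k (i ℕ.* 2)) x
  𝓕-spec k 0 x =
    R.trans (eval-constant 1# (x * x)) (R.sym (eval-constant 1# x))
  𝓕-spec k 1 x = R.trans
    (_⟨-⟩_ {X} {constant (fromℕ k)} (eval-X (x * x))
      (eval-constant (fromℕ k) (x * x)))
    (R.sym (f₂ k x))
  𝓕-spec k 2 x = begin
    eval (𝓕 k 2) y
      ≈⟨ _⟨+⟩_ {X *ₚ X -ₚ b •ₚ X} {constant (a * m)}
           (_⟨-⟩_ {X *ₚ X} {b •ₚ X}
             (_⟨*⟩_ {X} {X} (eval-X y) (eval-X y))
             (⟨•⟩ b {X} (eval-X y)))
           (eval-constant (a * m) y) ⟩
    y * y - b * y + a * m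
      ≈⟨ R.+-cong (R.+-congˡ (R.trans (-‿distribˡ-* b y) (R.*-congʳ -b)))
           am ⟩
    y * y + (- a + n + n) * y + - a * n
      ≈⟨ I.base x (- a) n ⟩
    x * (x * (x * x - a) + n * x) + n * (x * x - a)
      ≈⟨ R.+-cong (R.*-congˡ (R.+-cong (R.*-congˡ (f₂ k x))
           (R.*-congˡ (eval-X x))))
           (R.*-congˡ (f₂ k x)) ⟨
    x * (x * f k x 2 + n * f k x 1) + n * f k x 2
      ≈⟨ R.+-congʳ (R.*-congˡ (f₃₊′ k x 0)) ⟨
    x * f k x 3 + n * f k x 2
      ≈⟨ f₃₊′ k x 1 ⟨
    f k x 4 ∎
    where
    y = x * x
    a = fromℕ k
    m = a - 1#
    n = - m
    b = fromℕ 3 * a - fromℕ 2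

    -b : - b ≈ - a + n + n
    -b = begin
      - b                           ≈⟨ R.-‿cong (R.+-cong (fromℕ3* a) -fromℕ2≈) ⟩
      - (a + (a + a) + (- 1# - 1#)) ≈⟨ R.-‿cong (I.three-two a (- 1#)) ⟩
      - (a + m + m)                 ≈⟨ -‿+-comm (a + m) m ⟨
      - (a + m) - m                 ≈⟨ R.+-congʳ (-‿+-comm a m) ⟨
      - a + n + n                   ∎

    am : a * m ≈ - a * n
    am = begin
      a * m       ≈⟨ -‿involutive (a * m) ⟨
      - - (a * m) ≈⟨ R.-‿cong (-‿distribʳ-* a m) ⟩
      - (a * n)   ≈⟨ -‿distribˡ-* a n ⟩
      - a * n     ∎
  𝓕-spec k (suc (suc (suc i))) x = begin
    eval (𝓕 k (3 ℕ.+ i)) y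
      ≈⟨ _⟨-⟩_ {L *ₚ 𝓕 k (2 ℕ.+ i)} {(m * m) •ₚ 𝓕 k (1 ℕ.+ i)}
           (_⟨*⟩_ {L} {𝓕 k (2 ℕ.+ i)}
             (_⟨+⟩_ {X -ₚ constant (fromℕ 2 * a)} {constant (fromℕ 2)}
               (_⟨-⟩_ {X} {constant (fromℕ 2 * a)} (eval-X y)
                 (eval-constant _ y))
               (eval-constant _ y))
             (𝓕-spec k (suc (suc i)) x))
           (⟨•⟩ _ {𝓕 k (1 ℕ.+ i)} (𝓕-spec k (suc i) x)) ⟩
    (y - fromℕ 2 * a + fromℕ 2) * p - (m * m) * q
      ≈⟨ R.+-cong (R.*-congʳ leading)
           (R.trans (-‿distribˡ-* _ q) (R.*-congʳ (-‿distribˡ-* m m))) ⟩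
    (y + (n + n)) * p + (n * m) * q
      ≈⟨ I.step x m n p q ⟩
    x * (x * p) + n * (p + m * q) + n * p
      ≈⟨ R.+-congʳ (R.+-congˡ (R.*-congˡ
           (move k x (f₃₊ k x (1 ℕ.+ j))))) ⟨
    x * (x * p) + n * (x * f k x (3 ℕ.+ j)) + n * p
      ≈⟨ R.+-congʳ (I.regroup x n p (f k x (3 ℕ.+ j))) ⟩
    x * (x * p + n * f k x (3 ℕ.+ j)) + n * p
      ≈⟨ R.+-congʳ (R.*-congˡ (f₃₊′ k x (2 ℕ.+ j))) ⟨
    x * f k x (5 ℕ.+ j) + n * p
      ≈⟨ f₃₊′ k x (3 ℕ.+ j) ⟨
    f k x (6 ℕ.+ j) ∎
    where
    y = x * x
    a = fromℕ k
    m = a - 1#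
    n = - m
    j = i ℕ.* 2
    p = f k x (4 ℕ.+ j)
    q = f k x (2 ℕ.+ j)
    L = X -ₚ constant (fromℕ 2 * a) +ₚ constant (fromℕ 2)

    n≈ : - a + 1# ≈ n
    n≈ = R.trans (R.+-congˡ (R.sym (-‿involutive 1#))) (-‿+-comm a (- 1#))

    leading : y - fromℕ 2 * a + fromℕ 2 ≈ y + (n + n)
    leading = begin
      y - fromℕ 2 * a + fromℕ 2
        ≈⟨ R.+-cong (R.+-congˡ (R.-‿cong (fromℕ2* a))) fromℕ2≈ ⟩
      y - (a + a) + (1# + 1#)
        ≈⟨ R.+-congʳ (R.+-congˡ (-‿+-comm a a)) ⟨
      y + (- a - a) + (1# + 1#)
        ≈⟨ I.two-two y (- a) 1# ⟩
      y + ((- a + 1#) + (- a + 1#))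
        ≈⟨ R.+-congˡ (R.+-cong n≈ n≈) ⟩
      y + (n + n) ∎

open Over public
open Reals {{...}} public
  using (Carrier; _≈_; _≤_; _<_; _*_; _/_; 0#; fromℕ)

-- Let A be the adjacency matrix; A² is block diagonal with blocks NNᵀ and NᵀN.
-- Regularity makes the entries of 𝓕 k j (A²) count the non-backtracking walks of
-- length 2j, so tr 𝓕 k j (A²) ≥ 0, with strict inequality as soon as there is a
-- cycle of length 2j. The spectral theorem gives tr f(A²) = Σ mᵢ f(τᵢ²) with all
-- mᵢ > 0, and m₀ = 2 because the eigenvectors for k² are constant on the two
-- colour classes. Computing tr f(A²) in both ways,
--   f₀ v + Σ_{j ≥ 1} fⱼ tr 𝓕 k j (A²) = 2 f(k²) + Σ_{i ≥ 1} mᵢ f(τᵢ²),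
-- where the left sum is ≥ 0 and the right one ≤ 0; every claim is read off this
-- identity. Cycles are even, so tr 𝓕 k j (A²) = 0 for 1 ≤ j ≤ t bounds the girth.

module Submission where

open import Data.Fin.Base using (Fin; zero; suc; toℕ)
open import Data.Nat.Base as ℕ using (ℕ; suc)
open import Data.Product.Base using (∃-syntax; _×_)
open import Data.Vec.Functional using (Vector)
open import Function.Bundles using (_⇔_)

open import Algebra.Bundles using (CommutativeRing)
import Algebra.Properties.AbelianGroup
import Algebra.Properties.Monoid.Mult.TCOptimised
import Algebra.Properties.Ring
import Algebra.Properties.Semiring.Mult.TCOptimised
import Algebra.Properties.Semiring.Sum
import Algebra.Solver.Ring
open import Algebra.Solver.Ring.AlmostCommutativeRing using (fromCommutativeRing; _-Raw-AlmostCommutative⟶_)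
open import Data.Bool.Base using (Bool; true; false; not; if_then_else_)
import Data.Bool.Properties as Bool
open import Data.Fin.Base using (fromℕ<; punchIn; punchOut; splitAt)
import Data.Fin.Properties as Fin
open import Data.Integer.Base as ℤ using (ℤ; +_; -[1+_])
import Data.Integer.Properties as ℤ
open import Data.List.Base using (List; []; _∷_; _∷ʳ_; length; lookup)
open import Data.List.Membership.DecPropositional using (_∈?_)
open import Data.List.Membership.Propositional using (_∈_)
open import Data.List.Membership.Propositional.Properties using (∈-lookup)
open import Data.List.Relation.Unary.All as All using (All; []; _∷_)
open import Data.List.Relation.Unary.All.Properties using (¬Any⇒All¬)
open import Data.List.Relation.Unary.AllPairs using ([]; _∷_)
open import Data.List.Relation.Unary.Any using (here; there)
open import Data.List.Relation.Unary.Linked as Linked using (Linked; [-]; _∷_)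
open import Data.List.Relation.Unary.Unique.DecPropositional using (unique?)
open import Data.List.Relation.Unary.Unique.Propositional using (Unique)
open import Data.Maybe.Base as Maybe using (Maybe)
open import Data.Nat.Base using (zero; s≤s; z≤n)
import Data.Nat.Properties as ℕ
open import Data.Product.Base using (∃; Σ-syntax; _,_; proj₁; proj₂)
import Data.Sign.Base as Sign
open import Data.Sum.Base as Sum using (_⊎_; inj₁; inj₂)
import Data.Sum.Properties as Sum
import Data.Vec.Base as Vec
open import Data.Vec.Functional as Vector using (removeAt)
open import Data.Vec.Functional.Properties using (removeAt-punchOut)
open import Function.Base using (_∘_)
open import Function.Bundles using (mk⇔; module Equivalence; module Inverse)
open import Function.Construct.Composition using (_↔-∘_)
open import Level using (Lift; lift; lower; _⊔_)
open import Relation.Binary.Bundles using (Poset)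
open import Relation.Binary.Construct.Closure.ReflexiveTransitive as Star using (Star)
open import Relation.Binary.Core using (Rel)
open import Relation.Binary.PropositionalEquality.Core as ≡ using (_≡_)
import Relation.Binary.Reasoning.PartialOrder
import Relation.Binary.Reasoning.Setoid
open import Relation.Binary.Structures using (IsDecTotalOrder)
open import Relation.Nullary.Decidable using (Dec; yes; no; does; map′; ¬?; _×-dec_; dec-true; dec-false; dec⇒maybe)
open import Relation.Nullary.Negation.Core using (¬_; contradiction)
open import Relation.Unary using (Pred; Decidable)

open import Defs using (Reals; module Reals; module Over; Graph; module Graph; Regular; Connected; Bipartition; module Bipartition; Cycle; module Cycle; IsGirth)

-- Completeness is given only as the existence of suprema; square roots, roots of polynomials and
-- compactness of the sphere would all have to be derived from it. The spectral theorem is therefore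
-- proved without them, in the form that traces need: every unit vector is a sum of eigenvectors of
-- A², one for each σ i = τ i². The τ i are nonnegative, so the σ i stay distinct. Let G be the
-- product of all A² - σ i. It is self-adjoint, commutes with A and kills every eigenvector of A, so
-- its image contains none. If the image were nonzero, there would be a greatest λ₀ with A - λ₀
-- positive semidefinite on it; the Fredholm alternative inverts A - λ₀ there, and a bounded inverse
-- leaves room for a larger λ₀. Hence G = 0, and dividing by the differences of the σ i splits each
-- unit vector. By orthogonality the pieces are projections, and mᵢ is the trace of one of them.

-- A ring solver with integer coefficients

module IntegerCoefficients {c ℓ} (R : CommutativeRing c ℓ) where
  open CommutativeRing R
  open Algebra.Properties.Ring ring using (-0#≈0#; -‿distribˡ-*; -‿distribʳ-*; -‿involutive)
  open Algebra.Properties.AbelianGroup +-abelianGroup using () renaming (⁻¹-∙-comm to -‿+-comm)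
  open Algebra.Properties.Monoid.Mult.TCOptimised +-monoid using (1+×; ×-homo-+) renaming (_×_ to _·_)
  open Algebra.Properties.Semiring.Mult.TCOptimised semiring using (×1-homo-*)
  open Relation.Binary.Reasoning.Setoid setoid

  -- With the optimised multiples `1 · 1#` is `1#` by computation, so `con (+ 1)` stands for `1#`
  -- itself.
  ⟦_⟧ℤ : ℤ → Carrier
  ⟦ + n ⟧ℤ      = n · 1#
  ⟦ -[1+ n ] ⟧ℤ = - (suc n · 1#)

  private
    cancel : ∀ a x y → (a + x) - (a + y) ≈ x - y
    cancel a x y = begin
      (a + x) - (a + y)       ≈⟨ +-cong (+-comm a x) (sym (-‿+-comm a y)) ⟩
      (x + a) + (- a - y)     ≈⟨ +-assoc x a _ ⟩
      x + (a + (- a - y))     ≈⟨ +-congˡ (+-assoc a (- a) (- y)) ⟨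
      x + ((a - a) - y)       ≈⟨ +-congˡ (+-congʳ (-‿inverseʳ a)) ⟩
      x + (0# - y)            ≈⟨ +-congˡ (+-identityˡ _) ⟩
      x - y                   ∎

    ⊖-homo : ∀ m n → ⟦ m ℤ.⊖ n ⟧ℤ ≈ m · 1# - n · 1#
    ⊖-homo m zero = sym (trans (+-congˡ -0#≈0#) (+-identityʳ _))
    ⊖-homo zero (suc n) = sym (+-identityˡ _)
    ⊖-homo (suc m) (suc n) = begin
      ⟦ suc m ℤ.⊖ suc n ⟧ℤ            ≡⟨ ≡.cong ⟦_⟧ℤ (ℤ.[1+m]⊖[1+n]≡m⊖n m n) ⟩
      ⟦ m ℤ.⊖ n ⟧ℤ                    ≈⟨ ⊖-homo m n ⟩
      m · 1# - n · 1#                 ≈⟨ cancel 1# _ _ ⟨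
      (1# + m · 1#) - (1# + n · 1#)   ≈⟨ +-cong (1+× m 1#) (-‿cong (1+× n 1#)) ⟨
      suc m · 1# - suc n · 1#         ∎

    +-homo : ∀ i j → ⟦ i ℤ.+ j ⟧ℤ ≈ ⟦ i ⟧ℤ + ⟦ j ⟧ℤ
    +-homo (+ m)      (+ n)      = ×-homo-+ 1# m n
    +-homo (+ m)      (-[1+ n ]) = ⊖-homo m (suc n)
    +-homo (-[1+ m ]) (+ n)      = trans (⊖-homo n (suc m)) (+-comm _ _)
    +-homo (-[1+ m ]) (-[1+ n ]) = begin
      - (suc (suc (m ℕ.+ n)) · 1#)      ≈⟨ -‿cong (1+× (suc (m ℕ.+ n)) 1#) ⟩
      - (1# + suc (m ℕ.+ n) · 1#)       ≈⟨ -‿cong (+-congˡ (×-homo-+ 1# (suc m) n)) ⟩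
      - (1# + (suc m · 1# + n · 1#))    ≈⟨ -‿cong (+-assoc _ _ _) ⟨
      - ((1# + suc m · 1#) + n · 1#)    ≈⟨ -‿cong (+-congʳ (+-comm _ _)) ⟩
      - ((suc m · 1# + 1#) + n · 1#)    ≈⟨ -‿cong (+-assoc _ _ _) ⟩
      - (suc m · 1# + (1# + n · 1#))    ≈⟨ -‿cong (+-congˡ (1+× n 1#)) ⟨
      - (suc m · 1# + suc n · 1#)       ≈⟨ -‿+-comm _ _ ⟨
      - (suc m · 1#) - suc n · 1#       ∎

    -‿homo : ∀ i → ⟦ ℤ.- i ⟧ℤ ≈ - ⟦ i ⟧ℤ
    -‿homo (+ zero)    = sym -0#≈0#
    -‿homo (+ (suc n)) = refl
    -‿homo (-[1+ n ])  = sym (-‿involutive _)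

    +◃ : ∀ n → ⟦ Sign.+ ℤ.◃ n ⟧ℤ ≈ n · 1#
    +◃ zero    = refl
    +◃ (suc n) = refl

    -◃ : ∀ n → ⟦ Sign.- ℤ.◃ n ⟧ℤ ≈ - (n · 1#)
    -◃ zero    = sym -0#≈0#
    -◃ (suc n) = refl

    *-homo : ∀ i j → ⟦ i ℤ.* j ⟧ℤ ≈ ⟦ i ⟧ℤ * ⟦ j ⟧ℤ
    *-homo (+ m) (+ n) = trans (+◃ (m ℕ.* n)) (×1-homo-* m n)
    *-homo (+ m) (-[1+ n ]) = trans (-◃ (m ℕ.* suc n))
      (trans (-‿cong (×1-homo-* m (suc n))) (-‿distribʳ-* _ _))
    *-homo (-[1+ m ]) (+ n) = trans (-◃ (suc m ℕ.* n))
      (trans (-‿cong (×1-homo-* (suc m) n)) (-‿distribˡ-* _ _))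
    *-homo (-[1+ m ]) (-[1+ n ]) = begin
      ⟦ Sign.+ ℤ.◃ (suc m ℕ.* suc n) ⟧ℤ   ≈⟨ +◃ (suc m ℕ.* suc n) ⟩
      (suc m ℕ.* suc n) · 1#              ≈⟨ ×1-homo-* (suc m) (suc n) ⟩
      suc m · 1# * suc n · 1#             ≈⟨ -‿involutive _ ⟨
      - - (suc m · 1# * suc n · 1#)       ≈⟨ -‿cong (-‿distribʳ-* _ _) ⟩
      - (suc m · 1# * - (suc n · 1#))     ≈⟨ -‿distribˡ-* _ _ ⟩
      - (suc m · 1#) * - (suc n · 1#)     ∎

    morphism : ℤ.+-*-rawRing -Raw-AlmostCommutative⟶ fromCommutativeRing R
    morphism = record
      { ⟦_⟧ = ⟦_⟧ℤ ; +-homo = +-homo ; *-homo = *-homo ; -‿homo = -‿homo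
      ; 0-homo = refl ; 1-homo = refl }

    _≟ℤ_ : ∀ i j → Maybe (⟦ i ⟧ℤ ≈ ⟦ j ⟧ℤ)
    i ≟ℤ j = Maybe.map (λ e → reflexive (≡.cong ⟦_⟧ℤ e)) (dec⇒maybe (i ℤ.≟ j))

  open Algebra.Solver.Ring ℤ.+-*-rawRing (fromCommutativeRing R) morphism _≟ℤ_ public
    using (solve; _:=_; _:+_; _:*_; _:-_; :-_; con)

-- Cycles in finite graphs

lookup-injective : ∀ {a} {A : Set a} {xs : List A} → Unique xs → ∀ {i j} → lookup xs i ≡ lookup xs j → i ≡ j
lookup-injective (x∉ ∷ u) {zero}  {zero}  e = ≡.refl
lookup-injective {xs = _ ∷ xs} (x∉ ∷ u) {zero}  {suc j} e = contradiction e (All.lookup x∉ (∈-lookup {xs = xs} j))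
lookup-injective {xs = _ ∷ xs} (x∉ ∷ u) {suc i} {zero}  e = contradiction (≡.sym e) (All.lookup x∉ (∈-lookup {xs = xs} i))
lookup-injective (x∉ ∷ u) {suc i} {suc j} e = ≡.cong suc (lookup-injective u e)

-- Pigeonhole; this is what stops the search in `cycle-exists`.
unique⇒length≤ : ∀ {n} {xs : List (Fin n)} → Unique xs → length xs ℕ.≤ n
unique⇒length≤ u = Fin.injective⇒≤ (lookup-injective u)

-- Paths are stored newest vertex first. When a path meets itself at `z`, the vertices visited since
-- then are the prefix in front of `z`, and together with `z` they form a cycle.
before : ∀ {a} {A : Set a} {z : A} {xs} → z ∈ xs → List A
before (here _)             = []
before {xs = x ∷ _} (there z∈xs) = x ∷ before z∈xs

module _ {a} {A : Set a} {z : A} where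

  linked-before : ∀ {ℓ} {R : Rel A ℓ} {xs} → Linked R xs → (z∈xs : z ∈ xs) → Linked R (before z∈xs ∷ʳ z)
  linked-before _         (here _)                      = [-]
  linked-before (r ∷ _)   (there (here ≡.refl))         = r ∷ [-]
  linked-before (r ∷ rs)  (there (there z∈xs))          = r ∷ linked-before rs (there z∈xs)

  all-before : ∀ {p} {P : Pred A p} {xs} → All P xs → (z∈xs : z ∈ xs) → All P (before z∈xs)
  all-before _        (here _)     = []
  all-before (p ∷ ps) (there z∈xs) = p ∷ all-before ps z∈xs

  unique-before : ∀ {xs} → Unique xs → (z∈xs : z ∈ xs) → Unique (z ∷ before z∈xs)
  unique-before _        (here _) = [] ∷ []
  unique-before (x∉ ∷ u) (there z∈xs) with unique-before u z∈xs
  ... | z∉ ∷ u′ = (All.lookup x∉ z∈xs ∘ ≡.sym ∷ z∉) ∷ all-before x∉ z∈xs ∷ u′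

-- There are finitely many lists of a given length over `Fin n`. This makes the existence of a cycle
-- of given length decidable, as `least` requires.
any-list? : ∀ {n p} {P : Pred (List (Fin n)) p} → Decidable P → ∀ m → Dec (∃[ xs ] length xs ≡ m × P xs)
any-list? {P = P} P? zero = map′ (λ p → [] , ≡.refl , p) (λ { ([] , _ , p) → p }) (P? [])
any-list? P? (suc m) = map′
  (λ { (x , xs , ≡.refl , p) → x ∷ xs , ≡.refl , p })
  (λ { (x ∷ xs , ≡.refl , p) → x , xs , ≡.refl , p })
  (Fin.any? (λ x → any-list? (P? ∘ (x ∷_)) m))

least : ∀ {p} {P : Pred ℕ p} → Decidable P → ∀ {n} → P n → ∃[ g ] P g × (∀ m → P m → g ℕ.≤ m)
least {P = P} P? {n} Pn with below (suc n)
  where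
  below : ∀ n → (∀ m → m ℕ.< n → ¬ P m) ⊎ (∃[ g ] P g × (∀ m → P m → g ℕ.≤ m))
  below zero = inj₁ (λ _ ())
  below (suc n) with below n
  ... | inj₂ found = inj₂ found
  ... | inj₁ none with P? n
  ...   | yes Pn = inj₂ (n , Pn , λ m Pm → ℕ.≮⇒≥ (λ m<n → none m m<n Pm))
  ...   | no ¬Pn = inj₁ none′
    where
    none′ : ∀ m → m ℕ.< suc n → ¬ P m
    none′ m (s≤s m≤n) Pm with ℕ.m≤n⇒m<n∨m≡n m≤n
    ... | inj₁ m<n     = none m m<n Pm
    ... | inj₂ ≡.refl  = ¬Pn Pm
... | inj₁ none  = contradiction Pn (none n (ℕ.n<1+n n))
... | inj₂ found = found

alternate : ℕ → Bool → Bool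
alternate zero    b = b
alternate (suc n) b = alternate n (not b)

alternate-even : ∀ n {b} → b ≡ alternate n b → ∃[ j ] n ≡ j ℕ.* 2
alternate-even zero          e = 0 , ≡.refl
alternate-even (suc zero)    e = contradiction e (Bool.not-¬ ≡.refl)
alternate-even (suc (suc n)) {b} e with alternate-even n (≡.trans e (≡.cong (alternate n) (Bool.not-involutive b)))
... | j , ≡.refl = suc j , ≡.refl

module _ {v} (Γ : Graph v) where
  open Graph Γ

  linked-alternates : (colour : Fin v → Bool) → (∀ {x y} → x ~ y → colour y ≡ not (colour x)) →
                      ∀ x ys z → Linked _~_ (x ∷ (ys ∷ʳ z)) → colour z ≡ alternate (suc (length ys)) (colour x)
  linked-alternates colour flips x []       z (x~z ∷ _) = flips x~z
  linked-alternates colour flips x (y ∷ ys) z (x~y ∷ l) = ≡.trans (linked-alternates colour flips y ys z l)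
    (≡.cong (alternate (suc (length ys))) (flips x~y))

  -- Once around the cycle, the colour of the start is negated once per edge and must come back to
  -- itself.
  even-cycle : (colour : Fin v → Bool) → (∀ {x y} → x ~ y → colour y ≡ not (colour x)) →
               ∀ C → ∃[ j ] Cycle.cycleLength {Γ = Γ} C ≡ j ℕ.* 2
  even-cycle colour flips C = alternate-even (Cycle.cycleLength C)
    (linked-alternates colour flips _ (Cycle.rest C) _ (Cycle.closed C))

  -- A path is prolonged, never turning back, until it meets itself.
  cycle-exists : (∀ x y → ∃[ z ] y ~ z × ¬ z ≡ x) → Fin v → Cycle Γ
  cycle-exists onward u =
    let w , u~w , w≢u = onward u u
    in search v w u [] (~-sym u~w ∷ [-]) ((w≢u ∷ []) ∷ [] ∷ []) (ℕ.m<m+n v (s≤s z≤n))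
    where
    search : ∀ n y x xs → Linked _~_ (y ∷ x ∷ xs) → Unique (y ∷ x ∷ xs) →
             v ℕ.< n ℕ.+ length (y ∷ x ∷ xs) → Cycle Γ
    -- The fuel `n` and the length of the path together exceed `v`; with no fuel left the path would
    -- have more than `v` distinct vertices.
    search zero    y x xs l u v< = contradiction v< (ℕ.≤⇒≯ (unique⇒length≤ u))
    search (suc n) y x xs l u v< with onward x y
    -- Only `xs` needs searching: `z` is not `y` by irreflexivity and not `x` by the choice of
    -- `onward`. A vertex met again therefore closes a cycle with at least the three vertices `z`,
    -- `y` and `x`.
    ... | z , y~z , z≢x with _∈?_ Fin._≟_ z xs
    ...   | no z∉xs = search n z y (x ∷ xs) (~-sym y~z ∷ l)
      (((λ z≡y → ~-irrefl (≡.sym z≡y) y~z) ∷ z≢x ∷ ¬Any⇒All¬ xs z∉xs) ∷ u)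
      (≡.subst (v ℕ.<_) (≡.sym (ℕ.+-suc n (length (y ∷ x ∷ xs)))) v<)
    ...   | yes z∈xs = record
      { start    = z
      ; rest     = y ∷ x ∷ before z∈xs
      ; distinct = unique-before u (there (there z∈xs))
      ; closed   = ~-sym y~z ∷ linked-before l (there (there z∈xs))
      ; proper   = s≤s (s≤s (s≤s z≤n))
      }

  cycleOfLength? : Decidable (λ l → ∃[ C ] Cycle.cycleLength {Γ = Γ} C ≡ l)
  cycleOfLength? zero = no λ ()
  cycleOfLength? (suc m) = map′
    (λ { (s , xs , ≡.refl , u , l , p) → record { start = s ; rest = xs ; distinct = u ; closed = l ; proper = p } , ≡.refl })
    (λ { (record { start = s ; rest = xs ; distinct = u ; closed = l ; proper = p } , ≡.refl) → s , xs , ≡.refl , u , l , p })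
    (Fin.any? λ s → any-list? (λ xs → unique? Fin._≟_ (s ∷ xs) ×-dec
      (Linked.linked? _~?_ (s ∷ (xs ∷ʳ s)) ×-dec 3 ℕ.≤? length (s ∷ xs))) m)

  girth-exists : Cycle Γ → ∃[ g ] IsGirth Γ g
  girth-exists C with least cycleOfLength? (C , ≡.refl)
  ... | g , has-cycle , minimal = g , has-cycle , λ C′ → minimal _ (C′ , ≡.refl)

-- Ordered field arithmetic and finite sums

module Analysis {c ℓ₁ ℓ₂} (ℝ : Reals c ℓ₁ ℓ₂) where
  open Reals ℝ public
  open Over {{ℝ}} public hiding (_*ᵛ_; X; F)
  open CommutativeRing commutativeRing public
    hiding (Carrier; _≈_; _+_; _*_; -_; 0#; 1#; isCommutativeRing; _-_; +-rawMonoid; zero)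
  open IsDecTotalOrder isDecTotalOrder public
    using (_≟_; _≤?_; total; antisym; ≤-respˡ-≈; ≤-respʳ-≈; isPartialOrder)
    renaming (refl to ≤-refl; trans to ≤-trans; reflexive to ≤-reflexive)
  open IntegerCoefficients commutativeRing public using (solve; _:=_; _:+_; _:*_; _:-_; :-_; con)
  open Algebra.Properties.Semiring.Sum semiring public
    using (sum-cong-≋; sum-replicate; sum-replicate-zero; sum-permute; sum-remove; ∑-distrib-+; ∑-comm; *-distribˡ-sum; *-distribʳ-sum)

  poset : Poset _ _ _
  poset = record { isPartialOrder = isPartialOrder }

  module ≈-Reasoning = Relation.Binary.Reasoning.Setoid setoid
  module ≤-Reasoning = Relation.Binary.Reasoning.PartialOrder poset

  +-mono-≤ : ∀ {x y z w} → x ≤ y → z ≤ w → x + z ≤ y + w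
  +-mono-≤ {x} {y} {z} {w} x≤y z≤w = begin
    x + z ≤⟨ +-monoˡ-≤ z x≤y ⟩
    y + z ≈⟨ +-comm y z ⟩
    z + y ≤⟨ +-monoˡ-≤ y z≤w ⟩
    w + y ≈⟨ +-comm w y ⟩
    y + w ∎
    where open ≤-Reasoning

  +-nonNegative : ∀ {x y} → 0# ≤ x → 0# ≤ y → 0# ≤ x + y
  +-nonNegative 0≤x 0≤y = ≤-respˡ-≈ (+-identityˡ 0#) (+-mono-≤ 0≤x 0≤y)

  x≤y⇒0≤y-x : ∀ {x y} → x ≤ y → 0# ≤ y - x
  x≤y⇒0≤y-x {x} x≤y = ≤-respˡ-≈ (-‿inverseʳ x) (+-monoˡ-≤ (- x) x≤y)

  0≤y-x⇒x≤y : ∀ {x y} → 0# ≤ y - x → x ≤ y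
  0≤y-x⇒x≤y {x} {y} 0≤y-x = begin
    x           ≈⟨ +-identityˡ x ⟨
    0# + x      ≤⟨ +-monoˡ-≤ x 0≤y-x ⟩
    y - x + x   ≈⟨ solve 2 (λ x y → y :- x :+ x := y) refl x y ⟩
    y           ∎
    where open ≤-Reasoning

  x≤0⇒0≤-x : ∀ {x} → x ≤ 0# → 0# ≤ - x
  x≤0⇒0≤-x x≤0 = ≤-respʳ-≈ (+-identityˡ _) (x≤y⇒0≤y-x x≤0)

  0≤x² : ∀ x → 0# ≤ x * x
  0≤x² x with total 0# x
  ... | inj₁ 0≤x = *-nonNegative 0≤x 0≤x
  ... | inj₂ x≤0 = ≤-respʳ-≈ (solve 1 (λ x → :- x :* :- x := x :* x) refl x)
                     (*-nonNegative (x≤0⇒0≤-x x≤0) (x≤0⇒0≤-x x≤0))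

  0≤1 : 0# ≤ 1#
  0≤1 = ≤-respʳ-≈ (*-identityˡ 1#) (0≤x² 1#)

  0<1 : 0# < 1#
  0<1 = 0≤1 , 0≉1

  *-monoˡ-≤ : ∀ {a x y} → 0# ≤ a → x ≤ y → a * x ≤ a * y
  *-monoˡ-≤ {a} {x} {y} 0≤a x≤y = 0≤y-x⇒x≤y
    (≤-respʳ-≈ (solve 3 (λ a x y → a :* (y :- x) := a :* y :- a :* x) refl a x y)
      (*-nonNegative 0≤a (x≤y⇒0≤y-x x≤y)))

  +-pos-nonNeg : ∀ {x y} → 0# < x → 0# ≤ y → 0# < x + y
  +-pos-nonNeg {x} {y} (0≤x , 0≉x) 0≤y = +-nonNegative 0≤x 0≤y , λ 0≈x+y →
    0≉x (antisym 0≤x (begin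
      x      ≈⟨ +-identityʳ x ⟨
      x + 0# ≤⟨ +-mono-≤ ≤-refl 0≤y ⟩
      x + y  ≈⟨ 0≈x+y ⟨
      0#     ∎))
    where open ≤-Reasoning

  *-cancelˡ : ∀ {a x y} → ¬ a ≈ 0# → a * x ≈ a * y → x ≈ y
  *-cancelˡ {a} {x} {y} a≉0 ax≈ay = begin
    x              ≈⟨ *-identityˡ x ⟨
    1# * x         ≈⟨ *-congʳ (*-inverseʳ a a≉0) ⟨
    a * a ⁻¹ * x   ≈⟨ solve 3 (λ a b x → a :* b :* x := b :* (a :* x)) refl a (a ⁻¹) x ⟩
    a ⁻¹ * (a * x) ≈⟨ *-congˡ ax≈ay ⟩
    a ⁻¹ * (a * y) ≈⟨ solve 3 (λ a b x → a :* b :* x := b :* (a :* x)) refl a (a ⁻¹) y ⟨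
    a * a ⁻¹ * y   ≈⟨ *-congʳ (*-inverseʳ a a≉0) ⟩
    1# * y         ≈⟨ *-identityˡ y ⟩
    y              ∎
    where open ≈-Reasoning

  x*y≈0 : ∀ {x y} → ¬ x ≈ 0# → x * y ≈ 0# → y ≈ 0#
  x*y≈0 x≉0 xy≈0 = *-cancelˡ x≉0 (trans xy≈0 (sym (zeroʳ _)))

  x²≈0⇒x≈0 : ∀ {x} → x * x ≈ 0# → x ≈ 0#
  x²≈0⇒x≈0 {x} x²≈0 with x ≟ 0#
  ... | yes x≈0 = x≈0
  ... | no  x≉0 = x*y≈0 x≉0 x²≈0

  x-y≈0⇒x≈y : ∀ {x y} → x - y ≈ 0# → x ≈ y
  x-y≈0⇒x≈y {x} {y} x-y≈0 = begin
    x         ≈⟨ solve 2 (λ x y → x := x :- y :+ y) refl x y ⟩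
    x - y + y ≈⟨ +-congʳ x-y≈0 ⟩
    0# + y    ≈⟨ +-identityˡ y ⟩
    y         ∎
    where open ≈-Reasoning

  x≈y⇒x-y≈0 : ∀ {x y} → x ≈ y → x - y ≈ 0#
  x≈y⇒x-y≈0 {x} {y} x≈y = trans (+-congʳ x≈y) (-‿inverseʳ y)

  ⁻¹-pos : ∀ {x} → 0# < x → 0# < x ⁻¹
  ⁻¹-pos {x} (0≤x , 0≉x) = ≤-respʳ-≈ eq (*-nonNegative 0≤x (0≤x² (x ⁻¹))) , λ 0≈x⁻¹ →
    0≉1 (trans (sym (zeroʳ x)) (trans (*-congˡ 0≈x⁻¹) (*-inverseʳ x (0≉x ∘ sym))))
    where
    open ≈-Reasoning
    eq : x * (x ⁻¹ * x ⁻¹) ≈ x ⁻¹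
    eq = begin
      x * (x ⁻¹ * x ⁻¹) ≈⟨ *-assoc x (x ⁻¹) (x ⁻¹) ⟨
      x * x ⁻¹ * x ⁻¹   ≈⟨ *-congʳ (*-inverseʳ x (0≉x ∘ sym)) ⟩
      1# * x ⁻¹         ≈⟨ *-identityˡ _ ⟩
      x ⁻¹              ∎

  *-cancelˡ-≤ : ∀ {a x y} → 0# < a → a * x ≤ a * y → x ≤ y
  *-cancelˡ-≤ {a} {x} {y} 0<a ax≤ay = begin
    x              ≈⟨ simp x ⟨
    a ⁻¹ * (a * x) ≤⟨ *-monoˡ-≤ (proj₁ (⁻¹-pos 0<a)) ax≤ay ⟩
    a ⁻¹ * (a * y) ≈⟨ simp y ⟩
    y              ∎
    where
    open ≤-Reasoning
    simp : ∀ z → a ⁻¹ * (a * z) ≈ z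
    simp z = trans (solve 3 (λ a b x → b :* (a :* x) := a :* b :* x) refl a (a ⁻¹) z)
               (trans (*-congʳ (*-inverseʳ a (proj₂ 0<a ∘ sym))) (*-identityˡ z))

  x+y≈0⇒x≈0 : ∀ {x y} → 0# ≤ x → 0# ≤ y → x + y ≈ 0# → x ≈ 0#
  x+y≈0⇒x≈0 {x} 0≤x 0≤y x+y≈0 with x ≟ 0#
  ... | yes x≈0 = x≈0
  ... | no  x≉0 = contradiction (sym x+y≈0) (proj₂ (+-pos-nonNeg (0≤x , x≉0 ∘ sym) 0≤y))

  fromℕ-nonNegative : ∀ n → 0# ≤ fromℕ n
  fromℕ-nonNegative zero    = ≤-refl
  fromℕ-nonNegative (suc n) = +-nonNegative 0≤1 (fromℕ-nonNegative n)

  fromℕ-pos : ∀ n → 0# < fromℕ (suc n)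
  fromℕ-pos n = +-pos-nonNeg 0<1 (fromℕ-nonNegative n)

  sum-zero : ∀ {n} (f : Vector Carrier n) → (∀ i → f i ≈ 0#) → sum f ≈ 0#
  sum-zero {n} f f≈0 = trans (sum-cong-≋ f≈0) (sum-replicate-zero n)

  sum-neg : ∀ {n} (f : Vector Carrier n) → sum (λ i → - f i) ≈ - sum f
  sum-neg {zero}  f = solve 0 (con (+ 0) := :- con (+ 0)) refl
  sum-neg {suc n} f = trans (+-congˡ (sum-neg (f ∘ suc)))
    (solve 2 (λ x y → :- x :- y := :- (x :+ y)) refl (f zero) (sum (f ∘ suc)))

  sum-nonNegative : ∀ {n} (f : Vector Carrier n) → (∀ i → 0# ≤ f i) → 0# ≤ sum f
  sum-nonNegative {zero}  f 0≤f = ≤-refl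
  sum-nonNegative {suc n} f 0≤f = +-nonNegative (0≤f zero) (sum-nonNegative (f ∘ suc) (0≤f ∘ suc))

  term≤sum : ∀ {n} (f : Vector Carrier n) → (∀ i → 0# ≤ f i) → ∀ i → f i ≤ sum f
  term≤sum {suc n} f 0≤f i = begin
    f i                       ≈⟨ +-identityʳ _ ⟨
    f i + 0#                  ≤⟨ +-mono-≤ ≤-refl (sum-nonNegative (removeAt f i) (λ _ → 0≤f _)) ⟩
    f i + sum (removeAt f i)  ≈⟨ sum-remove f ⟨
    sum f                     ∎
    where open ≤-Reasoning

  two-terms≤sum : ∀ {n} (f : Vector Carrier n) → (∀ i → 0# ≤ f i) →
                  ∀ {i j} → ¬ i ≡ j → f i + f j ≤ sum f
  two-terms≤sum {suc n} f 0≤f {i} {j} i≢j = begin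
    f i + f j                            ≈⟨ +-congˡ (reflexive (removeAt-punchOut f i≢j)) ⟨
    f i + removeAt f i (punchOut i≢j)    ≤⟨ +-mono-≤ ≤-refl (term≤sum (removeAt f i) (λ _ → 0≤f _) (punchOut i≢j)) ⟩
    f i + sum (removeAt f i)             ≈⟨ sum-remove f ⟨
    sum f                                ∎
    where open ≤-Reasoning

  sum≈0⇒term≈0 : ∀ {n} (f : Vector Carrier n) → (∀ i → 0# ≤ f i) → sum f ≈ 0# → ∀ i → f i ≈ 0#
  sum≈0⇒term≈0 f 0≤f sum≈0 i = antisym (≤-respʳ-≈ sum≈0 (term≤sum f 0≤f i)) (0≤f i)

  -- Linear algebra

  Vec : ℕ → Set c
  Vec = Vector Carrier

  infix  4 _≋_
  infixl 6 _+ᵛ_ _-ᵛ_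
  infixl 7 _•ᵛ_ _∙_

  _≋_ : ∀ {n} → Vec n → Vec n → Set ℓ₁
  x ≋ y = ∀ i → x i ≈ y i

  0ᵛ : ∀ {n} → Vec n
  0ᵛ i = 0#

  _+ᵛ_ _-ᵛ_ : ∀ {n} → Vec n → Vec n → Vec n
  (x +ᵛ y) i = x i + y i
  (x -ᵛ y) i = x i - y i

  _•ᵛ_ : ∀ {n} → Carrier → Vec n → Vec n
  (a •ᵛ x) i = a * x i

  ≋0? : ∀ {n} (x : Vec n) → Dec (x ≋ 0ᵛ)
  ≋0? x = Fin.all? (λ i → x i ≟ 0#)

  ≉0⇒entry≉0 : ∀ {n} {x : Vec n} → ¬ x ≋ 0ᵛ → ∃[ i ] ¬ x i ≈ 0#
  ≉0⇒entry≉0 {n} {x} = Fin.¬∀⟶∃¬ n _ (λ i → x i ≟ 0#)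

  opaque

    -- Opaque, so that a dot product stays an atom during type checking instead of unfolding into
    -- its sum; `∙-def` unfolds it on demand.
    _∙_ : ∀ {n} → Vec n → Vec n → Carrier
    x ∙ y = sum (λ i → x i * y i)

    ∙-def : ∀ {n} (x y : Vec n) → x ∙ y ≡ sum (λ i → x i * y i)
    ∙-def x y = ≡.refl

    ∙-zero : ∀ (x y : Vec 0) → x ∙ y ≡ 0#
    ∙-zero x y = ≡.refl

    ∙-suc : ∀ {n} (x y : Vec (suc n)) → x ∙ y ≡ x zero * y zero + (x ∘ suc) ∙ (y ∘ suc)
    ∙-suc x y = ≡.refl

  module _ {n : ℕ} where

    opaque
      unfolding _∙_

      ∙-cong : ∀ {x x′ y y′ : Vec n} → x ≋ x′ → y ≋ y′ → x ∙ y ≈ x′ ∙ y′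
      ∙-cong x≋x′ y≋y′ = sum-cong-≋ (λ i → *-cong (x≋x′ i) (y≋y′ i))

      ∙-congˡ : ∀ (x : Vec n) {y y′} → y ≋ y′ → x ∙ y ≈ x ∙ y′
      ∙-congˡ x y≋y′ = sum-cong-≋ (λ i → *-congˡ (y≋y′ i))

      ∙-congʳ : ∀ {x x′ : Vec n} y → x ≋ x′ → x ∙ y ≈ x′ ∙ y
      ∙-congʳ y x≋x′ = sum-cong-≋ (λ i → *-congʳ (x≋x′ i))

      ∙-comm : ∀ (x y : Vec n) → x ∙ y ≈ y ∙ x
      ∙-comm x y = sum-cong-≋ (λ i → *-comm (x i) (y i))

      ∙-zeroʳ : ∀ (x : Vec n) {y} → y ≋ 0ᵛ → x ∙ y ≈ 0#
      ∙-zeroʳ x y≋0 = sum-zero _ (λ i → trans (*-congˡ (y≋0 i)) (zeroʳ (x i)))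

      ∙-+ʳ : ∀ (x y z : Vec n) → x ∙ (y +ᵛ z) ≈ x ∙ y + x ∙ z
      ∙-+ʳ x y z = trans (sum-cong-≋ (λ i → distribˡ (x i) (y i) (z i))) (∑-distrib-+ (λ i → x i * y i) (λ i → x i * z i))

      ∙-•ʳ : ∀ (x : Vec n) a y → x ∙ (a •ᵛ y) ≈ a * (x ∙ y)
      ∙-•ʳ x a y = trans
        (sum-cong-≋ (λ i → solve 3 (λ x a y → x :* (a :* y) := a :* (x :* y)) refl (x i) a (y i)))
        (sym (*-distribˡ-sum a (λ i → x i * y i)))

      ∙--ʳ : ∀ (x y z : Vec n) → x ∙ (y -ᵛ z) ≈ x ∙ y - x ∙ z
      ∙--ʳ x y z = trans
        (sum-cong-≋ (λ i → solve 3 (λ x y z → x :* (y :- z) := x :* y :+ :- (x :* z)) refl (x i) (y i) (z i)))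
        (trans (∑-distrib-+ (λ i → x i * y i) (λ i → - (x i * z i))) (+-congˡ (sum-neg (λ i → x i * z i))))

      ∙-•ˡ : ∀ a (x : Vec n) y → (a •ᵛ x) ∙ y ≈ a * (x ∙ y)
      ∙-•ˡ a x y = trans (∙-comm _ y) (trans (∙-•ʳ y a x) (*-congˡ (∙-comm y x)))

      ∙--ˡ : ∀ (x y z : Vec n) → (x -ᵛ y) ∙ z ≈ x ∙ z - y ∙ z
      ∙--ˡ x y z = trans (∙-comm _ z) (trans (∙--ʳ z x y) (+-cong (∙-comm z x) (-‿cong (∙-comm z y))))

      0≤x∙x : ∀ (x : Vec n) → 0# ≤ x ∙ x
      0≤x∙x x = sum-nonNegative _ (λ i → 0≤x² (x i))

      x∙x≈0⇒x≋0 : ∀ {x : Vec n} → x ∙ x ≈ 0# → x ≋ 0ᵛ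
      x∙x≈0⇒x≋0 {x} x∙x≈0 i = x²≈0⇒x≈0 (sum≈0⇒term≈0 _ (λ i → 0≤x² (x i)) x∙x≈0 i)

  opaque
    unfolding _∙_

    1ᴹ-∙ : ∀ {n} i (x : Vec n) → 1ᴹ i ∙ x ≈ x i
    1ᴹ-∙ zero x = trans (+-cong (*-identityˡ _) (sum-zero (λ i → 0# * x (suc i)) (λ i → zeroˡ (x (suc i))))) (+-identityʳ _)
    1ᴹ-∙ (suc i) x = trans (+-cong (zeroˡ _) (1ᴹ-∙ i (x ∘ suc))) (+-identityˡ _)

    -- Both sides are the double sum of t i * M i j * x j, taken in either order.
    ∙-adjoint : ∀ {m n} (M : Matrix m n) t x →
                (λ j → t ∙ (M ᵀ) j) ∙ x ≈ t ∙ (λ i → M i ∙ x)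
    ∙-adjoint M t x = begin
      sum (λ j → sum (λ i → t i * M i j) * x j)     ≈⟨ sum-cong-≋ (λ j → *-distribʳ-sum (x j) (λ i → t i * M i j)) ⟩
      sum (λ j → sum (λ i → t i * M i j * x j))     ≈⟨ ∑-comm (λ j i → t i * M i j * x j) ⟩
      sum (λ i → sum (λ j → t i * M i j * x j))     ≈⟨ sum-cong-≋ (λ i → sum-cong-≋ (λ j → *-assoc (t i) (M i j) (x j))) ⟩
      sum (λ i → sum (λ j → t i * (M i j * x j)))   ≈⟨ sum-cong-≋ (λ i → *-distribˡ-sum (t i) (λ j → M i j * x j)) ⟨
      sum (λ i → t i * sum (λ j → M i j * x j))     ∎
      where open ≈-Reasoning

  infixl 7 _*ᵛ_

  _*ᵛ_ : ∀ {m n} → Matrix m n → Vec n → Vec m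
  (M *ᵛ x) i = M i ∙ x

  *ᴹ-row : ∀ {l m n} (M : Matrix l m) (N : Matrix m n) i → (M *ᴹ N) i ≋ (λ j → M i ∙ (N ᵀ) j)
  *ᴹ-row M N i j = reflexive (≡.sym (∙-def (M i) ((N ᵀ) j)))

  *ᴹ-*ᵛ : ∀ {l m n} (M : Matrix l m) (N : Matrix m n) x → ((M *ᴹ N) *ᵛ x) ≋ (M *ᵛ (N *ᵛ x))
  *ᴹ-*ᵛ M N x i = trans (∙-congʳ x (*ᴹ-row M N i)) (∙-adjoint N (M i) x)

  -- The Fredholm alternative: `b` lies in the row space of `M`, or some kernel vector of `M` is not
  -- orthogonal to `b`. Induction on the rows. If the first row r depends on the others, it may be
  -- dropped; otherwise some `y` in the kernel of the others has r·y ≠ 0, and multiples of r and `y`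
  -- correct `b` and `x`.
  fredholm : ∀ {m n} (M : Matrix m n) (b : Vec n) →
             (Σ[ t ∈ Vec m ] b ≋ (λ j → t ∙ (M ᵀ) j)) ⊎
             (Σ[ x ∈ Vec n ] (M *ᵛ x) ≋ 0ᵛ × ¬ b ∙ x ≈ 0#)
  fredholm {zero} M b with ≋0? b
  ... | yes b≋0 = inj₁ ((λ ()) , λ j → trans (b≋0 j) (reflexive (≡.sym (∙-zero _ ((M ᵀ) j)))))
  ... | no  b≋̸0 with ≉0⇒entry≉0 b≋̸0
  ...   | i , bᵢ≉0 = inj₂ (1ᴹ i , (λ ()) , λ e → bᵢ≉0 (trans (sym (trans (∙-comm b (1ᴹ i)) (1ᴹ-∙ i b))) e))
  fredholm {suc m} M b with fredholm (M ∘ suc) (M zero)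
  ... | inj₁ (t , r≋tM) with fredholm (M ∘ suc) b
  ...   | inj₁ (s , b≋sM) = inj₁ (0# Vector.∷ s , λ j → trans (b≋sM j) (sym (trans (reflexive (∙-suc (0# Vector.∷ s) ((M ᵀ) j))) (trans (+-congʳ (zeroˡ _)) (+-identityˡ _)))))
  ...   | inj₂ (x , Mx≋0 , bx≉0) = inj₂ (x , rows , bx≉0)
    where
    rows : (M *ᵛ x) ≋ 0ᵛ
    rows zero    = trans (∙-congʳ x r≋tM) (trans (∙-adjoint (M ∘ suc) t x) (∙-zeroʳ t Mx≋0))
    rows (suc i) = Mx≋0 i
  -- The multiple of the first row is chosen to make the corrected `b` orthogonal to `y`.
  fredholm {suc m} M b | inj₂ (y , My≋0 , ry≉0) with fredholm (M ∘ suc) (b -ᵛ (b ∙ y * (M zero ∙ y) ⁻¹) •ᵛ M zero)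
  ... | inj₁ (s , b′≋sM) = inj₁ (e Vector.∷ s , λ j → trans
          (solve 2 (λ b z → b := z :+ (b :- z))
               refl (b j) (e * M zero j)) (trans (+-congˡ (b′≋sM j)) (reflexive (≡.sym (∙-suc (e Vector.∷ s) ((M ᵀ) j))))))
    where e = b ∙ y * (M zero ∙ y) ⁻¹
  ... | inj₂ (x , Mx≋0 , b′x≉0) = inj₂ (x′ , rows , λ bx′≈0 → b′x≉0 (trans bx≈ bx′≈0))
    where
    open ≈-Reasoning
    r = M zero
    ry⁻¹ = (r ∙ y) ⁻¹
    e = r ∙ x * ry⁻¹
    -- Subtracting this multiple of `y` kills the product with r and stays in the kernel of the
    -- other rows.
    x′ = x -ᵛ e •ᵛ y

    _∙x′ : ∀ z → z ∙ x′ ≈ z ∙ x - e * (z ∙ y)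
    z ∙x′ = trans (∙--ʳ z x (e •ᵛ y)) (+-congˡ (-‿cong (∙-•ʳ z e y)))

    rows : (M *ᵛ x′) ≋ 0ᵛ
    rows zero = begin
      r ∙ x′                             ≈⟨ r ∙x′ ⟩
      r ∙ x - r ∙ x * ry⁻¹ * (r ∙ y)
        ≈⟨ solve 3 (λ a b c → a :- a :* b :* c := a :* (con (+ 1) :- c :* b)) refl (r ∙ x) ry⁻¹ (r ∙ y) ⟩
      r ∙ x * (1# - r ∙ y * ry⁻¹)        ≈⟨ *-congˡ (x≈y⇒x-y≈0 (sym (*-inverseʳ (r ∙ y) ry≉0))) ⟩
      r ∙ x * 0#                         ≈⟨ zeroʳ _ ⟩
      0#                                 ∎
    rows (suc i) = begin
      M (suc i) ∙ x′                         ≈⟨ M (suc i) ∙x′ ⟩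
      M (suc i) ∙ x - e * (M (suc i) ∙ y)    ≈⟨ +-cong (Mx≋0 i) (-‿cong (*-congˡ (My≋0 i))) ⟩
      0# - e * 0#                            ≈⟨ solve 1 (λ e → con (+ 0) :- e :* con (+ 0) := con (+ 0)) refl e ⟩
      0#                                     ∎

    -- Both corrections take the same amount (b·y)(r·x)/(r·y) away from b·x.
    bx≈ : (b -ᵛ (b ∙ y * ry⁻¹) •ᵛ r) ∙ x ≈ b ∙ x′
    bx≈ = begin
      (b -ᵛ (b ∙ y * ry⁻¹) •ᵛ r) ∙ x       ≈⟨ ∙--ˡ b _ x ⟩
      b ∙ x - ((b ∙ y * ry⁻¹) •ᵛ r) ∙ x    ≈⟨ +-congˡ (-‿cong (∙-•ˡ _ r x)) ⟩
      b ∙ x - b ∙ y * ry⁻¹ * (r ∙ x)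
        ≈⟨ solve 4 (λ a b c d → a :- b :* c :* d := a :- d :* c :* b) refl (b ∙ x) (b ∙ y) ry⁻¹ (r ∙ x) ⟩
      b ∙ x - e * (b ∙ y)                  ≈⟨ b ∙x′ ⟨
      b ∙ x′                               ∎

  -- A crude squared operator norm, built entry by entry from (u + r)² ≤ 2u² + 2r²; it needs neither
  -- Cauchy-Schwarz nor a supremum over the sphere.
  *ᵛ-bounded : ∀ {m n} (M : Matrix m n) →
               ∃[ D ] 0# ≤ D × (∀ x → (M *ᵛ x) ∙ (M *ᵛ x) ≤ D * (x ∙ x))
  *ᵛ-bounded {zero} M = 0# , ≤-refl , λ x → ≤-reflexive (trans (reflexive (∙-zero (M *ᵛ x) (M *ᵛ x))) (sym (zeroˡ _)))
  *ᵛ-bounded {suc m} M with *ᵛ-bounded (M ∘ suc) | row-bounded (M zero)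
    where
    row-bounded : ∀ {n} (t : Vec n) → ∃[ D ] 0# ≤ D × (∀ x → (t ∙ x) * (t ∙ x) ≤ D * (x ∙ x))
    row-bounded {zero} t = 0# , ≤-refl , λ x → ≤-reflexive (trans (*-congʳ (reflexive (∙-zero t x))) (trans (zeroˡ _) (sym (zeroˡ _))))
    row-bounded {suc n} t with row-bounded (t ∘ suc)
    ... | D , 0≤D , bound = E , 0≤E , λ x → 
      let t₀ = t zero ; x₀ = x zero ; r = (t ∘ suc) ∙ (x ∘ suc) ; s = (x ∘ suc) ∙ (x ∘ suc)
          0≤s = 0≤x∙x (x ∘ suc) in begin
        (t ∙ x) * (t ∙ x)
          ≈⟨ *-cong (reflexive (∙-suc t x)) (reflexive (∙-suc t x)) ⟩
        (t₀ * x₀ + r) * (t₀ * x₀ + r)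
          ≈⟨ +-identityʳ _ ⟨
        (t₀ * x₀ + r) * (t₀ * x₀ + r) + 0#
          -- Adding (u - r)² to (u + r)² removes the mixed term.
          ≤⟨ +-mono-≤ ≤-refl (0≤x² (t₀ * x₀ - r)) ⟩
        (t₀ * x₀ + r) * (t₀ * x₀ + r) + (t₀ * x₀ - r) * (t₀ * x₀ - r)
          ≈⟨ solve 2 (λ u r → (u :+ r) :* (u :+ r) :+ (u :- r) :* (u :- r) := u :* u :+ u :* u :+ (r :* r :+ r :* r))
               refl (t₀ * x₀) r ⟩
        t₀ * x₀ * (t₀ * x₀) + t₀ * x₀ * (t₀ * x₀) + (r * r + r * r)
          ≤⟨ +-mono-≤ ≤-refl (+-mono-≤ (bound (x ∘ suc)) (bound (x ∘ suc))) ⟩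
        t₀ * x₀ * (t₀ * x₀) + t₀ * x₀ * (t₀ * x₀) + (D * s + D * s)
          ≈⟨ +-identityʳ _ ⟨
        t₀ * x₀ * (t₀ * x₀) + t₀ * x₀ * (t₀ * x₀) + (D * s + D * s) + 0#
          -- The missing cross terms are nonnegative; once they are added, the expression factors
          -- through x·x.
          ≤⟨ +-mono-≤ ≤-refl (+-nonNegative
               (*-nonNegative (0≤2u (0≤x² t₀)) 0≤s) (*-nonNegative (0≤2u 0≤D) (0≤x² x₀))) ⟩
        t₀ * x₀ * (t₀ * x₀) + t₀ * x₀ * (t₀ * x₀) + (D * s + D * s) + ((t₀ * t₀ + t₀ * t₀) * s + (D + D) * (x₀ * x₀))
          ≈⟨ solve 4 (λ t x D s → t :* x :* (t :* x) :+ t :* x :* (t :* x) :+ (D :* s :+ D :* s) :+ ((t :* t :+ t :* t) :* s :+ (D :+ D) :* (x :* x))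
               := (t :* t :+ t :* t :+ (D :+ D)) :* (x :* x :+ s)) refl t₀ x₀ D s ⟩
        E * (x₀ * x₀ + s)
          ≈⟨ *-congˡ (reflexive (∙-suc x x)) ⟨
        E * (x ∙ x) ∎
      where
      open ≤-Reasoning
      E = t zero * t zero + t zero * t zero + (D + D)
      0≤2u : ∀ {u} → 0# ≤ u → 0# ≤ u + u
      0≤2u 0≤u = +-nonNegative 0≤u 0≤u
      0≤E = +-nonNegative (0≤2u (0≤x² (t zero))) (0≤2u 0≤D)
  ... | D , 0≤D , bound | D₀ , 0≤D₀ , bound₀ = D₀ + D , +-nonNegative 0≤D₀ 0≤D , λ x →
    ≤-respˡ-≈ (sym (reflexive (∙-suc (M *ᵛ x) (M *ᵛ x))))
      (≤-respʳ-≈ (sym (distribʳ (x ∙ x) D₀ D)) (+-mono-≤ (bound₀ x) (bound x)))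

  -- Spectral theorem

  0≤u+u⇒0≤u : ∀ {u} → 0# ≤ u + u → 0# ≤ u
  0≤u+u⇒0≤u {u} 0≤u+u with total 0# u
  ... | inj₁ 0≤u = 0≤u
  ... | inj₂ u≤0 = ≤-trans 0≤u+u (≤-respʳ-≈ (+-identityʳ u) (+-mono-≤ ≤-refl u≤0))

  x≤y*z⁻¹ : ∀ {x y z} → 0# < z → x * z ≤ y → x ≤ y * z ⁻¹
  x≤y*z⁻¹ {x} {y} {z} 0<z xz≤y = *-cancelˡ-≤ 0<z (begin
    z * x          ≈⟨ *-comm z x ⟩
    x * z          ≤⟨ xz≤y ⟩
    y              ≈⟨ *-identityˡ y ⟨
    1# * y         ≈⟨ *-congʳ (*-inverseʳ z (proj₂ 0<z ∘ sym)) ⟨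
    z * z ⁻¹ * y   ≈⟨ solve 3 (λ z w y → z :* w :* y := z :* (y :* w)) refl z (z ⁻¹) y ⟩
    z * (y * z ⁻¹) ∎)
    where open ≤-Reasoning

  x*z≤y : ∀ {x y z} → 0# < z → x ≤ y * z ⁻¹ → x * z ≤ y
  x*z≤y {x} {y} {z} 0<z x≤ = begin
    x * z          ≈⟨ *-comm x z ⟩
    z * x          ≤⟨ *-monoˡ-≤ (proj₁ 0<z) x≤ ⟩
    z * (y * z ⁻¹) ≈⟨ solve 3 (λ z w y → z :* w :* y := z :* (y :* w)) refl z (z ⁻¹) y ⟨
    z * z ⁻¹ * y   ≈⟨ *-congʳ (*-inverseʳ z (proj₂ 0<z ∘ sym)) ⟩
    1# * y         ≈⟨ *-identityˡ y ⟩
    y              ∎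
    where open ≤-Reasoning

  ≋̸0⇒0<x∙x : ∀ {n} (x : Vec n) → ¬ x ≋ 0ᵛ → 0# < x ∙ x
  ≋̸0⇒0<x∙x x x≋̸0 = 0≤x∙x x , λ 0≈x∙x → x≋̸0 (x∙x≈0⇒x≋0 {x = x} (sym 0≈x∙x))

  -- 2 (x·x + y·y - x·y) = |x - y|² + x·x + y·y.
  ∙-≤ : ∀ {n} (x y : Vec n) → x ∙ y ≤ x ∙ x + y ∙ y
  ∙-≤ x y = 0≤y-x⇒x≤y (0≤u+u⇒0≤u (≤-respʳ-≈ eq
    (+-nonNegative (0≤x∙x (x -ᵛ y)) (+-nonNegative (0≤x∙x x) (0≤x∙x y)))))
    where
    open ≈-Reasoning
    u = x ∙ x + y ∙ y - x ∙ y
    eq : (x -ᵛ y) ∙ (x -ᵛ y) + (x ∙ x + y ∙ y) ≈ u + u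
    eq = begin
      (x -ᵛ y) ∙ (x -ᵛ y) + (x ∙ x + y ∙ y)
        ≈⟨ +-congʳ (trans (∙--ʳ (x -ᵛ y) x y) (+-cong (∙--ˡ x y x) (-‿cong (∙--ˡ x y y)))) ⟩
      x ∙ x - y ∙ x - (x ∙ y - y ∙ y) + (x ∙ x + y ∙ y)
        ≈⟨ +-congʳ (+-congʳ (+-congˡ (-‿cong (∙-comm y x)))) ⟩
      x ∙ x - x ∙ y - (x ∙ y - y ∙ y) + (x ∙ x + y ∙ y)
        ≈⟨ solve 3 (λ a b d → a :- b :- (b :- d) :+ (a :+ d) := a :+ d :- b :+ (a :+ d :- b)) refl (x ∙ x) (x ∙ y) (y ∙ y) ⟩
      u + u ∎

  -∙-≤ : ∀ {n} (x y : Vec n) → - (x ∙ y) ≤ x ∙ x + y ∙ y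
  -∙-≤ x y = ≤-respˡ-≈ neg (≤-respʳ-≈ (+-congˡ sq) (∙-≤ x ((- 1#) •ᵛ y)))
    where
    neg : x ∙ ((- 1#) •ᵛ y) ≈ - (x ∙ y)
    neg = trans (∙-•ʳ x (- 1#) y) (solve 1 (λ a → :- con (+ 1) :* a := :- a) refl (x ∙ y))
    sq : ((- 1#) •ᵛ y) ∙ ((- 1#) •ᵛ y) ≈ y ∙ y
    sq = trans (∙-•ʳ ((- 1#) •ᵛ y) (- 1#) y) (trans (*-congˡ (∙-•ˡ (- 1#) y y))
      (solve 1 (λ a → :- con (+ 1) :* (:- con (+ 1) :* a) := a) refl (y ∙ y)))

  module _ {m n} (M : Matrix m n) where

    *ᵛ-cong : ∀ {x y} → x ≋ y → (M *ᵛ x) ≋ (M *ᵛ y)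
    *ᵛ-cong x≋y i = ∙-congˡ (M i) x≋y

    *ᵛ-zero : ∀ {x} → x ≋ 0ᵛ → (M *ᵛ x) ≋ 0ᵛ
    *ᵛ-zero x≋0 i = ∙-zeroʳ (M i) x≋0

  IsSymmetric : ∀ {n} → Matrix n n → Set ℓ₁
  IsSymmetric M = ∀ i j → M i j ≈ M j i

  *ᵛ-selfAdjoint : ∀ {n} {M : Matrix n n} → IsSymmetric M → ∀ x y → (M *ᵛ x) ∙ y ≈ x ∙ (M *ᵛ y)
  *ᵛ-selfAdjoint {M = M} M-sym x y = trans
    (∙-congʳ y (λ i → trans (∙-comm (M i) x) (∙-congˡ x (M-sym i))))
    (∙-adjoint M x y)

  1ᴹ-sym : ∀ {n} → IsSymmetric (1ᴹ {n})
  1ᴹ-sym i j with i Fin.≟ j | j Fin.≟ i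
  ... | yes _   | yes _   = refl
  ... | no  _   | no  _   = refl
  ... | yes i≡j | no  j≢i = contradiction (≡.sym i≡j) j≢i
  ... | no  i≢j | yes j≡i = contradiction (≡.sym j≡i) i≢j

  -- The supremum of the μ for which A - μ is positive semidefinite on the image
  -- of G would be an eigenvalue of A on that image: otherwise A - μ is bounded
  -- below there, and μ could be increased.
  module _ {n} {A : Matrix n n} (A-sym : IsSymmetric A) (G : Matrix n n)
    (AG≋GA : ∀ x → (A *ᵛ (G *ᵛ x)) ≋ (G *ᵛ (A *ᵛ x)))
    (no-eigenvector : ∀ θ x → (A *ᵛ (G *ᵛ x)) ≋ (θ •ᵛ (G *ᵛ x)) → (G *ᵛ x) ≋ 0ᵛ)
    where

    private
      BoundedBy : Carrier → Set (c ⊔ ℓ₂)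
      BoundedBy μ = ∀ x → μ * ((G *ᵛ x) ∙ (G *ᵛ x)) ≤ (G *ᵛ x) ∙ (A *ᵛ (G *ᵛ x))

      bound-below : ∃ BoundedBy
      bound-below with *ᵛ-bounded A
      -- The constant comes from -(y·Ay) ≤ |y|² + |Ay|² ≤ (1 + D)|y|².
      ... | D , 0≤D , |Ay|²≤ = - (1# + D) , λ x → let y = G *ᵛ x in 0≤y-x⇒x≤y (begin
        0#                                     ≤⟨ x≤y⇒0≤y-x (-∙-≤ y (A *ᵛ y)) ⟩
        y ∙ y + (A *ᵛ y) ∙ (A *ᵛ y) - - (y ∙ (A *ᵛ y))
          ≤⟨ +-monoˡ-≤ _ (+-mono-≤ ≤-refl (|Ay|²≤ y)) ⟩
        y ∙ y + D * (y ∙ y) - - (y ∙ (A *ᵛ y))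
          ≈⟨ solve 3 (λ s D r → s :+ D :* s :- :- r := r :- :- (con (+ 1) :+ D) :* s) refl (y ∙ y) D (y ∙ (A *ᵛ y)) ⟩
        y ∙ (A *ᵛ y) - - (1# + D) * (y ∙ y)    ∎)
        where open ≤-Reasoning

      rayleigh : Vec n → Carrier
      rayleigh y = y ∙ (A *ᵛ y) * (y ∙ y) ⁻¹

      ≤rayleigh : ∀ x → ¬ (G *ᵛ x) ≋ 0ᵛ → ∀ μ → BoundedBy μ → μ ≤ rayleigh (G *ᵛ x)
      ≤rayleigh x Gx≋̸0 μ bounded = x≤y*z⁻¹ (≋̸0⇒0<x∙x (G *ᵛ x) Gx≋̸0) (bounded x)

      -- The supremum is itself a bound: each Rayleigh quotient on the image is an upper bound of
      -- all admissible μ, hence at least λ₀. Where G x = 0 both sides vanish.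
      bounded-sup : ∀ λ₀ → (∀ u → (∀ μ → BoundedBy μ → μ ≤ u) → λ₀ ≤ u) → BoundedBy λ₀
      bounded-sup λ₀ least x with ≋0? (G *ᵛ x)
      ... | no  Gx≋̸0 = x*z≤y (≋̸0⇒0<x∙x (G *ᵛ x) Gx≋̸0) (least (rayleigh (G *ᵛ x)) (≤rayleigh x Gx≋̸0))
      ... | yes Gx≋0 = ≤-reflexive (begin
        λ₀ * ((G *ᵛ x) ∙ (G *ᵛ x))       ≈⟨ *-congˡ (∙-zeroʳ (G *ᵛ x) Gx≋0) ⟩
        λ₀ * 0#                          ≈⟨ zeroʳ λ₀ ⟩
        0#                               ≈⟨ ∙-zeroʳ (G *ᵛ x) (*ᵛ-zero A Gx≋0) ⟨
        (G *ᵛ x) ∙ (A *ᵛ (G *ᵛ x))       ∎)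
        where open ≈-Reasoning

      greatest-bound : ∀ x → ¬ (G *ᵛ x) ≋ 0ᵛ →
                       ∃[ λ₀ ] BoundedBy λ₀ × (∀ μ → BoundedBy μ → μ ≤ λ₀)
      greatest-bound x Gx≋̸0 =
        let μ , bounded-μ = bound-below
            -- `supremum` takes predicates at level `c ⊔ ℓ₁ ⊔ ℓ₂`, hence the `Lift`. The given x
            -- with G x nonzero supplies an upper bound.
            λ₀ , upper , least = supremum (λ μ → Lift ℓ₁ (BoundedBy μ)) (μ , lift bounded-μ)
              (rayleigh (G *ᵛ x) , λ μ bounded → ≤rayleigh x Gx≋̸0 μ (lower bounded))
        in λ₀ , bounded-sup λ₀ (λ u upper-u → least u (λ μ bounded → upper-u μ (lower bounded)))
              , λ μ bounded → upper μ (lift bounded)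

      module _ (λ₀ : Carrier) (λ₀-bounded : BoundedBy λ₀) where

        S : Matrix n n
        S i j = A i j - λ₀ * 1ᴹ i j

        S-sym : IsSymmetric S
        S-sym i j = +-cong (A-sym i j) (-‿cong (*-congˡ (1ᴹ-sym i j)))

        S*ᵛ : ∀ x → (S *ᵛ x) ≋ ((A *ᵛ x) -ᵛ λ₀ •ᵛ x)
        S*ᵛ x i = trans (∙--ˡ (A i) (λ₀ •ᵛ 1ᴹ i) x)
          (+-congˡ (-‿cong (trans (∙-•ˡ λ₀ (1ᴹ i) x) (*-congˡ (1ᴹ-∙ i x)))))

        y∙Sy : ∀ y → y ∙ (S *ᵛ y) ≈ y ∙ (A *ᵛ y) - λ₀ * (y ∙ y)
        y∙Sy y = trans (∙-congˡ y (S*ᵛ y)) (trans (∙--ʳ y (A *ᵛ y) (λ₀ •ᵛ y)) (+-congˡ (-‿cong (∙-•ʳ y λ₀ y))))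

        0≤y∙Sy : ∀ x → 0# ≤ (G *ᵛ x) ∙ (S *ᵛ (G *ᵛ x))
        0≤y∙Sy x = ≤-respʳ-≈ (sym (y∙Sy (G *ᵛ x))) (x≤y⇒0≤y-x (λ₀-bounded x))

        SG≋GS : ∀ x → (S *ᵛ (G *ᵛ x)) ≋ (G *ᵛ (S *ᵛ x))
        SG≋GS x i = begin
          (S *ᵛ (G *ᵛ x)) i                         ≈⟨ S*ᵛ (G *ᵛ x) i ⟩
          (A *ᵛ (G *ᵛ x)) i - λ₀ * (G *ᵛ x) i       ≈⟨ +-congʳ (AG≋GA x i) ⟩
          G i ∙ (A *ᵛ x) - λ₀ * (G i ∙ x)           ≈⟨ +-congˡ (-‿cong (∙-•ʳ (G i) λ₀ x)) ⟨
          G i ∙ (A *ᵛ x) - G i ∙ (λ₀ •ᵛ x)          ≈⟨ ∙--ʳ (G i) (A *ᵛ x) (λ₀ •ᵛ x) ⟨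
          G i ∙ ((A *ᵛ x) -ᵛ λ₀ •ᵛ x)               ≈⟨ ∙-congˡ (G i) (S*ᵛ x) ⟨
          (G *ᵛ (S *ᵛ x)) i                         ∎
          where open ≈-Reasoning

        -- The operator inequality S² ≤ C S for 0 ≤ S ≤ C, without a square root of S. With z = S y,
        -- evaluate the form of S at w = C y - z, again in the image of G: 0 ≤ w·Sw = C² y·z - 2C
        -- z·z + z·Sz, and z·Sz ≤ C z·z. Then cancel one factor C.
        |Sy|²≤ : ∃[ C ] 0# < C × (∀ x → let y = G *ᵛ x in (S *ᵛ y) ∙ (S *ᵛ y) ≤ C * (y ∙ (S *ᵛ y)))
        |Sy|²≤ with *ᵛ-bounded S
        ... | D , 0≤D , |Sz|²≤ = C , 0<C , main
          where
          C = 1# + D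
          0<C = +-pos-nonNeg 0<1 0≤D

          z∙Sz≤ : ∀ z → z ∙ (S *ᵛ z) ≤ C * (z ∙ z)
          z∙Sz≤ z = begin
            z ∙ (S *ᵛ z)                       ≤⟨ ∙-≤ z (S *ᵛ z) ⟩
            z ∙ z + (S *ᵛ z) ∙ (S *ᵛ z)        ≤⟨ +-mono-≤ ≤-refl (|Sz|²≤ z) ⟩
            z ∙ z + D * (z ∙ z)                ≈⟨ solve 2 (λ s D → s :+ D :* s := (con (+ 1) :+ D) :* s) refl (z ∙ z) D ⟩
            C * (z ∙ z)                        ∎
            where open ≤-Reasoning

          main : ∀ x → let y = G *ᵛ x in (S *ᵛ y) ∙ (S *ᵛ y) ≤ C * (y ∙ (S *ᵛ y))
          main x = 0≤y-x⇒x≤y (*-cancelˡ-≤ 0<C (begin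
            C * 0#                                   ≈⟨ zeroʳ C ⟩
            0#                                       ≤⟨ 0≤y∙Sy x′ ⟩
            (G *ᵛ x′) ∙ (S *ᵛ (G *ᵛ x′))             ≈⟨ ∙-cong Gx′≋w (*ᵛ-cong S Gx′≋w) ⟩
            w ∙ (S *ᵛ w)
              ≈⟨ ∙-congˡ w (λ i → trans (∙--ʳ (S i) (C •ᵛ y) z) (+-congʳ (∙-•ʳ (S i) C y))) ⟩
            w ∙ (C •ᵛ z -ᵛ S *ᵛ z)                   ≈⟨ trans (∙--ʳ w (C •ᵛ z) (S *ᵛ z)) (+-congʳ (∙-•ʳ w C z)) ⟩
            C * (w ∙ z) - w ∙ (S *ᵛ z)               ≈⟨ +-cong (*-congˡ (trans (∙--ˡ (C •ᵛ y) z z) (+-congʳ (∙-•ˡ C y z))))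
                                                          (-‿cong (trans (∙--ˡ (C •ᵛ y) z (S *ᵛ z)) (+-congʳ (∙-•ˡ C y (S *ᵛ z))))) ⟩
            C * (C * (y ∙ z) - z ∙ z) - (C * (y ∙ (S *ᵛ z)) - z ∙ (S *ᵛ z))
                                                     ≈⟨ +-congˡ (-‿cong (+-congʳ (*-congˡ (*ᵛ-selfAdjoint S-sym y z)))) ⟨
            C * (C * (y ∙ z) - z ∙ z) - (C * (z ∙ z) - z ∙ (S *ᵛ z))
                                                     ≈⟨ solve 4 (λ C r s q → C :* (C :* r :- s) :- (C :* s :- q)
                                                            := C :* (C :* r :- s) :- C :* s :+ q)
                                                          refl C (y ∙ z) (z ∙ z) (z ∙ (S *ᵛ z)) ⟩
            C * (C * (y ∙ z) - z ∙ z) - C * (z ∙ z) + z ∙ (S *ᵛ z)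
                                                     ≤⟨ +-mono-≤ ≤-refl (z∙Sz≤ z) ⟩
            C * (C * (y ∙ z) - z ∙ z) - C * (z ∙ z) + C * (z ∙ z)
                                                     ≈⟨ solve 2 (λ a b → a :- b :+ b := a)
                                                          refl (C * (C * (y ∙ z) - z ∙ z)) (C * (z ∙ z)) ⟩
            C * (C * (y ∙ z) - z ∙ z)                ∎))
            where
            open ≤-Reasoning
            y = G *ᵛ x
            z = S *ᵛ y
            -- S commutes with G, so this is a preimage of w under G.
            x′ = C •ᵛ x -ᵛ S *ᵛ x
            w = C •ᵛ y -ᵛ z
            Gx′≋w : (G *ᵛ x′) ≋ w
            Gx′≋w i = trans (∙--ʳ (G i) (C •ᵛ x) (S *ᵛ x))
              (+-cong (∙-•ʳ (G i) C x) (-‿cong (sym (SG≋GS x i))))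

        -- By the Fredholm alternative for the rows of S G: a vector `x` with S G x = 0 makes G x an
        -- eigenvector for λ₀ or zero, so `no-eigenvector` gives G x = 0 and excludes the second
        -- case.
        G-rows : ∀ i → Σ[ t ∈ Vec n ] G i ≋ (λ j → t ∙ ((S *ᴹ G) ᵀ) j)
        G-rows i with fredholm (S *ᴹ G) (G i)
        ... | inj₁ combination = combination
        ... | inj₂ (x , SGx≋0 , Gᵢx≉0) = contradiction (no-eigenvector λ₀ x AGx≋ i) Gᵢx≉0
          where
          AGx≋ : (A *ᵛ (G *ᵛ x)) ≋ (λ₀ •ᵛ (G *ᵛ x))
          AGx≋ j = x-y≈0⇒x≈y (trans (sym (S*ᵛ (G *ᵛ x) j)) (trans (sym (*ᴹ-*ᵛ S G x j)) (SGx≋0 j)))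

        -- T inverts S on the image of G. Being a matrix, it is bounded, and so |y| is bounded by a
        -- multiple of |S y|.
        G-factors : Σ[ T ∈ Matrix n n ] (∀ x → (G *ᵛ x) ≋ (T *ᵛ (S *ᵛ (G *ᵛ x))))
        G-factors = (λ i → proj₁ (G-rows i)) , λ x i → trans (∙-congʳ x (proj₂ (G-rows i)))
          (trans (∙-adjoint (S *ᴹ G) (proj₁ (G-rows i)) x) (∙-congˡ (proj₁ (G-rows i)) (*ᴹ-*ᵛ S G x)))

        -- For y = G x, |y|² = |T S y|² ≤ D |S y|² ≤ D C y·Sy. So y·Sy ≥ ε |y|², and λ₀ can be
        -- raised by ε.
        increase : ∀ {C D} → 0# ≤ C → 0# ≤ D → (T : Matrix n n) →
                   (∀ x → (S *ᵛ (G *ᵛ x)) ∙ (S *ᵛ (G *ᵛ x)) ≤ C * ((G *ᵛ x) ∙ (S *ᵛ (G *ᵛ x)))) →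
                   (∀ x → (G *ᵛ x) ≋ (T *ᵛ (S *ᵛ (G *ᵛ x)))) →
                   (∀ z → (T *ᵛ z) ∙ (T *ᵛ z) ≤ D * (z ∙ z)) →
                   ∃[ ε ] 0# < ε × BoundedBy (λ₀ + ε)
        increase {C} {D} 0≤C 0≤D T |Sy|²≤′ Gx≋TSGx |Tz|²≤ = ε , 0<ε , bounded
          where
          open ≤-Reasoning
          -- The summand 1 keeps E positive, hence invertible, even when D C vanishes; it costs an
          -- extra y·Sy ≥ 0.
          E = 1# + D * C
          0<E = +-pos-nonNeg 0<1 (*-nonNegative 0≤D 0≤C)
          ε = E ⁻¹
          0<ε = ⁻¹-pos 0<E

          y∙y≤ : ∀ x → let y = G *ᵛ x in y ∙ y ≤ E * (y ∙ (S *ᵛ y))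
          y∙y≤ x = let y = G *ᵛ x ; z = S *ᵛ y in begin
            y ∙ y                                ≈⟨ ∙-cong (Gx≋TSGx x) (Gx≋TSGx x) ⟩
            (T *ᵛ z) ∙ (T *ᵛ z)                  ≤⟨ |Tz|²≤ z ⟩
            D * (z ∙ z)                          ≤⟨ *-monoˡ-≤ 0≤D (|Sy|²≤′ x) ⟩
            D * (C * (y ∙ z))                    ≈⟨ +-identityˡ _ ⟨
            0# + D * (C * (y ∙ z))               ≤⟨ +-monoˡ-≤ _ (0≤y∙Sy x) ⟩
            y ∙ z + D * (C * (y ∙ z))
              ≈⟨ solve 3 (λ r D C → r :+ D :* (C :* r) := (con (+ 1) :+ D :* C) :* r) refl (y ∙ z) D C ⟩
            E * (y ∙ z)                          ∎

          εy∙y≤ : ∀ x → let y = G *ᵛ x in ε * (y ∙ y) ≤ y ∙ (S *ᵛ y)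
          εy∙y≤ x = let s = (G *ᵛ x) ∙ (G *ᵛ x) in *-cancelˡ-≤ 0<E (begin
            E * (ε * s)                          ≈⟨ *-assoc E ε s ⟨
            E * ε * s                            ≈⟨ *-congʳ (*-inverseʳ E (proj₂ 0<E ∘ sym)) ⟩
            1# * s                               ≈⟨ *-identityˡ s ⟩
            s                                    ≤⟨ y∙y≤ x ⟩
            E * ((G *ᵛ x) ∙ (S *ᵛ (G *ᵛ x)))     ∎)

          bounded : BoundedBy (λ₀ + ε)
          bounded x = let y = G *ᵛ x ; s = y ∙ y ; r = y ∙ (A *ᵛ y) in 0≤y-x⇒x≤y (begin
            0#                        ≤⟨ x≤y⇒0≤y-x (εy∙y≤ x) ⟩
            y ∙ (S *ᵛ y) - ε * s      ≈⟨ +-congʳ (y∙Sy y) ⟩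
            r - λ₀ * s - ε * s        ≈⟨ solve 4 (λ r l s e → r :- l :* s :- e :* s := r :- (l :+ e) :* s) refl r λ₀ s ε ⟩
            r - (λ₀ + ε) * s          ∎)

      not-greatest : ∀ λ₀ → BoundedBy λ₀ → ¬ (∀ μ → BoundedBy μ → μ ≤ λ₀)
      not-greatest λ₀ λ₀-bounded greatest =
        let C , (0≤C , _) , |Sy|²≤′ = |Sy|²≤ λ₀ λ₀-bounded
            T , Gx≋TSGx = G-factors λ₀ λ₀-bounded
            D , 0≤D , |Tz|²≤ = *ᵛ-bounded T
            ε , (0≤ε , 0≉ε) , bounded = increase λ₀ λ₀-bounded 0≤C 0≤D T |Sy|²≤′ Gx≋TSGx |Tz|²≤
        in 0≉ε (antisym 0≤ε (begin
             ε             ≈⟨ solve 2 (λ e l → e := l :+ e :- l) refl ε λ₀ ⟩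
             λ₀ + ε - λ₀   ≤⟨ +-monoˡ-≤ (- λ₀) (greatest (λ₀ + ε) bounded) ⟩
             λ₀ - λ₀       ≈⟨ -‿inverseʳ λ₀ ⟩
             0#            ∎))
        where open ≤-Reasoning

    no-eigenvector⇒≋0 : ∀ x → (G *ᵛ x) ≋ 0ᵛ
    no-eigenvector⇒≋0 x with ≋0? (G *ᵛ x)
    ... | yes Gx≋0 = Gx≋0
    ... | no  Gx≋̸0 =
      let λ₀ , λ₀-bounded , greatest = greatest-bound x Gx≋̸0
      in contradiction greatest (not-greatest λ₀ λ₀-bounded)

  sum-single : ∀ {n} (f : Vec n) i → (∀ j → ¬ j ≡ i → f j ≈ 0#) → sum f ≈ f i
  sum-single {suc n} f i f≈0 = trans (sum-remove f)
    (trans (+-congˡ (sum-zero (λ j → f (punchIn i j)) (λ j → f≈0 _ (Fin.punchInᵢ≢i i j)))) (+-identityʳ _))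

  opaque
    unfolding _∙_

    ∙-sumʳ : ∀ {m n} (x : Vec n) (Y : Fin m → Vec n) → x ∙ (λ j → sum (λ h → Y h j)) ≈ sum (λ h → x ∙ Y h)
    ∙-sumʳ x Y = trans (sum-cong-≋ (λ j → *-distribˡ-sum (x j) (λ h → Y h j))) (∑-comm (λ j h → x j * Y h j))

  ∙-sumˡ : ∀ {m n} (X : Fin m → Vec n) (y : Vec n) → (λ j → sum (λ h → X h j)) ∙ y ≈ sum (λ h → X h ∙ y)
  ∙-sumˡ X y = trans (∙-comm _ y) (trans (∙-sumʳ y X) (sum-cong-≋ (λ h → ∙-comm y (X h))))

  -- Eigenspaces of the square of a symmetric matrix

  module Square {n} {A : Matrix n n} (A-sym : IsSymmetric A) where

    A² : Vec n → Vec n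
    A² x = A *ᵛ (A *ᵛ x)

    A²-cong : ∀ {x y} → x ≋ y → A² x ≋ A² y
    A²-cong x≋y = *ᵛ-cong A (*ᵛ-cong A x≋y)

    *ᵛ--• : ∀ x a y → (A *ᵛ (x -ᵛ a •ᵛ y)) ≋ (A *ᵛ x -ᵛ a •ᵛ (A *ᵛ y))
    *ᵛ--• x a y i = trans (∙--ʳ (A i) x (a •ᵛ y)) (+-congˡ (-‿cong (∙-•ʳ (A i) a y)))

    A²--• : ∀ x a y → A² (x -ᵛ a •ᵛ y) ≋ (A² x -ᵛ a •ᵛ A² y)
    A²--• x a y i = trans (*ᵛ-cong A (*ᵛ--• x a y) i) (*ᵛ--• (A *ᵛ x) a (A *ᵛ y) i)

    A²-• : ∀ a x → A² (a •ᵛ x) ≋ a •ᵛ A² x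
    A²-• a x i = trans (*ᵛ-cong A (λ j → ∙-•ʳ (A j) a x) i) (∙-•ʳ (A i) a (A *ᵛ x))

    A²-+ : ∀ x y → A² (x +ᵛ y) ≋ A² x +ᵛ A² y
    A²-+ x y i = trans (*ᵛ-cong A (λ j → ∙-+ʳ (A j) x y) i) (∙-+ʳ (A i) (A *ᵛ x) (A *ᵛ y))

    A²-selfAdjoint : ∀ x y → A² x ∙ y ≈ x ∙ A² y
    A²-selfAdjoint x y = trans (*ᵛ-selfAdjoint A-sym (A *ᵛ x) y) (*ᵛ-selfAdjoint A-sym x (A *ᵛ y))

    A²-sum : ∀ {m} (X : Fin m → Vec n) → A² (λ j → sum (λ h → X h j)) ≋ (λ j → sum (λ h → A² (X h) j))
    A²-sum X i = trans (*ᵛ-cong A (λ j → ∙-sumʳ (A j) X) i) (∙-sumʳ (A i) (λ h → A *ᵛ X h))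

    Eigen : Carrier → Vec n → Set ℓ₁
    Eigen s x = A² x ≋ s •ᵛ x

    orthogonal : ∀ {s r x y} → Eigen s x → Eigen r y → ¬ s ≈ r → x ∙ y ≈ 0#
    orthogonal {s} {r} {x} {y} Ax Ay s≉r = x*y≈0 (s≉r ∘ x-y≈0⇒x≈y) (begin
      (s - r) * (x ∙ y)              ≈⟨ solve 3 (λ s r z → (s :- r) :* z := s :* z :- r :* z) refl s r (x ∙ y) ⟩
      s * (x ∙ y) - r * (x ∙ y)      ≈⟨ +-cong (∙-•ˡ s x y) (-‿cong (∙-•ʳ x r y)) ⟨
      (s •ᵛ x) ∙ y - x ∙ (r •ᵛ y)    ≈⟨ +-cong (∙-congʳ y Ax) (-‿cong (∙-congˡ x Ay)) ⟨
      A² x ∙ y - x ∙ A² y            ≈⟨ x≈y⇒x-y≈0 (A²-selfAdjoint x y) ⟩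
      0#                             ∎)
      where open ≈-Reasoning

    -- The product of the A² - σ j, applied to `x`, with the factor of index zero acting first.
    annihilate : ∀ {m} → Vec m → Vec n → Vec n
    annihilate {zero}  σ x = x
    annihilate {suc m} σ x = annihilate (σ ∘ suc) (A² x -ᵛ σ zero •ᵛ x)

    annihilate-cong : ∀ {m} (σ : Vec m) {x y} → x ≋ y → annihilate σ x ≋ annihilate σ y
    annihilate-cong {zero}  σ x≋y = x≋y
    annihilate-cong {suc m} σ x≋y = annihilate-cong (σ ∘ suc)
      (λ i → +-cong (A²-cong x≋y i) (-‿cong (*-congˡ (x≋y i))))

    annihilate--• : ∀ {m} (σ : Vec m) x a y →
                    annihilate σ (x -ᵛ a •ᵛ y) ≋ annihilate σ x -ᵛ a •ᵛ annihilate σ y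
    annihilate--• {zero}  σ x a y i = refl
    annihilate--• {suc m} σ x a y i = trans
      (annihilate-cong (σ ∘ suc) (λ j → trans (+-congʳ (A²--• x a y j))
        (solve 6 (λ X a Y s x y → X :- a :* Y :- s :* (x :- a :* y) := X :- s :* x :- a :* (Y :- s :* y)) refl
          (A² x j) a (A² y j) (σ zero) (x j) (y j))) i)
      (annihilate--• (σ ∘ suc) (A² x -ᵛ σ zero •ᵛ x) a (A² y -ᵛ σ zero •ᵛ y) i)

    annihilate-comm : ∀ {m} (σ : Vec m) x → (A *ᵛ annihilate σ x) ≋ annihilate σ (A *ᵛ x)
    annihilate-comm {zero}  σ x i = refl
    annihilate-comm {suc m} σ x i = trans (annihilate-comm (σ ∘ suc) (A² x -ᵛ σ zero •ᵛ x) i)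
      (annihilate-cong (σ ∘ suc) (*ᵛ--• (A² x) (σ zero) x) i)

    -- A factor peeled off the inside on the left reappears on the outside on the right;
    -- `annihilate-comm` moves it back in.
    annihilate-selfAdjoint : ∀ {m} (σ : Vec m) x y → annihilate σ x ∙ y ≈ x ∙ annihilate σ y
    annihilate-selfAdjoint {zero} σ x y = refl
    annihilate-selfAdjoint {suc m} σ x y = begin
      annihilate (σ ∘ suc) (A² x -ᵛ s •ᵛ x) ∙ y        ≈⟨ annihilate-selfAdjoint (σ ∘ suc) _ y ⟩
      (A² x -ᵛ s •ᵛ x) ∙ z
        ≈⟨ trans (∙--ˡ (A² x) (s •ᵛ x) z) (+-cong (A²-selfAdjoint x z) (-‿cong (∙-•ˡ s x z))) ⟩
      x ∙ A² z - s * (x ∙ z)                           ≈⟨ trans (∙--ʳ x (A² z) (s •ᵛ z)) (+-congˡ (-‿cong (∙-•ʳ x s z))) ⟨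
      x ∙ (A² z -ᵛ s •ᵛ z)
        ≈⟨ ∙-congˡ x (λ i → +-congʳ (trans (*ᵛ-cong A (annihilate-comm (σ ∘ suc) y) i) (annihilate-comm (σ ∘ suc) (A *ᵛ y) i))) ⟩
      x ∙ (annihilate (σ ∘ suc) (A² y) -ᵛ s •ᵛ z)      ≈⟨ ∙-congˡ x (annihilate--• (σ ∘ suc) (A² y) s y) ⟨
      x ∙ annihilate (σ ∘ suc) (A² y -ᵛ s •ᵛ y)        ∎
      where
      open ≈-Reasoning
      s = σ zero
      z = annihilate (σ ∘ suc) y

    annihilate-eigen : ∀ {m} (σ : Vec m) j {x} → Eigen (σ j) x → annihilate σ x ≋ 0ᵛ
    annihilate-eigen σ zero {x} Ax i = begin
      annihilate (σ ∘ suc) (A² x -ᵛ σ zero •ᵛ x) i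
        -- The zero vector is written as `x -ᵛ 1# •ᵛ x`, so that linearity in the form
        -- `annihilate--•` applies.
        ≈⟨ annihilate-cong (σ ∘ suc) (λ h → trans (x≈y⇒x-y≈0 (Ax h)) (sym (x≈y⇒x-y≈0 (sym (*-identityˡ _))))) i ⟩
      annihilate (σ ∘ suc) (x -ᵛ 1# •ᵛ x) i         ≈⟨ annihilate--• (σ ∘ suc) x 1# x i ⟩
      annihilate (σ ∘ suc) x i - 1# * annihilate (σ ∘ suc) x i   ≈⟨ x≈y⇒x-y≈0 (sym (*-identityˡ _)) ⟩
      0#                                            ∎
      where open ≈-Reasoning
    annihilate-eigen σ (suc j) {x} Ax = annihilate-eigen (σ ∘ suc) j (λ i → begin
      A² (A² x -ᵛ σ zero •ᵛ x) i                 ≈⟨ A²--• (A² x) (σ zero) x i ⟩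
      A² (A² x) i - σ zero * A² x i              ≈⟨ +-congʳ (trans (A²-cong Ax i) (A²-• s x i)) ⟩
      s * A² x i - σ zero * A² x i               ≈⟨ +-congˡ (-‿cong (*-congˡ (Ax i))) ⟩
      s * A² x i - σ zero * (s * x i)
        ≈⟨ solve 4 (λ s X r x → s :* X :- r :* (s :* x) := s :* (X :- r :* x)) refl s (A² x i) (σ zero) (x i) ⟩
      s * (A² x i - σ zero * x i)                ∎)
      where
      open ≈-Reasoning
      s = σ (suc j)

    -- `annihilate` as a matrix, the form in which the supremum argument, which applies `fredholm`,
    -- takes G.
    annihilator : ∀ {m} → Vec m → Matrix n n
    annihilator {zero}  σ = 1ᴹ
    annihilator {suc m} σ = annihilator (σ ∘ suc) *ᴹ (λ i j → (A *ᴹ A) i j - σ zero * 1ᴹ i j)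

    annihilator-*ᵛ : ∀ {m} (σ : Vec m) x → (annihilator σ *ᵛ x) ≋ annihilate σ x
    annihilator-*ᵛ {zero}  σ x i = 1ᴹ-∙ i x
    annihilator-*ᵛ {suc m} σ x i = trans (*ᴹ-*ᵛ (annihilator (σ ∘ suc)) M x i)
      (trans (annihilator-*ᵛ (σ ∘ suc) (M *ᵛ x) i) (annihilate-cong (σ ∘ suc) M*ᵛx i))
      where
      M : Matrix n n
      M i j = (A *ᴹ A) i j - σ zero * 1ᴹ i j
      M*ᵛx : (M *ᵛ x) ≋ (A² x -ᵛ σ zero •ᵛ x)
      M*ᵛx j = trans (∙--ˡ ((A *ᴹ A) j) (σ zero •ᵛ 1ᴹ j) x)
        (+-cong (*ᴹ-*ᵛ A A x j) (-‿cong (trans (∙-•ˡ (σ zero) (1ᴹ j) x) (*-congˡ (1ᴹ-∙ j x)))))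

    -- An eigenvector of A of the form G x is killed by the self-adjoint G, so (G x)·(G x) = x·(G (G x)) = 0.
    annihilate≋0 : ∀ {m} (σ : Vec m) →
                   (∀ θ x → ¬ x ≋ 0ᵛ → (A *ᵛ x) ≋ θ •ᵛ x → ∃[ j ] θ * θ ≈ σ j) →
                   ∀ x → annihilate σ x ≋ 0ᵛ
    annihilate≋0 σ spectrum x i = trans (sym (annihilator-*ᵛ σ x i))
      (no-eigenvector⇒≋0 A-sym G comm no-eigenvector x i)
      where
      G = annihilator σ

      comm : ∀ x → (A *ᵛ (G *ᵛ x)) ≋ (G *ᵛ (A *ᵛ x))
      comm x i = trans (*ᵛ-cong A (annihilator-*ᵛ σ x) i)
        (trans (annihilate-comm σ x i) (sym (annihilator-*ᵛ σ (A *ᵛ x) i)))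

      no-eigenvector : ∀ θ x → (A *ᵛ (G *ᵛ x)) ≋ (θ •ᵛ (G *ᵛ x)) → (G *ᵛ x) ≋ 0ᵛ
      no-eigenvector θ x AGx≋ with ≋0? (G *ᵛ x)
      ... | yes Gx≋0 = Gx≋0
      ... | no  Gx≋̸0 with spectrum θ (G *ᵛ x) Gx≋̸0 AGx≋
      ...   | j , θ²≈σⱼ = x∙x≈0⇒x≋0 {x = G *ᵛ x} (begin
        (G *ᵛ x) ∙ (G *ᵛ x)                       ≈⟨ ∙-cong (annihilator-*ᵛ σ x) (annihilator-*ᵛ σ x) ⟩
        annihilate σ x ∙ annihilate σ x           ≈⟨ annihilate-selfAdjoint σ x (annihilate σ x) ⟩
        x ∙ annihilate σ (annihilate σ x)         ≈⟨ ∙-congˡ x (annihilate-cong σ (annihilator-*ᵛ σ x)) ⟨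
        x ∙ annihilate σ (G *ᵛ x)                 ≈⟨ ∙-zeroʳ x (annihilate-eigen σ j eigen) ⟩
        0#                                        ∎)
        where
        open ≈-Reasoning
        eigen : Eigen (σ j) (G *ᵛ x)
        eigen h = begin
          A² (G *ᵛ x) h                  ≈⟨ *ᵛ-cong A AGx≋ h ⟩
          (A *ᵛ (θ •ᵛ (G *ᵛ x))) h       ≈⟨ ∙-•ʳ (A h) θ (G *ᵛ x) ⟩
          θ * (A *ᵛ (G *ᵛ x)) h          ≈⟨ *-congˡ (AGx≋ h) ⟩
          θ * (θ * (G *ᵛ x) h)           ≈⟨ *-assoc θ θ _ ⟨
          θ * θ * (G *ᵛ x) h             ≈⟨ *-congʳ θ²≈σⱼ ⟩
          σ j * (G *ᵛ x) h               ∎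

    -- Partial fractions, one eigenvalue at a time. The remaining factors kill y = A² x - σ₀ x, so y
    -- is a sum of eigenvectors Y i. Dividing Y i by its gap σᵢ - σ₀ gives a vector V with A² V - σ₀
    -- V = y, and x - V is then an eigenvector for σ₀.
    decompose : ∀ {m} (σ : Vec m) → (∀ i j → σ i ≈ σ j → i ≡ j) →
                ∀ x → annihilate σ x ≋ 0ᵛ →
                Σ[ X ∈ (Fin m → Vec n) ] (∀ i → Eigen (σ i) (X i)) × x ≋ (λ j → sum (λ i → X i j))
    decompose {zero}  σ distinct x x≋0 = (λ ()) , (λ ()) , x≋0
    decompose {suc m} σ distinct x Gx≋0 with decompose (σ ∘ suc)
      (λ i j e → Fin.suc-injective (distinct (suc i) (suc j) e)) (A² x -ᵛ σ zero •ᵛ x) Gx≋0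
    ... | Y , eigen-Y , y≋ΣY = X , eigen-X , λ j → solve 2 (λ x v → x := x :- con (+ 1) :* v :+ v) refl (x j) (V j)
      where
      open ≈-Reasoning
      gap : Fin m → Carrier
      gap i = σ (suc i) - σ zero

      gap≉0 : ∀ i → ¬ gap i ≈ 0#
      gap≉0 i gap≈0 with distinct (suc i) zero (x-y≈0⇒x≈y gap≈0)
      ... | ()

      X′ : Fin m → Vec n
      X′ i = gap i ⁻¹ •ᵛ Y i

      V : Vec n
      V j = sum (λ i → X′ i j)

      X : Fin (suc m) → Vec n
      X zero    = x -ᵛ 1# •ᵛ V
      X (suc i) = X′ i

      eigen-X′ : ∀ i → Eigen (σ (suc i)) (X′ i)
      eigen-X′ i j = begin
        A² (X′ i) j                        ≈⟨ A²-• (gap i ⁻¹) (Y i) j ⟩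
        gap i ⁻¹ * A² (Y i) j              ≈⟨ *-congˡ (eigen-Y i j) ⟩
        gap i ⁻¹ * (σ (suc i) * Y i j)
          ≈⟨ solve 3 (λ g s y → g :* (s :* y) := s :* (g :* y)) refl (gap i ⁻¹) (σ (suc i)) (Y i j) ⟩
        σ (suc i) * X′ i j                 ∎

      split : ∀ i j → A² (X′ i) j ≈ σ zero * X′ i j + Y i j
      split i j = begin
        A² (X′ i) j                                ≈⟨ eigen-X′ i j ⟩
        σ (suc i) * (gap i ⁻¹ * Y i j)
          ≈⟨ solve 4 (λ s r g y → s :* (g :* y) := r :* (g :* y) :+ (s :- r) :* g :* y)
               refl (σ (suc i)) (σ zero) (gap i ⁻¹) (Y i j) ⟩
        σ zero * X′ i j + gap i * gap i ⁻¹ * Y i j ≈⟨ +-congˡ (trans (*-congʳ (*-inverseʳ (gap i) (gap≉0 i))) (*-identityˡ _)) ⟩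
        σ zero * X′ i j + Y i j                    ∎

      A²V : ∀ j → A² V j ≈ σ zero * V j + (A² x -ᵛ σ zero •ᵛ x) j
      A²V j = begin
        A² V j                                         ≈⟨ A²-sum X′ j ⟩
        sum (λ i → A² (X′ i) j)                        ≈⟨ sum-cong-≋ (λ i → split i j) ⟩
        sum (λ i → σ zero * X′ i j + Y i j)            ≈⟨ ∑-distrib-+ (λ i → σ zero * X′ i j) (λ i → Y i j) ⟩
        sum (λ i → σ zero * X′ i j) + sum (λ i → Y i j) ≈⟨ +-cong (*-distribˡ-sum (σ zero) (λ i → X′ i j)) (y≋ΣY j) ⟨
        σ zero * V j + (A² x -ᵛ σ zero •ᵛ x) j         ∎

      eigen-X : ∀ i → Eigen (σ i) (X i)
      eigen-X (suc i) = eigen-X′ i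
      eigen-X zero j = begin
        A² (x -ᵛ 1# •ᵛ V) j                                          ≈⟨ A²--• x 1# V j ⟩
        A² x j - 1# * A² V j                                         ≈⟨ +-congˡ (-‿cong (*-congˡ (A²V j))) ⟩
        A² x j - 1# * (σ zero * V j + (A² x j - σ zero * x j))
          ≈⟨ solve 4 (λ X s v x → X :- con (+ 1) :* (s :* v :+ (X :- s :* x)) := s :* (x :- con (+ 1) :* v))
               refl (A² x j) (σ zero) (V j) (x j) ⟩
        σ zero * (x j - 1# * V j)                                    ∎

    -- Horner evaluation of the polynomial at A², applied to a vector.
    act : Poly → Vec n → Vec n
    act []       x = 0ᵛ
    act (a ∷ ps) x = a •ᵛ x +ᵛ A² (act ps x)

    act-cong : ∀ ps {x y} → x ≋ y → act ps x ≋ act ps y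
    act-cong []       x≋y i = refl
    act-cong (a ∷ ps) x≋y i = +-cong (*-congˡ (x≋y i)) (A²-cong (act-cong ps x≋y) i)

    act-sum : ∀ {m} ps (X : Fin m → Vec n) → act ps (λ j → sum (λ h → X h j)) ≋ (λ j → sum (λ h → act ps (X h) j))
    act-sum {m} []   X i = sym (sum-replicate-zero m)
    act-sum (a ∷ ps) X i = trans
      (+-cong (*-distribˡ-sum a (λ h → X h i)) (trans (A²-cong (act-sum ps X) i) (A²-sum (λ h → act ps (X h)) i)))
      (sym (∑-distrib-+ (λ h → a * X h i) (λ h → A² (act ps (X h)) i)))

    act-eigen : ∀ ps {s x} → Eigen s x → act ps x ≋ eval ps s •ᵛ x
    act-eigen []       Ax i = sym (zeroˡ _)
    act-eigen (a ∷ ps) {s} {x} Ax i = begin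
      a * x i + A² (act ps x) i          ≈⟨ +-congˡ (trans (A²-cong (act-eigen ps Ax) i) (A²-• (eval ps s) x i)) ⟩
      a * x i + eval ps s * A² x i       ≈⟨ +-congˡ (*-congˡ (Ax i)) ⟩
      a * x i + eval ps s * (s * x i)
        ≈⟨ solve 4 (λ a e s x → a :* x :+ e :* (s :* x) := (a :+ s :* e) :* x) refl a (eval ps s) s (x i) ⟩
      (a + s * eval ps s) * x i          ∎
      where open ≈-Reasoning

    -- The trace of the polynomial at A², since `1ᴹ u` is the unit vector at `u`.
    trace : Poly → Carrier
    trace ps = sum (λ u → act ps (1ᴹ u) u)

    module Resolution {m} (σ : Vec m) (distinct : ∀ i j → σ i ≈ σ j → i ≡ j)
      (X : Fin n → Fin m → Vec n) (eigen : ∀ u i → Eigen (σ i) (X u i))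
      (1ᴹ≋ΣX : ∀ u → 1ᴹ u ≋ (λ j → sum (λ i → X u i j))) where

      -- X u i is the orthogonal projection of the unit vector at u on the eigenspace of σ i.
      component-∙ : ∀ u i {y} → Eigen (σ i) y → X u i ∙ y ≈ y u
      component-∙ u i {y} Ay = begin
        X u i ∙ y
          ≈⟨ sum-single (λ j → X u j ∙ y) i (λ j j≢i → orthogonal (eigen u j) Ay (j≢i ∘ distinct j i)) ⟨
        sum (λ j → X u j ∙ y)               ≈⟨ ∙-sumˡ (X u) y ⟨
        (λ h → sum (λ j → X u j h)) ∙ y     ≈⟨ ∙-congʳ y (1ᴹ≋ΣX u) ⟨
        1ᴹ u ∙ y                            ≈⟨ 1ᴹ-∙ u y ⟩
        y u                                 ∎
        where open ≈-Reasoning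

      -- The trace of the projection on an eigenspace, that is, its dimension.
      multiplicity : Fin m → Carrier
      multiplicity i = sum (λ u → X u i u)

      0≤Xᵤᵤ : ∀ i u → 0# ≤ X u i u
      0≤Xᵤᵤ i u = ≤-respʳ-≈ (component-∙ u i (eigen u i)) (0≤x∙x (X u i))

      -- The diagonal entries are the squares |X u i|². If their sum is zero the whole projection is
      -- zero, and y u = X u i · y vanishes for every eigenvector `y`.
      multiplicity-pos : ∀ i y → ¬ y ≋ 0ᵛ → Eigen (σ i) y → 0# < multiplicity i
      multiplicity-pos i y y≋̸0 Ay = sum-nonNegative (λ u → X u i u) (0≤Xᵤᵤ i) , λ 0≈m → y≋̸0 (λ u → begin
        y u            ≈⟨ component-∙ u i Ay ⟨
        X u i ∙ y      ≈⟨ ∙-comm (X u i) y ⟩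
        y ∙ X u i      ≈⟨ ∙-zeroʳ y (x∙x≈0⇒x≋0 (trans (component-∙ u i (eigen u i))
                            (sum≈0⇒term≈0 (λ u → X u i u) (0≤Xᵤᵤ i) (sym 0≈m) u))) ⟩
        0#             ∎)
        where open ≈-Reasoning

      trace-formula : ∀ ps → trace ps ≈ sum (λ i → eval ps (σ i) * multiplicity i)
      trace-formula ps = begin
        sum (λ u → act ps (1ᴹ u) u)
          ≈⟨ sum-cong-≋ (λ u → trans (act-cong ps (1ᴹ≋ΣX u) u) (act-sum ps (X u) u)) ⟩
        sum (λ u → sum (λ i → act ps (X u i) u))
          ≈⟨ sum-cong-≋ (λ u → sum-cong-≋ (λ i → act-eigen ps (eigen u i) u)) ⟩
        sum (λ u → sum (λ i → eval ps (σ i) * X u i u))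
          ≈⟨ ∑-comm (λ u i → eval ps (σ i) * X u i u) ⟩
        sum (λ i → sum (λ u → eval ps (σ i) * X u i u))
          ≈⟨ sum-cong-≋ (λ i → *-distribˡ-sum (eval ps (σ i)) (λ u → X u i u)) ⟨
        sum (λ i → eval ps (σ i) * multiplicity i) ∎
        where open ≈-Reasoning

  -- Non-backtracking walks

  module SquarePolynomials {n} {A : Matrix n n} (A-sym : IsSymmetric A) where
    open Over {{ℝ}} using (X)
    open Square A-sym

    A²-zero : A² 0ᵛ ≋ 0ᵛ
    A²-zero = *ᵛ-zero A (*ᵛ-zero A (λ _ → refl))

    act-+ : ∀ ps qs x → act (ps +ₚ qs) x ≋ act ps x +ᵛ act qs x
    act-+ []       qs       x i = sym (+-identityˡ _)
    act-+ (a ∷ ps) []       x i = sym (+-identityʳ _)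
    act-+ (a ∷ ps) (b ∷ qs) x i = trans
      (+-congˡ (trans (A²-cong (act-+ ps qs x) i) (A²-+ (act ps x) (act qs x) i)))
      (solve 5 (λ a b x p q → (a :+ b) :* x :+ (p :+ q) := a :* x :+ p :+ (b :* x :+ q)) refl
        a b (x i) (A² (act ps x) i) (A² (act qs x) i))

    act-• : ∀ a ps x → act (a •ₚ ps) x ≋ a •ᵛ act ps x
    act-• a []       x i = sym (zeroʳ a)
    act-• a (b ∷ ps) x i = trans
      (+-congˡ (trans (A²-cong (act-• a ps x) i) (A²-• a (act ps x) i)))
      (solve 4 (λ a b x p → a :* b :* x :+ a :* p := a :* (b :* x :+ p)) refl a b (x i) (A² (act ps x) i))

    act-- : ∀ ps qs x → act (ps -ₚ qs) x ≋ act ps x -ᵛ act qs x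
    act-- ps qs x i = trans (act-+ ps ((- 1#) •ₚ qs) x i)
      (trans (+-congˡ (act-• (- 1#) qs x i))
        (solve 2 (λ p q → p :+ :- con (+ 1) :* q := p :- q) refl (act ps x i) (act qs x i)))

    act-* : ∀ ps qs x → act (ps *ₚ qs) x ≋ act ps (act qs x)
    act-* []       qs x i = refl
    act-* (a ∷ ps) qs x i = trans (act-+ (a •ₚ qs) (0# ∷ ps *ₚ qs) x i)
      (+-cong (act-• a qs x i)
        (trans (+-cong (zeroˡ _) (A²-cong (act-* ps qs x) i)) (+-identityˡ _)))

    act-constant : ∀ a x → act (constant a) x ≋ a •ᵛ x
    act-constant a x i = trans (+-congˡ (A²-zero i)) (+-identityʳ _)

    act-X : ∀ x → act X x ≋ A² x
    act-X x i = trans (+-cong (zeroˡ _) (A²-cong (λ j → trans (act-constant 1# x j) (*-identityˡ _)) i)) (+-identityˡ _)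

    act-sumₚ : ∀ {m} (P : Vector Poly m) x → act (sumₚ P) x ≋ (λ j → sum (λ i → act (P i) x j))
    act-sumₚ {zero}  P x j = refl
    act-sumₚ {suc m} P x j = trans (act-+ (P zero) (sumₚ (P ∘ suc)) x j) (+-congˡ (act-sumₚ (P ∘ suc) x j))

  -- Idempotent entries of a field are 0 or 1. In this form the walk counts below become ring
  -- identities with no graph in sight.
  record IsRegularAdjacency {n} (k : ℕ) (A : Matrix n n) : Set (ℓ₁ ⊔ ℓ₂) where
    field
      A-sym    : IsSymmetric A
      A-idem   : ∀ i j → A i j * A i j ≈ A i j
      0≤A      : ∀ i j → 0# ≤ A i j
      row-sum  : ∀ i → sum (A i) ≈ fromℕ k

  module NonBacktracking {n k} {A : Matrix n n} (A-regular : IsRegularAdjacency k A) where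
    open Over {{ℝ}} using (X)
    open IsRegularAdjacency A-regular
    open Square A-sym
    open SquarePolynomials A-sym

    κ : Carrier
    κ = fromℕ k

    -- walk z i x y is the number of non-backtracking walks of length i + 1
    -- from x to z whose first step goes to y.
    walk : Fin n → ℕ → Fin n → Fin n → Carrier
    walk z zero    x y = A x y * 1ᴹ z y
    walk z (suc i) x y = A x y * (sum (walk z i y) - walk z i y x)

    -- The counts by length alone. Length 0 stands apart because `walk` needs a first step, so
    -- length i + 1 uses index i.
    walks : Fin n → ℕ → Vec n
    walks z zero    = 1ᴹ z
    walks z (suc i) = λ x → sum (walk z i x)

    0≤1ᴹ : ∀ {n} (i j : Fin n) → 0# ≤ 1ᴹ i j
    0≤1ᴹ i j with i Fin.≟ j
    ... | yes _ = 0≤1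
    ... | no  _ = ≤-refl

    -- What is subtracted, the walks that step straight back, is one of the summands.
    0≤walk : ∀ z i x y → 0# ≤ walk z i x y
    0≤walk z zero    x y = *-nonNegative (0≤A x y) (0≤1ᴹ z y)
    0≤walk z (suc i) x y = *-nonNegative (0≤A x y)
      (x≤y⇒0≤y-x (term≤sum (walk z i y) (0≤walk z i y) x))

    0≤walks : ∀ z i x → 0# ≤ walks z i x
    0≤walks z zero    x = 0≤1ᴹ z x
    0≤walks z (suc i) x = sum-nonNegative (walk z i x) (0≤walk z i x)

    A*walk : ∀ z i x y → A x y * walk z i x y ≈ walk z i x y
    A*walk z zero    x y = trans (sym (*-assoc _ _ _)) (*-congʳ (A-idem x y))
    A*walk z (suc i) x y = trans (sym (*-assoc _ _ _)) (*-congʳ (A-idem x y))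

    A*A : ∀ x y → A x y * A y x ≈ A x y
    A*A x y = trans (*-congˡ (A-sym y x)) (A-idem x y)

    A*ᵛ : ∀ x y → (A *ᵛ x) y ≈ sum (λ z → A y z * x z)
    A*ᵛ x y = reflexive (∙-def (A y) x)

    row-sum* : ∀ x a → sum (λ y → A x y * a) ≈ κ * a
    row-sum* x a = trans (sym (*-distribʳ-sum a (A x))) (*-congʳ (row-sum x))

    walks₁ : ∀ z → (A *ᵛ walks z 0) ≋ walks z 1
    walks₁ z x = A*ᵛ (1ᴹ z) x

    -- A step from x to y in front of a walk from y either continues without turning back or is
    -- undone at once; the last sum counts the second kind.
    extend : ∀ z i x → (A *ᵛ walks z (suc i)) x ≈
                       walks z (suc (suc i)) x + sum (λ y → A x y * walk z i y x)
    extend z i x = begin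
      (A *ᵛ walks z (suc i)) x                                      ≈⟨ A*ᵛ (walks z (suc i)) x ⟩
      sum (λ y → A x y * sum (walk z i y))                          ≈⟨ sum-cong-≋ (λ y →
        solve 3 (λ a s w → a :* s := a :* (s :- w) :+ a :* w) refl (A x y) (sum (walk z i y)) (walk z i y x)) ⟩
      sum (λ y → walk z (suc i) x y + A x y * walk z i y x)
        ≈⟨ ∑-distrib-+ (walk z (suc i) x) (λ y → A x y * walk z i y x) ⟩
      sum (walk z (suc i) x) + sum (λ y → A x y * walk z i y x)     ∎
      where open ≈-Reasoning

    -- In x → y → x no later step restricts y, so all κ neighbours occur. This is the exceptional
    -- coefficient of F₂.
    walks₂ : ∀ z → (A *ᵛ walks z 1) ≋ walks z 2 +ᵛ κ •ᵛ walks z 0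
    walks₂ z x = trans (extend z 0 x) (+-congˡ (begin
      sum (λ y → A x y * (A y x * 1ᴹ z x))  ≈⟨ sum-cong-≋ (λ y → trans (sym (*-assoc _ _ _)) (*-congʳ (A*A x y))) ⟩
      sum (λ y → A x y * 1ᴹ z x)            ≈⟨ row-sum* x (1ᴹ z x) ⟩
      κ * 1ᴹ z x                            ∎))
      where open ≈-Reasoning

    -- In x → y → x → ... the walk resumed at x must not begin with y, which leaves κ - 1 choices of
    -- y for each such walk.
    walks₃₊ : ∀ z i → (A *ᵛ walks z (2 ℕ.+ i)) ≋ walks z (3 ℕ.+ i) +ᵛ (κ - 1#) •ᵛ walks z (1 ℕ.+ i)
    walks₃₊ z i x = trans (extend z (suc i) x) (+-congˡ (begin
      sum (λ y → A x y * (A y x * (W - walk z i x y)))   ≈⟨ sum-cong-≋ (λ y → back y) ⟩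
      sum (λ y → A x y * W + - walk z i x y)             ≈⟨ ∑-distrib-+ (λ y → A x y * W) (λ y → - walk z i x y) ⟩
      sum (λ y → A x y * W) + sum (λ y → - walk z i x y) ≈⟨ +-cong (row-sum* x W) (sum-neg (walk z i x)) ⟩
      κ * W - W                                          ≈⟨ solve 2 (λ k w → k :* w :- w := (k :- con (+ 1)) :* w) refl κ W ⟩
      (κ - 1#) * W                                       ∎))
      where
      open ≈-Reasoning
      W = sum (walk z i x)
      back : ∀ y → A x y * (A y x * (W - walk z i x y)) ≈ A x y * W + - walk z i x y
      back y = begin
        A x y * (A y x * (W - walk z i x y))   ≈⟨ *-assoc _ _ _ ⟨
        A x y * A y x * (W - walk z i x y)     ≈⟨ *-congʳ (A*A x y) ⟩
        A x y * (W - walk z i x y)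
          ≈⟨ solve 3 (λ a s w → a :* (s :- w) := a :* s :+ :- (a :* w)) refl (A x y) W (walk z i x y) ⟩
        A x y * W + - (A x y * walk z i x y)   ≈⟨ +-congˡ (-‿cong (A*walk z i x y)) ⟩
        A x y * W + - walk z i x y             ∎

    *ᵛ-+• : ∀ x a y → (A *ᵛ (x +ᵛ a •ᵛ y)) ≋ (A *ᵛ x +ᵛ a •ᵛ (A *ᵛ y))
    *ᵛ-+• x a y i = trans (∙-+ʳ (A i) x (a •ᵛ y)) (+-congˡ (∙-•ʳ (A i) a y))

    A²-walks₀ : ∀ z → A² (walks z 0) ≋ walks z 2 +ᵛ κ •ᵛ walks z 0
    A²-walks₀ z i = trans (*ᵛ-cong A (walks₁ z) i) (walks₂ z i)

    A²-walks₂ : ∀ z i → A² (walks z 2) i ≈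
      walks z 4 i + (κ - 1#) * walks z 2 i + (κ - 1#) * (walks z 2 i + κ * walks z 0 i)
    A²-walks₂ z i = trans (*ᵛ-cong A (walks₃₊ z 0) i)
      (trans (*ᵛ-+• (walks z 3) (κ - 1#) (walks z 1) i)
        (+-cong (walks₃₊ z 1 i) (*-congˡ (walks₂ z i))))

    A²-walks₃₊ : ∀ z j i → A² (walks z (3 ℕ.+ j)) i ≈
      walks z (5 ℕ.+ j) i + (κ - 1#) * walks z (3 ℕ.+ j) i
        + (κ - 1#) * (walks z (3 ℕ.+ j) i + (κ - 1#) * walks z (1 ℕ.+ j) i)
    A²-walks₃₊ z j i = trans (*ᵛ-cong A (walks₃₊ z (1 ℕ.+ j)) i)
      (trans (*ᵛ-+• (walks z (4 ℕ.+ j)) (κ - 1#) (walks z (2 ℕ.+ j)) i)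
        (+-cong (walks₃₊ z (2 ℕ.+ j) i) (*-congˡ (walks₃₊ z j i))))

    -- The counts obey the recurrence of F with A in place of x. Taken two steps at a time this is
    -- the recurrence of 𝓕 in A².
    act-𝓕 : ∀ z j → act (𝓕 k j) (1ᴹ z) ≋ walks z (j ℕ.* 2)
    act-𝓕 z 0 i = trans (act-constant 1# (1ᴹ z) i) (*-identityˡ _)
    act-𝓕 z 1 i = begin
      act (X -ₚ constant κ) e i            ≈⟨ act-- X (constant κ) e i ⟩
      act X e i - act (constant κ) e i     ≈⟨ +-cong (act-X e i) (-‿cong (act-constant κ e i)) ⟩
      A² e i - κ * e i                     ≈⟨ +-congʳ (A²-walks₀ z i) ⟩
      walks z 2 i + κ * e i - κ * e i      ≈⟨ solve 2 (λ w k → w :+ k :- k := w) refl (walks z 2 i) (κ * e i) ⟩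
      walks z 2 i                          ∎
      where
      open ≈-Reasoning
      e = 1ᴹ z
    act-𝓕 z 2 i = begin
      act (X *ₚ X -ₚ b •ₚ X +ₚ constant (κ * (κ - 1#))) e i
        ≈⟨ trans (act-+ (X *ₚ X -ₚ b •ₚ X) (constant (κ * (κ - 1#))) e i)
             (+-cong (act-- (X *ₚ X) (b •ₚ X) e i) (act-constant (κ * (κ - 1#)) e i)) ⟩
      act (X *ₚ X) e i - act (b •ₚ X) e i + κ * (κ - 1#) * e i
        ≈⟨ +-congʳ (+-cong
             (trans (act-* X X e i) (trans (act-X (act X e) i) (A²-cong (act-X e) i)))
             (-‿cong (trans (act-• b X e i) (*-congˡ (act-X e i))))) ⟩
      A² (A² e) i - b * A² e i + κ * (κ - 1#) * e i
        ≈⟨ +-congʳ (+-cong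
             (trans (A²-cong (A²-walks₀ z) i) (trans (A²-+ (walks z 2) (κ •ᵛ e) i)
               (+-cong (A²-walks₂ z i) (trans (A²-• κ e i) (*-congˡ (A²-walks₀ z i))))))
             (-‿cong (*-congˡ (A²-walks₀ z i)))) ⟩
      W₄ + m * W₂ + m * (W₂ + κ * e i) + κ * (W₂ + κ * e i) - b * (W₂ + κ * e i) + κ * m * e i
        -- The nested sums of 𝟙 ending in 𝟘 spell out how `fromℕ 3` and `fromℕ 2` unfold.
        ≈⟨ solve 4 (λ k e W₂ W₄ →
             let 𝟙 = con (+ 1) ; 𝟘 = con (+ 0) ; m = k :- 𝟙 in
             W₄ :+ m :* W₂ :+ m :* (W₂ :+ k :* e) :+ k :* (W₂ :+ k :* e)
               :- ((𝟙 :+ (𝟙 :+ (𝟙 :+ 𝟘))) :* k :- (𝟙 :+ (𝟙 :+ 𝟘))) :* (W₂ :+ k :* e) :+ k :* m :* e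
             := W₄) refl κ (e i) W₂ W₄ ⟩
      W₄ ∎
      where
      open ≈-Reasoning
      e = 1ᴹ z
      b = fromℕ 3 * κ - fromℕ 2
      m = κ - 1#
      W₂ = walks z 2 i
      W₄ = walks z 4 i
    act-𝓕 z (suc (suc (suc j))) i = begin
      act (L *ₚ 𝓕 k (2 ℕ.+ j) -ₚ (m * m) •ₚ 𝓕 k (1 ℕ.+ j)) e i
        ≈⟨ act-- (L *ₚ 𝓕 k (2 ℕ.+ j)) ((m * m) •ₚ 𝓕 k (1 ℕ.+ j)) e i ⟩
      act (L *ₚ 𝓕 k (2 ℕ.+ j)) e i - act ((m * m) •ₚ 𝓕 k (1 ℕ.+ j)) e i
        ≈⟨ +-cong (trans (act-* L (𝓕 k (2 ℕ.+ j)) e i) (act-cong L (act-𝓕 z (suc (suc j))) i))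
             (-‿cong (trans (act-• (m * m) (𝓕 k (1 ℕ.+ j)) e i) (*-congˡ (act-𝓕 z (suc j) i)))) ⟩
      act L y i - m * m * W₂
        ≈⟨ +-congʳ (trans (act-+ (X -ₚ constant (fromℕ 2 * κ)) (constant (fromℕ 2)) y i)
             (+-cong (trans (act-- X (constant (fromℕ 2 * κ)) y i)
               (+-cong (trans (act-X y i) (A²-walks₃₊ z (1 ℕ.+ j ℕ.* 2) i))
                 (-‿cong (act-constant (fromℕ 2 * κ) y i)))) (act-constant (fromℕ 2) y i))) ⟩
      W₆ + m * W₄ + m * (W₄ + m * W₂) - fromℕ 2 * κ * W₄ + fromℕ 2 * W₄ - m * m * W₂
        ≈⟨ solve 4 (λ k W₂ W₄ W₆ →
             let 𝟙 = con (+ 1) ; 𝟘 = con (+ 0) ; m = k :- 𝟙 ; 𝟚 = 𝟙 :+ (𝟙 :+ 𝟘) in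
             W₆ :+ m :* W₄ :+ m :* (W₄ :+ m :* W₂) :- 𝟚 :* k :* W₄ :+ 𝟚 :* W₄ :- m :* m :* W₂
             := W₆) refl κ W₂ W₄ W₆ ⟩
      W₆ ∎
      where
      open ≈-Reasoning
      e = 1ᴹ z
      m = κ - 1#
      L = X -ₚ constant (fromℕ 2 * κ) +ₚ constant (fromℕ 2)
      y = walks z (4 ℕ.+ j ℕ.* 2)
      W₂ = walks z (2 ℕ.+ j ℕ.* 2) i
      W₄ = walks z (4 ℕ.+ j ℕ.* 2) i
      W₆ = walks z (6 ℕ.+ j ℕ.* 2) i

    walk-pos-base : ∀ {x z} → A x z ≈ 1# → 0# < walk z 0 x z
    walk-pos-base {x} {z} Axz≈1 = *-nonNegative (0≤A x z) (0≤1ᴹ z z) , λ 0≈w →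
      0≉1 (trans 0≈w (trans (*-cong Axz≈1 1ᴹzz) (*-identityˡ 1#)))
      where
      1ᴹzz : 1ᴹ z z ≈ 1#
      1ᴹzz with z Fin.≟ z
      ... | yes _   = refl
      ... | no  z≢z = contradiction ≡.refl z≢z

    -- As u ≠ x, the walks that begin y → u survive the subtraction of those that begin y → x.
    walk-pos-step : ∀ z i {x y u} → A x y ≈ 1# → ¬ u ≡ x → 0# < walk z i y u → 0# < walk z (suc i) x y
    walk-pos-step z i {x} {y} {u} Axy≈1 u≢x (0≤w , 0≉w) = 0≤walk z (suc i) x y , λ 0≈w′ →
      0≉w (antisym 0≤w (begin
        walk z i y u                            ≈⟨ solve 2 (λ u x → u := u :+ x :- x) refl (walk z i y u) (walk z i y x) ⟩
        walk z i y u + walk z i y x - walk z i y x   ≤⟨ +-monoˡ-≤ _ (two-terms≤sum (walk z i y) (0≤walk z i y) u≢x) ⟩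
        sum (walk z i y) - walk z i y x         ≈⟨ *-identityˡ _ ⟨
        1# * (sum (walk z i y) - walk z i y x)  ≈⟨ *-congʳ Axy≈1 ⟨
        walk z (suc i) x y                      ≈⟨ 0≈w′ ⟨
        0#                                      ∎))
      where open ≤-Reasoning

  -- Regular bipartite graphs

  indicator-yes : ∀ {p} {P : Set p} (P? : Dec P) → P → (if does P? then 1# else 0#) ≈ 1#
  indicator-yes P? p = reflexive (≡.cong (if_then 1# else 0#) (dec-true P? p))

  indicator-no : ∀ {p} {P : Set p} (P? : Dec P) → ¬ P → (if does P? then 1# else 0#) ≈ 0#
  indicator-no P? ¬p = reflexive (≡.cong (if_then 1# else 0#) (dec-false P? ¬p))

  -- A general `g` lets the induction pass to `g ∘ suc`; `allFin` is the case of the identity.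
  sum-indicator : ∀ {p m n} {P : Pred (Fin m) p} (P? : Decidable P) (g : Fin n → Fin m) →
                  sum (λ i → if does (P? (g i)) then 1# else 0#) ≈ fromℕ (Vec.count P? (Vec.tabulate g))
  sum-indicator {n = zero}  P? g = refl
  sum-indicator {n = suc n} P? g with P? (g zero)
  ... | yes _ = +-congˡ (sum-indicator P? (g ∘ suc))
  ... | no  _ = trans (+-identityˡ _) (sum-indicator P? (g ∘ suc))

  sum-splitAt : ∀ {q} p (f : Fin p ⊎ Fin q → Carrier) →
                sum (λ i → f (splitAt p i)) ≈ sum (f ∘ inj₁) + sum (f ∘ inj₂)
  sum-splitAt zero    f = sym (+-identityˡ _)
  sum-splitAt (suc p) f = trans (+-congˡ (sum-splitAt p (f ∘ Sum.map₁ suc))) (sym (+-assoc _ _ _))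

  does-not : ∀ a b → does (not a Bool.≟ b) ≡ does (a Bool.≟ not b)
  does-not true  true  = ≡.refl
  does-not true  false = ≡.refl
  does-not false true  = ≡.refl
  does-not false false = ≡.refl

  -- Stated for two abstract classes `l` and `r`, so that exchanging them turns the result for N Nᵀ
  -- into the one for Nᵀ N.
  module Blocks {n p q} {A : Matrix n n} (A-sym : IsSymmetric A)
    (l : Fin p → Fin n) (r : Fin q → Fin n)
    (sum-split : ∀ f → sum f ≈ sum (f ∘ l) + sum (f ∘ r))
    (A-ll : ∀ i i′ → A (l i) (l i′) ≈ 0#) (A-rr : ∀ j j′ → A (r j) (r j′) ≈ 0#)
    (1ᴹ-ll : ∀ i i′ → 1ᴹ (l i) (l i′) ≈ 1ᴹ i i′) (1ᴹ-lr : ∀ i j → 1ᴹ (l i) (r j) ≈ 0#)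
    (N : Matrix p q) (N≈A : ∀ i j → N i j ≈ A (l i) (r j)) where
    open Square A-sym

    A*ᵛ-l : ∀ x i → (A *ᵛ x) (l i) ≈ N i ∙ (x ∘ r)
    A*ᵛ-l x i = begin
      A (l i) ∙ x                            ≡⟨ ∙-def (A (l i)) x ⟩
      sum (λ u → A (l i) u * x u)            ≈⟨ sum-split (λ u → A (l i) u * x u) ⟩
      sum (λ h → A (l i) (l h) * x (l h)) + sum (λ j → A (l i) (r j) * x (r j))
        ≈⟨ +-cong (sum-zero (λ h → A (l i) (l h) * x (l h)) (λ h → trans (*-congʳ (A-ll i h)) (zeroˡ _)))
             (sum-cong-≋ (λ j → *-congʳ (sym (N≈A i j)))) ⟩
      0# + sum (λ j → N i j * x (r j))       ≈⟨ +-identityˡ _ ⟩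
      sum (λ j → N i j * x (r j))            ≡⟨ ∙-def (N i) (x ∘ r) ⟨
      N i ∙ (x ∘ r)                          ∎
      where open ≈-Reasoning

    A*ᵛ-r : ∀ x j → (A *ᵛ x) (r j) ≈ (N ᵀ) j ∙ (x ∘ l)
    A*ᵛ-r x j = begin
      A (r j) ∙ x                            ≡⟨ ∙-def (A (r j)) x ⟩
      sum (λ u → A (r j) u * x u)            ≈⟨ sum-split (λ u → A (r j) u * x u) ⟩
      sum (λ h → A (r j) (l h) * x (l h)) + sum (λ h → A (r j) (r h) * x (r h))
        ≈⟨ +-cong (sum-cong-≋ (λ h → *-congʳ (trans (A-sym (r j) (l h)) (sym (N≈A h j)))))
             (sum-zero (λ h → A (r j) (r h) * x (r h)) (λ h → trans (*-congʳ (A-rr j h)) (zeroˡ _))) ⟩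
      sum (λ h → N h j * x (l h)) + 0#       ≈⟨ +-identityʳ _ ⟩
      sum (λ h → N h j * x (l h))            ≡⟨ ∙-def ((N ᵀ) j) (x ∘ l) ⟨
      (N ᵀ) j ∙ (x ∘ l)                      ∎
      where open ≈-Reasoning

    act-r : ∀ ps i j → act ps (1ᴹ (l i)) (r j) ≈ 0#
    act-r []       i j = refl
    act-r (a ∷ ps) i j = trans
      (+-cong (trans (*-congˡ (1ᴹ-lr i j)) (zeroʳ a))
        (trans (A*ᵛ-r (A *ᵛ act ps (1ᴹ (l i))) j)
          (∙-zeroʳ ((N ᵀ) j) (λ h → trans (A*ᵛ-l (act ps (1ᴹ (l i))) h) (∙-zeroʳ (N h) (act-r ps i))))))
      (+-identityʳ _)

    -- A sends values on `l` to `r` by Nᵀ and values on `r` to `l` by N, so A² acts on the values on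
    -- `l` as N Nᵀ.
    evalᴹ≈act : ∀ ps i i′ → evalᴹ ps (N *ᴹ N ᵀ) i i′ ≈ act ps (1ᴹ (l i′)) (l i)
    evalᴹ≈act []       i i′ = refl
    evalᴹ≈act (a ∷ ps) i i′ = +-cong (*-congˡ (trans (1ᴹ-sym i i′) (sym (1ᴹ-ll i′ i)))) (begin
      sum (λ h → (N *ᴹ N ᵀ) i h * evalᴹ ps (N *ᴹ N ᵀ) h i′)    ≈⟨ sum-cong-≋ (λ h → *-congˡ (evalᴹ≈act ps h i′)) ⟩
      sum (λ h → (N *ᴹ N ᵀ) i h * act ps (1ᴹ (l i′)) (l h))    ≡⟨ ∙-def ((N *ᴹ N ᵀ) i) (act ps (1ᴹ (l i′)) ∘ l) ⟨
      ((N *ᴹ N ᵀ) *ᵛ (act ps (1ᴹ (l i′)) ∘ l)) i               ≈⟨ *ᴹ-*ᵛ N (N ᵀ) (act ps (1ᴹ (l i′)) ∘ l) i ⟩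
      (N *ᵛ (N ᵀ *ᵛ (act ps (1ᴹ (l i′)) ∘ l))) i               ≈⟨ ∙-congˡ (N i) (A*ᵛ-r (act ps (1ᴹ (l i′)))) ⟨
      N i ∙ ((A *ᵛ act ps (1ᴹ (l i′))) ∘ r)                    ≈⟨ A*ᵛ-l (A *ᵛ act ps (1ᴹ (l i′))) i ⟨
      A² (act ps (1ᴹ (l i′))) (l i)                            ∎)
      where open ≈-Reasoning

    tr-evalᴹ : ∀ ps → tr (evalᴹ ps (N *ᴹ N ᵀ)) ≈ sum (λ i → act ps (1ᴹ (l i)) (l i))
    tr-evalᴹ ps = sum-cong-≋ (λ i → evalᴹ≈act ps i i)

  module RegularBipartite {v} (Γ : Graph v) (Γ-connected : Connected Γ) {k} (Γ-regular : Regular Γ k)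
    (B : Bipartition Γ) where
    open Graph Γ
    open Bipartition B

    A : Matrix v v
    A = adjacency Γ

    A-yes : ∀ {x y} → x ~ y → A x y ≈ 1#
    A-yes {x} {y} = indicator-yes (x ~? y)

    A-no : ∀ {x y} → ¬ x ~ y → A x y ≈ 0#
    A-no {x} {y} = indicator-no (x ~? y)

    A-regular : IsRegularAdjacency k A
    A-regular = record { A-sym = A-sym′ ; A-idem = A-idem′ ; 0≤A = 0≤A′ ; row-sum = row-sum′ }
      where
      A-sym′ : IsSymmetric A
      A-sym′ x y with x ~? y
      ... | yes x~y = sym (A-yes (~-sym x~y))
      ... | no ¬x~y = sym (A-no (¬x~y ∘ ~-sym))
      A-idem′ : ∀ x y → A x y * A x y ≈ A x y
      A-idem′ x y with x ~? y
      ... | yes _ = *-identityˡ 1#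
      ... | no  _ = zeroˡ 0#
      0≤A′ : ∀ x y → 0# ≤ A x y
      0≤A′ x y with x ~? y
      ... | yes _ = 0≤1
      ... | no  _ = ≤-refl
      row-sum′ : ∀ x → sum (A x) ≈ fromℕ k
      row-sum′ x = trans (sum-indicator (x ~?_) (λ y → y)) (reflexive (≡.cong fromℕ (Γ-regular x)))

    open IsRegularAdjacency A-regular
    open NonBacktracking A-regular using (κ; A*ᵛ; row-sum*)
    open Square A-sym

    split : ∀ f → sum f ≈ sum (f ∘ left) + sum (f ∘ right)
    split f = trans (sum-permute f (ordering ↔-∘ Fin.+↔⊎)) (sum-splitAt p (f ∘ Inverse.to ordering))

    to-injective : ∀ {x y} → Inverse.to ordering x ≡ Inverse.to ordering y → x ≡ y
    to-injective {x} {y} e = ≡.trans (≡.sym (Inverse.strictlyInverseʳ ordering x))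
      (≡.trans (≡.cong (Inverse.from ordering) e) (Inverse.strictlyInverseʳ ordering y))

    1ᴹ-injective : ∀ {m} {f : Fin m → Fin v} → (∀ {i j} → f i ≡ f j → i ≡ j) → ∀ i j → 1ᴹ (f i) (f j) ≈ 1ᴹ i j
    1ᴹ-injective {f = f} f-injective i j with i Fin.≟ j
    ... | yes i≡j = indicator-yes (f i Fin.≟ f j) (≡.cong f i≡j)
    ... | no  i≢j = indicator-no (f i Fin.≟ f j) (i≢j ∘ f-injective)

    N : Matrix p q
    N = biadjacency Γ B

    left≢right : ∀ i j → ¬ left i ≡ right j
    left≢right i j e with to-injective e
    ... | ()

    module Left = Blocks A-sym left right split
      (λ i i′ → A-no (left-independent i i′)) (λ j j′ → A-no (right-independent j j′))
      (1ᴹ-injective (Sum.inj₁-injective ∘ to-injective))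
      (λ i j → indicator-no (left i Fin.≟ right j) (left≢right i j))
      N (λ i j → refl)

    module Right = Blocks A-sym right left (λ f → trans (split f) (+-comm _ _))
      (λ j j′ → A-no (right-independent j j′)) (λ i i′ → A-no (left-independent i i′))
      (1ᴹ-injective (Sum.inj₂-injective ∘ to-injective))
      (λ j i → indicator-no (right j Fin.≟ left i) (left≢right i j ∘ ≡.sym))
      (N ᵀ) (λ j i → A-sym (left i) (right j))

    trace≈tr+tr : ∀ ps → trace ps ≈ tr (evalᴹ ps (N *ᴹ N ᵀ)) + tr (evalᴹ ps (N ᵀ *ᴹ N))
    trace≈tr+tr ps = trans (split (λ u → act ps (1ᴹ u) u))
      (sym (+-cong (Left.tr-evalᴹ ps) (Right.tr-evalᴹ ps)))

    side : Fin p ⊎ Fin q → Bool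
    side (inj₁ _) = true
    side (inj₂ _) = false

    colour : Fin v → Bool
    colour x = side (Inverse.from ordering x)

    colour-~ : ∀ {x y} → x ~ y → colour y ≡ not (colour x)
    colour-~ {x} {y} x~y = flip (Inverse.from ordering x) (Inverse.from ordering y)
      (≡.subst₂ _~_ (≡.sym (Inverse.strictlyInverseˡ ordering x)) (≡.sym (Inverse.strictlyInverseˡ ordering y)) x~y)
      where
      flip : ∀ a b → Inverse.to ordering a ~ Inverse.to ordering b → side b ≡ not (side a)
      flip (inj₁ i) (inj₁ i′) a~b = contradiction a~b (left-independent i i′)
      flip (inj₁ i) (inj₂ j)  a~b = ≡.refl
      flip (inj₂ j) (inj₁ i)  a~b = ≡.refl
      flip (inj₂ j) (inj₂ j′) a~b = contradiction a~b (right-independent j j′)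

    χ : Bool → Vec v
    χ b u = if does (colour u Bool.≟ b) then 1# else 0#

    -- All κ neighbours of a vertex have the opposite colour.
    A*χ : ∀ b → (A *ᵛ χ b) ≋ κ •ᵛ χ (not b)
    A*χ b x = trans (A*ᵛ (χ b) x) (trans (sum-cong-≋ entry) (row-sum* x (χ (not b) x)))
      where
      entry : ∀ y → A x y * χ b y ≈ A x y * χ (not b) x
      entry y with x ~? y
      ... | no  _   = trans (zeroˡ _) (sym (zeroˡ _))
      ... | yes x~y rewrite colour-~ x~y = *-congˡ (reflexive (≡.cong (if_then 1# else 0#) (does-not (colour x) b)))

    eigen-χ : ∀ b → Eigen (κ * κ) (χ b)
    eigen-χ b x = begin
      A² (χ b) x                    ≈⟨ *ᵛ-cong A (A*χ b) x ⟩
      (A *ᵛ (κ •ᵛ χ (not b))) x     ≈⟨ ∙-•ʳ (A x) κ (χ (not b)) ⟩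
      κ * (A *ᵛ χ (not b)) x        ≈⟨ *-congˡ (A*χ (not b) x) ⟩
      κ * (κ * χ (not (not b)) x)   ≈⟨ *-assoc κ κ _ ⟨
      κ * κ * χ (not (not b)) x     ≡⟨ ≡.cong (λ b → κ * κ * χ b x) (Bool.not-involutive b) ⟩
      κ * κ * χ b x                 ∎
      where open ≈-Reasoning

    -- Eigenvectors for κ² turn the sum over all x, w of A x w (κ y x - (A y) w)² into 0.
    module _ {y : Vec v} (A²y : Eigen (κ * κ) y) where
      private
        z = A *ᵛ y
        term : Fin v → Fin v → Carrier
        term x w = A x w * ((κ * y x - z w) * (κ * y x - z w))

        0≤term : ∀ x w → 0# ≤ term x w
        0≤term x w = *-nonNegative (0≤A x w) (0≤x² _)

        row : ∀ x → sum (term x) ≈ κ * (κ * κ * (y x * y x)) - (κ + κ) * (κ * κ) * (y x * y x) + sum (λ w → A x w * (z w * z w))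
        row x = begin
          sum (term x)
            ≈⟨ sum-cong-≋ (λ w → solve 4 (λ a k y z → a :* ((k :* y :- z) :* (k :* y :- z))
                 := a :* (k :* k :* (y :* y)) :+ :- ((k :+ k) :* y) :* (a :* z) :+ a :* (z :* z)) refl (A x w) κ (y x) (z w)) ⟩
          sum (λ w → A x w * (κ * κ * (y x * y x)) + - ((κ + κ) * y x) * (A x w * z w) + A x w * (z w * z w))
            ≈⟨ trans (∑-distrib-+ (λ w → A x w * (κ * κ * (y x * y x)) + - ((κ + κ) * y x) * (A x w * z w)) (λ w → A x w * (z w * z w)))
                 (+-congʳ (trans (∑-distrib-+ (λ w → A x w * (κ * κ * (y x * y x))) (λ w → - ((κ + κ) * y x) * (A x w * z w)))
                   (+-cong (row-sum* x _) (sym (*-distribˡ-sum (- ((κ + κ) * y x)) (λ w → A x w * z w)))))) ⟩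
          κ * (κ * κ * (y x * y x)) + - ((κ + κ) * y x) * sum (λ w → A x w * z w) + sum (λ w → A x w * (z w * z w))
            ≈⟨ +-congʳ (+-congˡ (*-congˡ (trans (sym (A*ᵛ z x)) (A²y x)))) ⟩
          κ * (κ * κ * (y x * y x)) + - ((κ + κ) * y x) * (κ * κ * y x) + sum (λ w → A x w * (z w * z w))
            ≈⟨ +-congʳ (solve 2 (λ k y → k :* (k :* k :* (y :* y)) :+ :- ((k :+ k) :* y) :* (k :* k :* y)
                 := k :* (k :* k :* (y :* y)) :- (k :+ k) :* (k :* k) :* (y :* y)) refl κ (y x)) ⟩
          κ * (κ * κ * (y x * y x)) - (κ + κ) * (κ * κ) * (y x * y x) + sum (λ w → A x w * (z w * z w)) ∎
          where open ≈-Reasoning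

        column-sums : sum (λ x → sum (λ w → A x w * (z w * z w))) ≈ κ * (κ * κ) * (y ∙ y)
        column-sums = begin
          sum (λ x → sum (λ w → A x w * (z w * z w)))   ≈⟨ ∑-comm (λ x w → A x w * (z w * z w)) ⟩
          sum (λ w → sum (λ x → A x w * (z w * z w)))
            ≈⟨ sum-cong-≋ (λ w → trans (sum-cong-≋ (λ x → *-congʳ (A-sym x w))) (row-sum* w (z w * z w))) ⟩
          sum (λ w → κ * (z w * z w))                   ≈⟨ *-distribˡ-sum κ (λ w → z w * z w) ⟨
          κ * sum (λ w → z w * z w)                     ≡⟨ ≡.cong (κ *_) (∙-def z z) ⟨
          κ * (z ∙ z)                                   ≈⟨ *-congˡ (*ᵛ-selfAdjoint A-sym y z) ⟩
          κ * (y ∙ A² y)                                ≈⟨ *-congˡ (trans (∙-congˡ y A²y) (∙-•ʳ y (κ * κ) y)) ⟩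
          κ * (κ * κ * (y ∙ y))                         ≈⟨ *-assoc κ (κ * κ) (y ∙ y) ⟨
          κ * (κ * κ) * (y ∙ y)                         ∎
          where open ≈-Reasoning

        -- With z = A y and |z|² = y·A²y = κ²|y|², the expanded square gives κ³|y|² - 2κ³|y|² +
        -- κ³|y|².
        sum-term≈0 : sum (λ x → sum (term x)) ≈ 0#
        sum-term≈0 = begin
          sum (λ x → sum (term x))
            ≈⟨ sum-cong-≋ (λ x → trans (row x) (+-congʳ (solve 2 (λ k q → k :* (k :* k :* q) :- (k :+ k) :* (k :* k) :* q
                   := :- (k :* (k :* k)) :* q)
                 refl κ (y x * y x)))) ⟩
          sum (λ x → - (κ * (κ * κ)) * (y x * y x) + sum (λ w → A x w * (z w * z w)))
            ≈⟨ ∑-distrib-+ (λ x → - (κ * (κ * κ)) * (y x * y x)) (λ x → sum (λ w → A x w * (z w * z w))) ⟩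
          sum (λ x → - (κ * (κ * κ)) * (y x * y x)) + sum (λ x → sum (λ w → A x w * (z w * z w)))
            ≈⟨ +-cong (trans (sym (*-distribˡ-sum (- (κ * (κ * κ))) (λ x → y x * y x))) (*-congˡ (reflexive (≡.sym (∙-def y y))))) column-sums ⟩
          - (κ * (κ * κ)) * (y ∙ y) + κ * (κ * κ) * (y ∙ y)
            ≈⟨ solve 2 (λ k q → :- k :* q :+ k :* q := con (+ 0)) refl (κ * (κ * κ)) (y ∙ y) ⟩
          0# ∎
          where open ≈-Reasoning

      κ*y≈A*y : ∀ {x w} → x ~ w → κ * y x ≈ (A *ᵛ y) w
      κ*y≈A*y {x} {w} x~w = x-y≈0⇒x≈y (x²≈0⇒x≈0 (begin
        d * d             ≈⟨ *-identityˡ _ ⟨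
        1# * (d * d)      ≈⟨ *-congʳ (A-yes x~w) ⟨
        term x w          ≈⟨ sum≈0⇒term≈0 (term x) (0≤term x)
                               (sum≈0⇒term≈0 (λ x → sum (term x)) (λ x → sum-nonNegative (term x) (0≤term x)) sum-term≈0 x) w ⟩
        0#                ∎))
        where
        open ≈-Reasoning
        d = κ * y x - z w

      private
        -- Along an edge, κ y at one end equals A y at the other. Reading κ y on class `b` and A y
        -- off it thus gives a function that no edge changes; it is constant by connectedness, and
        -- so y is constant on the class.
        value : Bool → Fin v → Carrier
        value b w = if does (colour w Bool.≟ b) then κ * y w else z w

        value-~ : ∀ b {w w′} → w ~ w′ → value b w ≈ value b w′
        value-~ b {w} {w′} w~w′ rewrite colour-~ w~w′ with colour w | b
        ... | true  | true  = κ*y≈A*y w~w′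
        ... | true  | false = sym (κ*y≈A*y (~-sym w~w′))
        ... | false | true  = sym (κ*y≈A*y (~-sym w~w′))
        ... | false | false = κ*y≈A*y w~w′

        value-Star : ∀ b {w w′} → Star _~_ w w′ → value b w ≈ value b w′
        value-Star b Star.ε = refl
        value-Star b (w~ Star.◅ ws) = trans (value-~ b w~) (value-Star b ws)

        value-colour : ∀ b w → colour w ≡ b → value b w ≈ κ * y w
        value-colour b w e = reflexive (≡.cong (if_then κ * y w else z w) (dec-true (colour w Bool.≟ b) e))

      class-constant : ¬ κ ≈ 0# → ∀ {u w} → colour w ≡ colour u → y w ≈ y u
      class-constant κ≉0 {u} {w} e = *-cancelˡ κ≉0 (trans (sym (value-colour (colour u) w e))
        (trans (value-Star (colour u) (Γ-connected w u)) (value-colour (colour u) u ≡.refl)))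

    module _ (κ≉0 : ¬ κ ≈ 0#) {m} {σ : Vec m} {distinct : ∀ i j → σ i ≈ σ j → i ≡ j}
      {X : Fin v → Fin m → Vec v} {eigen : ∀ u i → Eigen (σ i) (X u i)}
      {1ᴹ≋ΣX : ∀ u → 1ᴹ u ≋ (λ j → sum (λ i → X u i j))} where
      open Resolution σ distinct X eigen 1ᴹ≋ΣX

      -- For `u` in class b, X u i is constant on that class, so size b * d u = X u i · χ b = χ b u
      -- = 1. The diagonal entries of each class therefore add up to 1.
      multiplicity-κ² : ∀ i → σ i ≈ κ * κ → ∀ {u₀ u₁} → u₀ ~ u₁ → multiplicity i ≈ 1# + 1#
      multiplicity-κ² i σᵢ≈κ² {u₀} {u₁} u₀~u₁ = begin
        sum d                                              ≈⟨ sum-cong-≋ (λ u → trans (sym (*-identityˡ _)) (*-congʳ (χ-sum u))) ⟩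
        sum (λ u → (χ true u + χ false u) * d u)           ≈⟨ sum-cong-≋ (λ u → distribʳ (d u) (χ true u) (χ false u)) ⟩
        sum (λ u → χ true u * d u + χ false u * d u)       ≈⟨ ∑-distrib-+ (λ u → χ true u * d u) (λ u → χ false u * d u) ⟩
        sum (λ u → χ true u * d u) + sum (λ u → χ false u * d u) ≈⟨ +-cong (class-sum true) (class-sum false) ⟩
        1# + 1#                                            ∎
        where
        open ≈-Reasoning
        d : Vec v
        d u = X u i u

        χ-sum : ∀ u → 1# ≈ χ true u + χ false u
        χ-sum u with colour u
        ... | true  = sym (+-identityʳ 1#)
        ... | false = sym (+-identityˡ 1#)

        χ-yes : ∀ {b u} → colour u ≡ b → χ b u ≈ 1#
        χ-yes {b} {u} = indicator-yes (colour u Bool.≟ b)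

        size : Bool → Carrier
        size b = sum (χ b)

        d*size : ∀ b u → χ b u * (size b * d u) ≈ χ b u
        d*size b u with colour u Bool.≟ b
        ... | no  _ = zeroˡ _
        ... | yes colour-u = trans (*-identityˡ _) (begin
          size b * d u                     ≈⟨ *-distribʳ-sum (d u) (χ b) ⟩
          sum (λ w → χ b w * d u)          ≈⟨ sum-cong-≋ (λ w → entry w) ⟨
          sum (λ w → X u i w * χ b w)      ≡⟨ ∙-def (X u i) (χ b) ⟨
          X u i ∙ χ b                      ≈⟨ component-∙ u i (λ x → trans (eigen-χ b x) (*-congʳ (sym σᵢ≈κ²))) ⟩
          χ b u                            ≈⟨ χ-yes colour-u ⟩
          1#                               ∎)
          where
          entry : ∀ w → X u i w * χ b w ≈ χ b w * d u
          entry w with colour w Bool.≟ b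
          ... | no  _ = trans (zeroʳ _) (sym (zeroˡ _))
          ... | yes colour-w = trans (*-comm _ _) (*-congˡ (class-constant
                  (λ x → trans (eigen u i x) (*-congʳ σᵢ≈κ²)) κ≉0 (≡.trans colour-w (≡.sym colour-u))))

        -- The edge has an end in each class, so neither size is zero and both can be cancelled.
        witness : ∀ b → ∃[ w ] colour w ≡ b
        witness b with colour u₀ Bool.≟ b
        ... | yes e = u₀ , e
        ... | no  e = u₁ , ≡.trans (colour-~ u₀~u₁) (≡.sym (Bool.¬-not (e ∘ ≡.sym)))

        size≉0 : ∀ b → ¬ size b ≈ 0#
        size≉0 b size≈0 = 0≉1 (trans (sym (sum≈0⇒term≈0 (χ b) 0≤χ size≈0 (proj₁ (witness b)))) (χ-yes (proj₂ (witness b))))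
          where
          0≤χ : ∀ u → 0# ≤ χ b u
          0≤χ u with colour u Bool.≟ b
          ... | yes _ = 0≤1
          ... | no  _ = ≤-refl

        class-sum : ∀ b → sum (λ u → χ b u * d u) ≈ 1#
        class-sum b = *-cancelˡ (size≉0 b) (begin
          size b * sum (λ u → χ b u * d u)     ≈⟨ *-distribˡ-sum (size b) (λ u → χ b u * d u) ⟩
          sum (λ u → size b * (χ b u * d u))
            ≈⟨ sum-cong-≋ (λ u → trans (solve 3 (λ s c d → s :* (c :* d) := c :* (s :* d))
                 refl (size b) (χ b u) (d u)) (d*size b u)) ⟩
          sum (χ b)                            ≈⟨ *-identityʳ _ ⟨
          size b * 1#                          ∎)

  -- The linear programming bound

  eval-cong : ∀ ps {x y} → x ≈ y → eval ps x ≈ eval ps y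
  eval-cong []       x≈y = refl
  eval-cong (a ∷ ps) x≈y = +-congˡ (*-cong x≈y (eval-cong ps x≈y))

  x*x≈y*y⇒x≈y : ∀ {x y} → 0# ≤ x → 0# ≤ y → x * x ≈ y * y → x ≈ y
  x*x≈y*y⇒x≈y {x} {y} 0≤x 0≤y x²≈y² with x + y ≟ 0#
  ... | yes x+y≈0 = trans (x+y≈0⇒x≈0 0≤x 0≤y x+y≈0) (sym (x+y≈0⇒x≈0 0≤y 0≤x (trans (+-comm y x) x+y≈0)))
  ... | no  x+y≉0 = x-y≈0⇒x≈y (x*y≈0 x+y≉0 (trans
    (solve 2 (λ x y → (x :+ y) :* (x :- y) := x :* x :- y :* y) refl x y) (x≈y⇒x-y≈0 x²≈y²)))

  tr-• : ∀ {n} a (M : Matrix n n) → tr (a •ᴹ M) ≈ a * tr M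
  tr-• a M = sym (*-distribˡ-sum a (λ i → M i i))

  -- Writing the degree as `2 ℕ.+ k` builds in that it is at least 2; κ is `fromℕ (2 ℕ.+ k)`.
  module LinearProgramming {v} (Γ : Graph v) (Γ-connected : Connected Γ) {k} (Γ-regular : Regular Γ (2 ℕ.+ k))
    (B : Bipartition Γ) where
    open Graph Γ
    open RegularBipartite Γ Γ-connected Γ-regular B
    open IsRegularAdjacency A-regular
    open NonBacktracking A-regular
    open Square A-sym
    open SquarePolynomials A-sym

    κ≉0 : ¬ κ ≈ 0#
    κ≉0 κ≈0 = proj₂ (fromℕ-pos (suc k)) (sym κ≈0)

    -- If y had no neighbour besides x, its row sum κ would be A y x ≤ 1, against κ ≥ 2.
    onward : ∀ x y → ∃[ z ] y ~ z × ¬ z ≡ x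
    onward x y with Fin.any? (λ z → (y ~? z) ×-dec ¬? (z Fin.≟ x))
    ... | yes found = found
    ... | no  none = contradiction (antisym (proj₁ 0<1+k) (begin
        1# + fromℕ k             ≈⟨ solve 2 (λ o w → w := o :+ w :- o) refl 1# (1# + fromℕ k) ⟩
        κ - 1#                   ≈⟨ +-congʳ (row-sum y) ⟨
        sum (A y) - 1#           ≈⟨ +-congʳ (sum-single (A y) x (λ z z≢x → A-no (λ y~z → none (z , y~z , z≢x)))) ⟩
        A y x - 1#               ≤⟨ +-monoˡ-≤ (- 1#) Ayx≤1 ⟩
        1# - 1#                  ≈⟨ -‿inverseʳ 1# ⟩
        0#                       ∎)) (proj₂ 0<1+k)
      where
      open ≤-Reasoning
      0<1+k = fromℕ-pos k
      Ayx≤1 : A y x ≤ 1#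
      Ayx≤1 with y ~? x
      ... | yes _ = ≤-refl
      ... | no  _ = 0≤1

    -- Following the path to `z` never turns back, since vertices two steps apart are distinct. It
    -- has length 2 + `length ys`, and an index of `walk` is one less than the length.
    path-pos : ∀ z x y ys → Linked _~_ (x ∷ y ∷ (ys ∷ʳ z)) → Unique (x ∷ y ∷ ys) →
               All (λ u → ¬ z ≡ u) (x ∷ y ∷ ys) → 0# < walk z (suc (length ys)) x y
    path-pos z x y [] (x~y ∷ y~z ∷ _) u (z≢x ∷ _) =
      walk-pos-step z 0 (A-yes x~y) z≢x (walk-pos-base (A-yes y~z))
    path-pos z x y (y′ ∷ ys) (x~y ∷ l) ((_ ∷ x≢y′ ∷ _) ∷ u) (_ ∷ z∉) =
      walk-pos-step z (suc (length ys)) (A-yes x~y) (x≢y′ ∘ ≡.sym) (path-pos z y y′ ys l u z∉)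

    -- The cycle itself, run through once, is a closed non-backtracking walk; `proper` excludes the
    -- lengths 1 and 2.
    cycle-pos : (C : Cycle Γ) → 0# < walks (Cycle.start C) (Cycle.cycleLength C) (Cycle.start C)
    cycle-pos record { start = s ; rest = [] ; proper = s≤s () }
    cycle-pos record { start = s ; rest = _ ∷ [] ; proper = s≤s (s≤s ()) }
    cycle-pos record { start = s ; rest = x ∷ y ∷ ys ; distinct = (s≢x ∷ s≢y ∷ s∉) ∷ u ; closed = s~x ∷ l } =
      let 0≤w , 0≉w = walk-pos-step s (suc (length ys)) (A-yes s~x) (s≢y ∘ ≡.sym) (path-pos s x y ys l u (s≢x ∷ s≢y ∷ s∉))
          w≤sum = term≤sum (walk s (length (x ∷ y ∷ ys)) s) (0≤walk s (length (x ∷ y ∷ ys)) s) x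
      in ≤-trans 0≤w w≤sum , λ 0≈sum → 0≉w (antisym 0≤w (≤-respʳ-≈ (sym 0≈sum) w≤sum))

    traceᴸ traceᴿ : ℕ → Carrier
    traceᴸ j = tr (evalᴹ (𝓕 (2 ℕ.+ k) j) (N *ᴹ N ᵀ))
    traceᴿ j = tr (evalᴹ (𝓕 (2 ℕ.+ k) j) (N ᵀ *ᴹ N))

    0≤act-𝓕 : ∀ j u → 0# ≤ act (𝓕 (2 ℕ.+ k) j) (1ᴹ u) u
    0≤act-𝓕 j u = ≤-respʳ-≈ (sym (act-𝓕 u j u)) (0≤walks u (j ℕ.* 2) u)

    0≤traceᴸ : ∀ j → 0# ≤ traceᴸ j
    0≤traceᴸ j = ≤-respʳ-≈ (sym (Left.tr-evalᴹ (𝓕 (2 ℕ.+ k) j)))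
      (sum-nonNegative _ (λ i → 0≤act-𝓕 j (Bipartition.left B i)))

    0≤traceᴿ : ∀ j → 0# ≤ traceᴿ j
    0≤traceᴿ j = ≤-respʳ-≈ (sym (Right.tr-evalᴹ (𝓕 (2 ℕ.+ k) j)))
      (sum-nonNegative _ (λ i → 0≤act-𝓕 j (Bipartition.right B i)))

    trace-𝓕₀ : trace (𝓕 (2 ℕ.+ k) 0) ≈ fromℕ v
    trace-𝓕₀ = trans (sum-cong-≋ (λ u → trans (act-𝓕 u 0 u) (indicator-yes (u Fin.≟ u) ≡.refl))) (sum-replicate v)

    -- A vanishing trace with nonnegative diagonal has zero diagonal, but the entry at the start of
    -- such a cycle is positive.
    trace≈0⇒cycleLength≢ : ∀ j → trace (𝓕 (2 ℕ.+ k) j) ≈ 0# → (C : Cycle Γ) → ¬ Cycle.cycleLength C ≡ j ℕ.* 2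
    trace≈0⇒cycleLength≢ j tr≈0 C l≡2j = proj₂ (cycle-pos C) (sym (begin
      walks s (Cycle.cycleLength C) s        ≡⟨ ≡.cong (λ l → walks s l s) l≡2j ⟩
      walks s (j ℕ.* 2) s                    ≈⟨ act-𝓕 s j s ⟨
      act (𝓕 (2 ℕ.+ k) j) (1ᴹ s) s           ≈⟨ sum≈0⇒term≈0 (λ u → act (𝓕 (2 ℕ.+ k) j) (1ᴹ u) u) (0≤act-𝓕 j) tr≈0 s ⟩
      0#                                     ∎))
      where
      open ≈-Reasoning
      s = Cycle.start C

    trace-combination : ∀ {t} (a : Vec t) →
                        trace (𝓕-combination (2 ℕ.+ k) a) ≈ sum (λ j → a j * trace (𝓕 (2 ℕ.+ k) (toℕ j)))
    trace-combination a = begin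
      sum (λ u → act (𝓕-combination (2 ℕ.+ k) a) (1ᴹ u) u)
        ≈⟨ sum-cong-≋ (λ u → trans (act-sumₚ (λ j → a j •ₚ P j) (1ᴹ u) u)
             (sum-cong-≋ (λ j → act-• (a j) (P j) (1ᴹ u) u))) ⟩
      sum (λ u → sum (λ j → a j * act (P j) (1ᴹ u) u))
        ≈⟨ ∑-comm (λ u j → a j * act (P j) (1ᴹ u) u) ⟩
      sum (λ j → sum (λ u → a j * act (P j) (1ᴹ u) u))
        ≈⟨ sum-cong-≋ (λ j → *-distribˡ-sum (a j) (λ u → act (P j) (1ᴹ u) u)) ⟨
      sum (λ j → a j * trace (P j)) ∎
      where
      open ≈-Reasoning
      P = λ j → 𝓕 (2 ℕ.+ k) (toℕ j)

    module _ {d} (τ : Vec (suc d)) (spectrum : IsSymmetricSpectrum Γ τ) (τ₀≈κ : τ zero ≈ κ) where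

      σ : Vec (suc d)
      σ i = τ i * τ i

      σ-distinct : ∀ i j → σ i ≈ σ j → i ≡ j
      σ-distinct i j σᵢ≈σⱼ = proj₁ (proj₂ spectrum) i j
        (x*x≈y*y⇒x≈y (proj₁ spectrum i) (proj₁ spectrum j) σᵢ≈σⱼ)

      eigenvalue-² : ∀ θ x → ¬ x ≋ 0ᵛ → (A *ᵛ x) ≋ θ •ᵛ x → ∃[ j ] θ * θ ≈ σ j
      eigenvalue-² θ x x≋̸0 Ax≋θx with Equivalence.to (proj₂ (proj₂ spectrum) θ)
        (x , x≋̸0 , λ i → trans (sym (A*ᵛ x i)) (Ax≋θx i))
      ... | j , inj₁ θ≈τ  = j , *-cong θ≈τ θ≈τ
      ... | j , inj₂ θ≈-τ = j , trans (*-cong θ≈-τ θ≈-τ) (solve 1 (λ t → :- t :* :- t := t :* t) refl (τ j))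

      eigenvector : ∀ i → Σ[ x ∈ Vec v ] ¬ x ≋ 0ᵛ × Eigen (σ i) x
      eigenvector i with Equivalence.from (proj₂ (proj₂ spectrum) (τ i)) (i , inj₁ refl)
      ... | x , x≋̸0 , Ax≋τx = x , x≋̸0 , λ h → begin
        A² x h                  ≈⟨ *ᵛ-cong A (λ j → trans (A*ᵛ x j) (Ax≋τx j)) h ⟩
        (A *ᵛ (τ i •ᵛ x)) h     ≈⟨ ∙-•ʳ (A h) (τ i) x ⟩
        τ i * (A *ᵛ x) h        ≈⟨ *-congˡ (trans (A*ᵛ x h) (Ax≋τx h)) ⟩
        τ i * (τ i * x h)       ≈⟨ *-assoc (τ i) (τ i) (x h) ⟨
        σ i * x h               ∎
        where open ≈-Reasoning

      -- Nothing so far excludes an empty graph; a nonzero entry of an eigenvector for `τ zero`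
      -- marks a vertex.
      vertex : Fin v
      vertex = let x , x≋̸0 , _ = eigenvector zero in proj₁ (≉0⇒entry≉0 {x = x} x≋̸0)

      -- The multiplicities, packed with their properties so that `Bound` can treat them as abstract
      -- weights.
      weights : Σ[ μ ∈ Vec (suc d) ] μ zero ≈ 1# + 1# × (∀ i → 0# < μ i) ×
                (∀ ps → trace ps ≈ sum (λ i → eval ps (σ i) * μ i))
      weights = multiplicity ,
        multiplicity-κ² κ≉0 {distinct = σ-distinct} {eigen = eigen} {1ᴹ≋ΣX = 1ᴹ≋ΣX} zero
          (*-cong τ₀≈κ τ₀≈κ) (proj₁ (proj₂ (onward vertex vertex))) ,
        (λ i → let y , y≋̸0 , Ay = eigenvector i in multiplicity-pos i y y≋̸0 Ay) , trace-formula
        where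
        component : ∀ u → Σ[ X ∈ (Fin (suc d) → Vec v) ] (∀ i → Eigen (σ i) (X i)) × 1ᴹ u ≋ (λ j → sum (λ i → X i j))
        component u = decompose σ σ-distinct (1ᴹ u) (annihilate≋0 σ eigenvalue-² (1ᴹ u))
        X : Fin v → Fin (suc d) → Vec v
        X u = proj₁ (component u)
        eigen : ∀ u i → Eigen (σ i) (X u i)
        eigen u = proj₁ (proj₂ (component u))
        1ᴹ≋ΣX : ∀ u → 1ᴹ u ≋ (λ j → sum (λ i → X u i j))
        1ᴹ≋ΣX u = proj₂ (proj₂ (component u))
        open Resolution σ σ-distinct X eigen 1ᴹ≋ΣX

      module Bound {t} (a : Vec (suc t))
        (f≤0 : ∀ i → eval (𝓕-combination (2 ℕ.+ k) a) (σ (suc i)) ≤ 0#)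
        (0<a₀ : 0# < a zero) (0≤a : ∀ j → 0# ≤ a (suc j))
        (μ : Vec (suc d)) (μ₀≈2 : μ zero ≈ 1# + 1#) (0<μ : ∀ i → 0# < μ i)
        (trace-formula : ∀ ps → trace ps ≈ sum (λ i → eval ps (σ i) * μ i)) where

        f : Poly
        f = 𝓕-combination (2 ℕ.+ k) a

        f[κ²] bound : Carrier
        f[κ²] = eval f (κ * κ)
        bound = fromℕ 2 * f[κ²] / a zero

        spectral : Vec d
        spectral i = eval f (σ (suc i)) * μ (suc i)

        combinatorial : Vec t
        combinatorial j = a (suc j) * trace (𝓕 (2 ℕ.+ k) (toℕ (suc j)))

        0≤-spectral : ∀ i → 0# ≤ - spectral i
        0≤-spectral i = ≤-respʳ-≈ (solve 2 (λ e m → :- e :* m := :- (e :* m)) refl (eval f (σ (suc i))) (μ (suc i)))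
          (*-nonNegative (x≤0⇒0≤-x (f≤0 i)) (proj₁ (0<μ (suc i))))

        combinatorial≈ : ∀ j → combinatorial j ≈ a (suc j) * traceᴸ (toℕ (suc j)) + a (suc j) * traceᴿ (toℕ (suc j))
        combinatorial≈ j = trans (*-congˡ (trace≈tr+tr (𝓕 (2 ℕ.+ k) (toℕ (suc j))))) (distribˡ _ _ _)

        0≤aᴸ : ∀ j → 0# ≤ a (suc j) * traceᴸ (toℕ (suc j))
        0≤aᴸ j = *-nonNegative (0≤a j) (0≤traceᴸ (toℕ (suc j)))

        0≤aᴿ : ∀ j → 0# ≤ a (suc j) * traceᴿ (toℕ (suc j))
        0≤aᴿ j = *-nonNegative (0≤a j) (0≤traceᴿ (toℕ (suc j)))

        0≤combinatorial : ∀ j → 0# ≤ combinatorial j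
        0≤combinatorial j = ≤-respʳ-≈ (sym (combinatorial≈ j)) (+-nonNegative (0≤aᴸ j) (0≤aᴿ j))

        -- The difference 2 f(κ²) - v a₀ as a sum of nonnegative terms: the bound says that it is
        -- nonnegative, and equality that every term vanishes.
        slack : Carrier
        slack = sum combinatorial + sum (λ i → - spectral i)

        0≤slack : 0# ≤ slack
        0≤slack = +-nonNegative (sum-nonNegative combinatorial 0≤combinatorial) (sum-nonNegative (λ i → - spectral i) 0≤-spectral)

        v*a₀+slack : fromℕ v * a zero + slack ≈ fromℕ 2 * f[κ²]
        v*a₀+slack = begin
          fromℕ v * a zero + slack
            ≈⟨ +-cong (trans (*-comm _ _) (*-congˡ (sym trace-𝓕₀))) (+-congˡ (sum-neg spectral)) ⟩
          a zero * trace (𝓕 (2 ℕ.+ k) 0) + (sum combinatorial - sum spectral)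
            ≈⟨ +-assoc _ _ _ ⟨
          sum (λ j → a j * trace (𝓕 (2 ℕ.+ k) (toℕ j))) - sum spectral
            ≈⟨ +-congʳ (trans (sym (trace-combination a)) (trace-formula f)) ⟩
          eval f (σ zero) * μ zero + sum spectral - sum spectral
            ≈⟨ +-congʳ (+-congʳ (*-cong (eval-cong f (*-cong τ₀≈κ τ₀≈κ)) μ₀≈2)) ⟩
          f[κ²] * (1# + 1#) + sum spectral - sum spectral
            ≈⟨ solve 2 (λ e s → let 𝟙 = con (+ 1) in e :* (𝟙 :+ 𝟙) :+ s :- s := (𝟙 :+ (𝟙 :+ con (+ 0))) :* e)
                 refl f[κ²] (sum spectral) ⟩
          fromℕ 2 * f[κ²] ∎
          where open ≈-Reasoning

        v≤bound : fromℕ v ≤ bound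
        v≤bound = x≤y*z⁻¹ 0<a₀ (begin
          fromℕ v * a zero            ≈⟨ +-identityʳ _ ⟨
          fromℕ v * a zero + 0#       ≤⟨ +-mono-≤ ≤-refl 0≤slack ⟩
          fromℕ v * a zero + slack    ≈⟨ v*a₀+slack ⟩
          fromℕ 2 * f[κ²]             ∎)
          where open ≤-Reasoning

        a₀≉0 : ¬ a zero ≈ 0#
        a₀≉0 = proj₂ 0<a₀ ∘ sym

        bound*a₀ : bound * a zero ≈ fromℕ 2 * f[κ²]
        bound*a₀ = trans (solve 3 (λ y w z → y :* w :* z := y :* (z :* w)) refl (fromℕ 2 * f[κ²]) (a zero ⁻¹) (a zero))
          (trans (*-congˡ (*-inverseʳ (a zero) a₀≉0)) (*-identityʳ _))

        equality⇒slack≈0 : fromℕ v ≈ bound → slack ≈ 0#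
        equality⇒slack≈0 v≈bound = begin
          slack                                           ≈⟨ solve 2 (λ x s → s := x :+ s :- x) refl (fromℕ v * a zero) slack ⟩
          fromℕ v * a zero + slack - fromℕ v * a zero
            ≈⟨ x≈y⇒x-y≈0 (trans v*a₀+slack (trans (sym bound*a₀) (*-congʳ (sym v≈bound)))) ⟩
          0#                                              ∎
          where open ≈-Reasoning

        slack≈0⇒equality : slack ≈ 0# → fromℕ v ≈ bound
        slack≈0⇒equality slack≈0 = *-cancelˡ a₀≉0 (begin
          a zero * fromℕ v            ≈⟨ *-comm _ _ ⟩
          fromℕ v * a zero            ≈⟨ +-identityʳ _ ⟨
          fromℕ v * a zero + 0#       ≈⟨ +-congˡ slack≈0 ⟨
          fromℕ v * a zero + slack    ≈⟨ trans v*a₀+slack (sym bound*a₀) ⟩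
          bound * a zero              ≈⟨ *-comm _ _ ⟩
          a zero * bound              ∎)
          where open ≈-Reasoning

        Tight : Set _
        Tight = (∀ i → eval f (σ (suc i)) ≈ 0#) ×
          (∀ j → (tr (a (suc j) •ᴹ evalᴹ (𝓕 (2 ℕ.+ k) (toℕ (suc j))) (N *ᴹ N ᵀ)) ≈ 0#) ×
                 (tr (a (suc j) •ᴹ evalᴹ (𝓕 (2 ℕ.+ k) (toℕ (suc j))) (N ᵀ *ᴹ N)) ≈ 0#))

        slack≈0⇒tight : slack ≈ 0# → Tight
        slack≈0⇒tight slack≈0 = f≈0 , λ j →
            trans (tr-• _ (evalᴹ (𝓕 (2 ℕ.+ k) (toℕ (suc j))) (N *ᴹ N ᵀ))) (x+y≈0⇒x≈0 (0≤aᴸ j) (0≤aᴿ j) (combinatorial≈0 j))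
          , trans (tr-• _ (evalᴹ (𝓕 (2 ℕ.+ k) (toℕ (suc j))) (N ᵀ *ᴹ N))) (x+y≈0⇒x≈0 (0≤aᴿ j) (0≤aᴸ j) (trans (+-comm _ _) (combinatorial≈0 j)))
          where
          0≤C = sum-nonNegative combinatorial 0≤combinatorial
          0≤S = sum-nonNegative (λ i → - spectral i) 0≤-spectral

          combinatorial≈0 : ∀ j → a (suc j) * traceᴸ (toℕ (suc j)) + a (suc j) * traceᴿ (toℕ (suc j)) ≈ 0#
          combinatorial≈0 j = trans (sym (combinatorial≈ j))
            (sum≈0⇒term≈0 combinatorial 0≤combinatorial (x+y≈0⇒x≈0 0≤C 0≤S slack≈0) j)

          f≈0 : ∀ i → eval f (σ (suc i)) ≈ 0#
          f≈0 i = x*y≈0 (proj₂ (0<μ (suc i)) ∘ sym) (begin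
            μ (suc i) * eval f (σ (suc i))   ≈⟨ solve 2 (λ m e → m :* e := :- :- (e :* m)) refl (μ (suc i)) (eval f (σ (suc i))) ⟩
            - - spectral i                   ≈⟨ -‿cong (sum≈0⇒term≈0 (λ i → - spectral i) 0≤-spectral
                                                  (x+y≈0⇒x≈0 0≤S 0≤C (trans (+-comm _ _) slack≈0)) i) ⟩
            - 0#                             ≈⟨ solve 0 (:- con (+ 0) := con (+ 0)) refl ⟩
            0#                               ∎)
            where open ≈-Reasoning

        tight⇒combinatorial≈0 : Tight → ∀ j → combinatorial j ≈ 0#
        tight⇒combinatorial≈0 (_ , tr≈0) j = trans (combinatorial≈ j) (trans
          (+-cong (trans (sym (tr-• _ (evalᴹ (𝓕 (2 ℕ.+ k) (toℕ (suc j))) (N *ᴹ N ᵀ)))) (proj₁ (tr≈0 j)))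
                  (trans (sym (tr-• _ (evalᴹ (𝓕 (2 ℕ.+ k) (toℕ (suc j))) (N ᵀ *ᴹ N)))) (proj₂ (tr≈0 j))))
          (+-identityˡ 0#))

        tight⇒slack≈0 : Tight → slack ≈ 0#
        tight⇒slack≈0 tight = trans
          (+-cong (sum-zero combinatorial (tight⇒combinatorial≈0 tight))
            (sum-zero (λ i → - spectral i) (λ i → trans (-‿cong (trans (*-congʳ (proj₁ tight i)) (zeroˡ _)))
              (solve 0 (:- con (+ 0) := con (+ 0)) refl))))
          (+-identityˡ 0#)

        equality⇔tight : fromℕ v ≈ bound ⇔ Tight
        equality⇔tight = mk⇔ (slack≈0⇒tight ∘ equality⇒slack≈0) (slack≈0⇒equality ∘ tight⇒slack≈0)

        tight⇒trace≈0 : Tight → (∀ j → 0# < a (suc j)) → ∀ (j : Fin t) → trace (𝓕 (2 ℕ.+ k) (toℕ (suc j))) ≈ 0#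
        tight⇒trace≈0 tight 0<a j = x*y≈0 (proj₂ (0<a j) ∘ sym) (tight⇒combinatorial≈0 tight j)

        girth-bound : Tight → (∀ j → 0# < a (suc j)) → ∃[ g ] IsGirth Γ g × (2 ℕ.* t ℕ.+ 2 ℕ.≤ g)
        girth-bound tight 0<a with girth-exists Γ (cycle-exists Γ onward vertex)
        ... | g , (C , length≡g) , minimal = g , ((C , length≡g) , minimal) ,
          ≡.subst (2 ℕ.* t ℕ.+ 2 ℕ.≤_) length≡g (long (even-cycle Γ colour colour-~ C))
          where
          long : (∃[ j ] Cycle.cycleLength C ≡ j ℕ.* 2) → 2 ℕ.* t ℕ.+ 2 ℕ.≤ Cycle.cycleLength C
          long (zero , length≡0) = contradiction (≡.subst (3 ℕ.≤_) length≡0 (Cycle.proper C)) λ ()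
          long (suc j , length≡2j) with suc j ℕ.≤? t
          -- `suc j ℕ.≤ t` is `j ℕ.< t` by definition, so it yields the index of the coefficient of
          -- 𝓕 with index j + 1.
          ... | yes j<t = contradiction length≡2j (trace≈0⇒cycleLength≢ (suc j)
            (≡.subst (λ j → trace (𝓕 (2 ℕ.+ k) (suc j)) ≈ 0#) (Fin.toℕ-fromℕ< j<t) (tight⇒trace≈0 tight 0<a (fromℕ< j<t))) C)
          -- Otherwise t + 1 ≤ j + 1, and doubling gives 2t + 2 at most the length.
          ... | no  j≮t = ≡.subst₂ ℕ._≤_
            (≡.trans (ℕ.+-comm 2 (t ℕ.* 2)) (≡.cong (ℕ._+ 2) (ℕ.*-comm t 2))) (≡.sym length≡2j)
            (ℕ.*-monoˡ-≤ 2 (ℕ.≰⇒> j≮t))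

open import Defs

theorem3p1 :
  ∀ {c ℓ₁ ℓ₂} {{ℝ : Reals c ℓ₁ ℓ₂}} →
  (k : ℕ) → 2 ℕ.≤ k →
  (v : ℕ) (Γ : Graph v) → Connected Γ → Regular Γ k →
  (B : Bipartition Γ) → let N = biadjacency Γ B in
  (d : ℕ) (τ : Vector Carrier (suc d)) →
  IsSymmetricSpectrum Γ τ →
  τ zero ≈ fromℕ k →
  (t : ℕ) (a : Vector Carrier (suc t)) →
  let f = 𝓕-combination k a
      f[k²] = eval f (fromℕ k * fromℕ k) in
  0# < f[k²] →
  (∀ (i : Fin d) → eval f (τ (suc i) * τ (suc i)) ≤ 0#) →
  0# < a zero →
  (∀ (j : Fin t) → 0# ≤ a (suc j)) →
  let bound = fromℕ 2 * f[k²] / a zero in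
  (fromℕ v ≤ bound) ×
  (fromℕ v ≈ bound ⇔
    ((∀ (i : Fin d) → eval f (τ (suc i) * τ (suc i)) ≈ 0#) ×
     (∀ (j : Fin t) →
       (tr (a (suc j) •ᴹ evalᴹ (𝓕 k (toℕ (suc j))) (N *ᴹ N ᵀ)) ≈ 0#) ×
       (tr (a (suc j) •ᴹ evalᴹ (𝓕 k (toℕ (suc j))) (N ᵀ *ᴹ N)) ≈ 0#)))) ×
  (fromℕ v ≈ bound → (∀ (j : Fin t) → 0# < a (suc j)) →
    ∃[ g ] IsGirth Γ g × (2 ℕ.* t ℕ.+ 2 ℕ.≤ g))
theorem3p1 {{ℝ}} (suc (suc k)) (s≤s (s≤s z≤n)) v Γ Γ-connected Γ-regular B d τ spectrum τ₀≈k t a _ f≤0 0<a₀ 0≤a =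
  let open Analysis.LinearProgramming ℝ Γ Γ-connected Γ-regular B
      μ , μ₀≈2 , 0<μ , trace-formula = weights τ spectrum τ₀≈k
      open Bound τ spectrum τ₀≈k a f≤0 0<a₀ 0≤a μ μ₀≈2 0<μ trace-formula
  in v≤bound , equality⇔tight ,
     λ equality → girth-bound (Equivalence.to equality⇔tight equality)
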